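{- Let $(W,S)$ be any Coxeter system (with $W$ finite or infinite) and let $\gamma\in W$ be any Coxeter element. Then every closed interval $[u,v]_{\gamma}=\{x\in C_{\gamma}\mid u\leq_{\gamma}x\leq_{\gamma}v\}$ (with $u,v\in C_\gamma$, $u\leq_\gamma v$) of the $\gamma$-Cambrian semilattice $\mathcal{C}_{\gamma}$ is a trim lattice. In particular, every graded closed interval of $\mathcal{C}_{\gamma}$ is a distributive lattice.
   Context: A Coxeter system $(W,S)$, $S=\{s_1,\dots,s_n\}$, is a group $W$ with presentation $\langle S\mid (s_is_j)^{m_{i,j}}=\varepsilon\rangle$, where $m_{i,i}=1$, $m_{i,j}=m_{j,i}\in\{2,3,\dots\}\cup\{\infty\}$ for $i\neq j$ ($\infty$ meaning no relation). $\ell_S(w)$ is the minimal length of a word in $S$ representing $w$; such a word of minimal length is a reduced word. The (right) weak order is $u\leq_S v$ iff $\ell_S(v)=\ell_S(u)+\ell_S(u^{ -1}v)$. A Coxeter element is an element $\gamma$ having a reduced word that is a permutation of $S$; write $\gamma=s_1s_2\cdots s_n$ for such a reduced word and consider the half-infinite word $\gamma^\infty=s_1\cdots s_n\,|\,s_1\cdots s_n\,|\,s_1\cdots$, divided into blocks (the copies of $s_1\cdots s_n$). Every reduced word of $w\in W$ can be viewed as a subword of $\gamma^\infty$; the $\gamma$-sorting word of $w$ is the reduced word of $w$ that is lexicographically first as a subword of $\gamma^\infty$. The element $w$ is $\gamma$-sortable if the sets of letters used by the $\gamma$-sorting word in the successive blocks form a weakly decreasing sequence under inclusion. $C_\gamma$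 is the set of $\gamma$-sortable elements (it does not depend on the chosen reduced word of $\gamma$), and $\mathcal{C}_\gamma=(C_\gamma,\leq_\gamma)$, with $\leq_\gamma$ the restriction of the weak order, is the $\gamma$-Cambrian semilattice; its closed intervals are finite lattices. For a finite lattice $\mathcal L$: its length is the maximum length of a chain; $x$ is join-irreducible (resp. meet-irreducible) if it has exactly one lower (resp. upper) cover; $x$ is left-modular if $(y\vee x)\wedge z=y\vee(x\wedge z)$ for all $y<z$. $\mathcal L$ of length $k$ is trim if it has a maximal chain $\hat0=x_0\lessdot x_1\lessdot\cdots\lessdot x_k=\hat1$ of left-modular elements and has exactly $k$ join-irreducible and exactly $k$ meet-irreducible elements. -}

module Defs where

open import Data.Nat using (ℕ; zero; suc; _+_) renaming (_<_ to _<ℕ_; _≤_ to _≤ℕ_)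
open import Data.Fin using (Fin; inject₁; fromℕ) renaming (_<_ to _<F_; zero to fzero; suc to fsuc)
open import Data.List using (List; []; _∷_; _++_; length; map; reverse; concat; replicate; allFin)
open import Data.List.Membership.Propositional using (_∈_)
open import Data.List.Relation.Unary.All using (All)
open import Data.List.Relation.Unary.Any using (Any)
open import Data.List.Relation.Unary.AllPairs using (AllPairs)
open import Data.Maybe using (Maybe; just; nothing)
open import Data.Product using (Σ; _×_; _,_; proj₁)
open import Data.Sum using (_⊎_)
open import Relation.Binary.PropositionalEquality using (_≡_; _≢_)
open import Relation.Binary.Structures using (IsPartialOrder)
open import Relation.Nullary using (¬_)

-- Coxeter matrices on the generating set S = Fin n.
-- m i j = nothing means m_{i,j} = ∞ (no relation).

record CoxeterMatrix (n : ℕ) : Set where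
  field
    m        : Fin n → Fin n → Maybe ℕ
    m-diag   : ∀ i → m i i ≡ just 1
    m-sym    : ∀ i j → m i j ≡ m j i
    m-off    : ∀ i j → i ≢ j → ∀ k → m i j ≡ just k → 2 ≤ℕ k

Word : ℕ → Set
Word n = List (Fin n)

alt : ∀ {n} → Fin n → Fin n → ℕ → Word n
alt i j k = concat (replicate k (i ∷ j ∷ []))

-- The Coxeter group W, elements represented by words in S,
-- equality of elements = the congruence generated by the relations.

module Coxeter {n : ℕ} (M : CoxeterMatrix n) where
  open CoxeterMatrix M

  infix 4 _~_
  data _~_ : Word n → Word n → Set where
    rel   : ∀ i j k → m i j ≡ just k → alt i j k ~ []
    ~refl : ∀ {x} → x ~ x
    ~sym  : ∀ {x y} → x ~ y → y ~ x
    ~trans : ∀ {x y z} → x ~ y → y ~ z → x ~ z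
    ~cong : ∀ a b {x y} → x ~ y → a ++ x ++ b ~ a ++ y ++ b

  IsLen : Word n → ℕ → Set
  IsLen w k = Σ (Word n) (λ v → v ~ w × length v ≡ k)
            × (∀ v → v ~ w → k ≤ℕ length v)

  Reduced : Word n → Set
  Reduced w = ∀ v → v ~ w → length w ≤ℕ length v

  -- inverse of an element (generators are involutions)
  inv : Word n → Word n
  inv = reverse

  WeakLe : Word n → Word n → Set
  WeakLe u v = Σ ℕ λ lu → Σ ℕ λ lv → Σ ℕ λ ld →
    IsLen u lu × IsLen v lv × IsLen (inv u ++ v) ld × lv ≡ lu + ld

  -- Coxeter element γ = c(0) c(1) ⋯ c(n-1), given by an injective
  -- c : Fin n → Fin n (a permutation of S).
  cword : (Fin n → Fin n) → Word n
  cword c = map c (allFin n)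

  -- positions in γ^∞: (block number, index inside the block)
  Pos : Set
  Pos = ℕ × Fin n

  _<P_ : Pos → Pos → Set
  (k , i) <P (k' , i') = (k <ℕ k') ⊎ (k ≡ k' × i <F i')

  letter : (Fin n → Fin n) → Pos → Fin n
  letter c (k , i) = c i

  -- a subword of γ^∞ = strictly increasing list of positions
  Increasing : List Pos → Set
  Increasing = AllPairs _<P_

  data LexLe : List Pos → List Pos → Set where
    lex-[] : LexLe [] []
    lex-<  : ∀ {p q ps qs} → p <P q → LexLe (p ∷ ps) (q ∷ qs)
    lex-≡  : ∀ {p ps qs} → LexLe ps qs → LexLe (p ∷ ps) (p ∷ qs)

  IsSortingWord : (Fin n → Fin n) → Word n → List Pos → Set
  IsSortingWord c w ps =
    Increasing ps × map (letter c) ps ~ w × Reduced (map (letter c) ps) ×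
    (∀ qs → Increasing qs → map (letter c) qs ~ w → Reduced (map (letter c) qs)
          → LexLe ps qs)

  InBlock : (Fin n → Fin n) → List Pos → ℕ → Fin n → Set
  InBlock c ps k s = Σ (Fin n) λ i → (k , i) ∈ ps × c i ≡ s

  BlocksDecreasing : (Fin n → Fin n) → List Pos → Set
  BlocksDecreasing c ps = ∀ k s → InBlock c ps (suc k) s → InBlock c ps k s

  Sortable : (Fin n → Fin n) → Word n → Set
  Sortable c w = Σ (List Pos) λ ps → IsSortingWord c w ps × BlocksDecreasing c ps

  Interval : (Fin n → Fin n) → Word n → Word n → Set
  Interval c u v = Σ (Word n) λ x → Sortable c x × WeakLe u x × WeakLe x v

  _≈I_ : ∀ {c u v} → Interval c u v → Interval c u v → Set
  x ≈I y = proj₁ x ~ proj₁ y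

  _≤I_ : ∀ {c u v} → Interval c u v → Interval c u v → Set
  x ≤I y = WeakLe (proj₁ x) (proj₁ y)

module PosetNotions {A : Set} (_≈_ : A → A → Set) (_≤_ : A → A → Set) where

  _<_ : A → A → Set
  x < y = x ≤ y × ¬ (x ≈ y)

  _⋖_ : A → A → Set
  x ⋖ y = x < y × (∀ z → x < z → z < y → Data.Empty.⊥)
    where import Data.Empty

  IsJoin : A → A → A → Set
  IsJoin x y j = x ≤ j × y ≤ j × (∀ z → x ≤ z → y ≤ z → j ≤ z)

  IsMeet : A → A → A → Set
  IsMeet x y w = w ≤ x × w ≤ y × (∀ z → z ≤ x → z ≤ y → z ≤ w)

  IsLattice : Set
  IsLattice = ∀ x y → Σ A (IsJoin x y) × Σ A (IsMeet x y)

  Finite : Set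
  Finite = Σ (List A) λ xs → ∀ x → Any (x ≈_) xs

  IsBottom : A → Set
  IsBottom b = ∀ y → b ≤ y

  IsTop : A → Set
  IsTop t = ∀ y → y ≤ t

  Chain : (k : ℕ) → (Fin (suc k) → A) → Set
  Chain k f = ∀ (i : Fin k) → f (inject₁ i) < f (fsuc i)

  MaximalChain : (k : ℕ) → (Fin (suc k) → A) → Set
  MaximalChain k f = (∀ (i : Fin k) → f (inject₁ i) ⋖ f (fsuc i))
                   × IsBottom (f fzero) × IsTop (f (fromℕ k))

  HasLength : ℕ → Set
  HasLength k = Σ (Fin (suc k) → A) (Chain k)
              × (∀ k' f → Chain k' f → k' ≤ℕ k)

  JoinIrreducible : A → Set
  JoinIrreducible x = Σ A λ y → y ⋖ x × (∀ y' → y' ⋖ x → y' ≈ y)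

  MeetIrreducible : A → Set
  MeetIrreducible x = Σ A λ y → x ⋖ y × (∀ y' → x ⋖ y' → y' ≈ y)

  ExactlyMany : (A → Set) → ℕ → Set
  ExactlyMany P k = Σ (List A) λ xs → length xs ≡ k × All P xs
    × AllPairs (λ a b → ¬ (a ≈ b)) xs × (∀ x → P x → Any (x ≈_) xs)

  LeftModular : A → Set
  LeftModular x = ∀ y z a b c d → y < z → IsJoin y x a → IsMeet a z b
    → IsMeet x z c → IsJoin y c d → b ≈ d

  FiniteLattice : Set
  FiniteLattice = IsPartialOrder _≈_ _≤_ × Finite × IsLattice

  Trim : Set
  Trim = FiniteLattice × Σ ℕ λ k → HasLength k
    × Σ (Fin (suc k) → A) (λ f → MaximalChain k f × (∀ i → LeftModular (f i)))
    × ExactlyMany JoinIrreducible k × ExactlyMany MeetIrreducible k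

  Graded : Set
  Graded = ∀ k k' f g → MaximalChain k f → MaximalChain k' g → k ≡ k'

  Distributive : Set
  Distributive = FiniteLattice × (∀ x y z j a b c d → IsJoin y z j → IsMeet x j a
    → IsMeet x y b → IsMeet x z c → IsJoin b c d → a ≈ d)

{-# OPTIONS --safe #-}

-- Put an Euler form E on the root lattice, E(αᵢ , αⱼ) being 1 for i = j, nonzero for i ≠ j only if j comes
-- before i in γ, with symmetrisation the Coxeter form and skew part ω.  A reduced word with inversions
-- β₁ , … , βₖ is, up to equality in W, a γ-sorting word of a sortable element iff ω(βᵢ , βⱼ) ≥ 0 for i < j.
-- This passes to subsequences, hence to standard parabolic parts.  Splitting off an initial letter s of γ,
-- it follows by induction on rank and length that inversion sets of sortable elements are closed under
-- intersection and that, below a sortable v with inversions β₁ , … , βₖ, they are the closed sets of the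
-- Galois connection on {1 , … , k} of the relation j → i :⇔ E(βᵢ , βⱼ) > 0, which is reflexive and forces
-- i ≤ j.  If x < y, some βᵢ is an inversion of y with no arrow from an inversion of x.  This gives every
-- lattice-theoretic claim: such labels are distinct along a chain, the final segments of {1 , … , k} give
-- a left-modular chain using all labels, and every join- or meet-irreducible is determined by its label.
--
-- The numbers 2cos(π/m) are replaced by adjacency matrices of unions of paths with m − 1 vertices,
-- nonnegative integer matrices satisfying the same Chebyshev relations, so all computations are over ℤ.
module Submission where

open import Data.Nat as ℕ using (ℕ; zero; suc; z≤n; s≤s; pred)
import Data.Nat.Properties as ℕₚ
open import Data.Fin as Fin using (Fin; inject₁; fromℕ; toℕ) renaming (zero to fzero; suc to fsuc)
import Data.Fin.Properties as Finₚ
open import Data.Bool using (true; false; if_then_else_)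
open import Data.List using (List; []; _∷_; _++_; length; map; filter; allFin; lookup) renaming (drop to dropL; take to takeL)
open import Data.List.Properties using (++-assoc; ++-identityʳ; length-++; length-map; take++drop≡id; drop-all)
open import Data.List.Membership.Propositional using (_∈_; _∉_; lose)
open import Data.List.Relation.Unary.Any as Any using (Any; here; there)
open import Data.List.Relation.Unary.Any.Properties using (lookup-index)
open import Data.List.Relation.Unary.All as All using (All; []; _∷_)
open import Data.List.Relation.Unary.AllPairs as AllPairs using (AllPairs; []; _∷_)
import Data.List.Relation.Unary.AllPairs.Properties as AllPairsₚ
open import Data.List.Membership.Propositional.Properties using (∈-map⁺; ∈-map⁻; ∈-++⁺ˡ; ∈-++⁺ʳ; ∈-++⁻; ∈-filter⁺; ∈-filter⁻; ∈-allFin; ∈-lookup)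
open import Data.Product using (Σ; _×_; _,_; proj₁; proj₂)
open import Data.Sum using (_⊎_; inj₁; inj₂; swap)
open import Data.Empty using (⊥; ⊥-elim)
open import Function.Definitions using (Injective)
open import Relation.Nullary using (¬_; Dec; yes; no; does)
open import Relation.Nullary.Decidable using (¬?; _×-dec_; _→-dec_)
open import Relation.Binary.PropositionalEquality
open import Relation.Binary.Definitions using (tri<; tri≈; tri>)
open import Defs

-- With integer matrices in place of 2cos(π/m), a coordinate of a root vector is itself a vector, an
-- element of `Mo` of which the entries below `N` count, and the matrices of different pairs of
-- generators need not commute. This is harmless because a Coxeter relation involves only one pair,
-- hence powers of a single symmetric nonnegative matrix. But a root is now a family w⁻¹(αₛ f) with
-- f in `Mo`, its sign is a statement about all f ≥ 0, and it can coincide with a simple root only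
-- up to a permutation of coordinates. Such a permutation fixes the constant vector, so equality of
-- roots is tested at f = `𝟙`.
--
-- The relation on {1 , ... , k} is set up once for the inversions of v. The lower end u of the
-- interval only discards the labels that receive an arrow from an inversion of u; the number of the
-- remaining labels is the length of the interval and the number of its irreducibles of either kind.
--
-- The lexicographic minimum over subwords of γ^∞ is unsuited to induction. It is traded for
-- derivations that read the letters of γ cyclically, so that taking the initial letter conjugates γ
-- and dropping it lowers the rank.

-- Lists, sublists and counting.

AllPairs-++⁻ : ∀ {A : Set} {R : A → A → Set} xs {ys} → AllPairs R (xs ++ ys) → ∀ {x y} → x ∈ xs → y ∈ ys → R x y
AllPairs-++⁻ (x ∷ xs) (r ∷ rs) (here refl) j = All.lookup r (∈-++⁺ʳ xs j)
AllPairs-++⁻ (x ∷ xs) (r ∷ rs) (there i)   j = AllPairs-++⁻ xs rs i j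

drop-lookup : ∀ {A : Set} (xs : List A) (i : Fin (length xs)) → dropL (toℕ i) xs ≡ lookup xs i ∷ dropL (suc (toℕ i)) xs
drop-lookup (x ∷ xs) fzero    = refl
drop-lookup (x ∷ xs) (fsuc i) = drop-lookup xs i

sublists : ∀ {A : Set} → List A → List (List A)
sublists []       = [] ∷ []
sublists (x ∷ xs) = map (x ∷_) (sublists xs) ++ sublists xs

filter-∈-sublists : ∀ {A : Set} {P : A → Set} (P? : ∀ x → Dec (P x)) xs → filter P? xs ∈ sublists xs
filter-∈-sublists P? []       = here refl
filter-∈-sublists P? (x ∷ xs) with does (P? x)
... | true  = ∈-++⁺ˡ (∈-map⁺ (x ∷_) (filter-∈-sublists P? xs))
... | false = ∈-++⁺ʳ (map (x ∷_) (sublists xs)) (filter-∈-sublists P? xs)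

count : ∀ K {P : Fin K → Set} → (∀ i → Dec (P i)) → ℕ
count zero    P? = 0
count (suc K) P? = (if does (P? fzero) then 1 else 0) ℕ.+ count K (λ i → P? (fsuc i))

indicator-mono : ∀ {P Q : Set} (p : Dec P) (q : Dec Q) → (P → Q) → (if does p then 1 else 0) ℕ.≤ (if does q then 1 else 0)
indicator-mono (no _)  q       f = z≤n
indicator-mono (yes p) (yes _) f = ℕₚ.≤-refl
indicator-mono (yes p) (no nq) f = ⊥-elim (nq (f p))

count-mono : ∀ K {P Q : Fin K → Set} (P? : ∀ i → Dec (P i)) (Q? : ∀ i → Dec (Q i)) → (∀ i → P i → Q i) → count K P? ℕ.≤ count K Q?
count-mono zero    P? Q? f = z≤n
count-mono (suc K) P? Q? f = ℕₚ.+-mono-≤ (indicator-mono (P? fzero) (Q? fzero) (f fzero)) (count-mono K _ _ (λ i → f (fsuc i)))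

count-strict : ∀ K {P Q : Fin K → Set} (P? : ∀ i → Dec (P i)) (Q? : ∀ i → Dec (Q i)) → (∀ i → P i → Q i) →
               ∀ i → ¬ P i → Q i → count K P? ℕ.< count K Q?
count-strict (suc K) {P} {Q} P? Q? f fzero np q = ℕₚ.+-mono-≤ (lem (P? fzero) (Q? fzero)) (count-mono K _ _ (λ i → f (fsuc i)))
  where
  lem : (p : Dec (P fzero)) (q : Dec (Q fzero)) → suc (if does p then 1 else 0) ℕ.≤ (if does q then 1 else 0)
  lem (yes p) _       = ⊥-elim (np p)
  lem (no _)  (yes _) = ℕₚ.≤-refl
  lem (no _)  (no nq) = ⊥-elim (nq q)
count-strict (suc K) P? Q? f (fsuc i) np q = ℕₚ.+-mono-≤-< (indicator-mono (P? fzero) (Q? fzero) (f fzero))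
  (count-strict K _ _ (λ j → f (fsuc j)) i np q)

-- Trimness of lattices of closed sets.

-- A finite lattice given by the closed sets X x of a Galois connection on Fin K whose relation ar is
-- reflexive and compatible with the order of Fin K; Y x is the other half of the pair.  The
-- hypothesis witness says that every strict inequality x < y is witnessed in X y ∩ Y x.
module GaloisLattice {A : Set} (_≈_ _≤_ : A → A → Set) (K : ℕ)
  (X : A → Fin K → Set) (X? : ∀ x i → Dec (X x i))
  (ar : Fin K → Fin K → Set) (ar? : ∀ i j → Dec (ar i j))
  (≤⇒⊆ : ∀ {x y} → x ≤ y → ∀ i → X x i → X y i) (⊆⇒≤ : ∀ {x y} → (∀ i → X x i → X y i) → x ≤ y)
  (≈⇒≤ : ∀ {x y} → x ≈ y → x ≤ y) (≈⇒≥ : ∀ {x y} → x ≈ y → y ≤ x) (antisym : ∀ {x y} → x ≤ y → y ≤ x → x ≈ y)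
  (ar-refl : ∀ i → ar i i) (ar-ord : ∀ j i → ar j i → i Fin.≤ j)
  (u v : A) (bot : ∀ x → u ≤ x) (top : ∀ i → X v i)
  (sep : ∀ x j → ¬ X x j → Σ (Fin K) λ i → ar j i × (∀ l → X x l → ¬ ar l i))
  (witness : ∀ x y → x ≤ y → ¬ y ≤ x → Σ (Fin K) λ i → X y i × (∀ l → X x l → ¬ ar l i))
  (meet : ∀ x y → Σ A λ z → (∀ i → X z i → X x i × X y i) × (∀ i → X x i → X y i → X z i))
  (perp : ∀ i → (∀ l → X u l → ¬ ar l i) → Σ A λ z → (∀ j → X z j → ¬ ar j i) × (∀ j → ¬ ar j i → X z j))
  where

  open PosetNotions _≈_ _≤_

  Y : A → Fin K → Set
  Y x i = ∀ l → X x l → ¬ ar l i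

  Y? : ∀ x i → Dec (Y x i)
  Y? x i = Finₚ.all? λ l → X? x l →-dec ¬? (ar? l i)

  ≤-refl : ∀ {x} → x ≤ x
  ≤-refl = ⊆⇒≤ λ i p → p

  ≤-trans : ∀ {x y z} → x ≤ y → y ≤ z → x ≤ z
  ≤-trans h k = ⊆⇒≤ λ i p → ≤⇒⊆ k i (≤⇒⊆ h i p)

  ≤? : ∀ x y → Dec (x ≤ y)
  ≤? x y with Finₚ.all? (λ i → X? x i →-dec X? y i)
  ... | yes h = yes (⊆⇒≤ h)
  ... | no h = no λ k → h (≤⇒⊆ k)

  Y-anti : ∀ {x y} → x ≤ y → ∀ {i} → Y y i → Y x i
  Y-anti h k l p = k l (≤⇒⊆ h l p)

  Y-u : ∀ x {i} → Y x i → Y u i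
  Y-u x = Y-anti (bot x)

  X∩Y : ∀ {x i} → X x i → Y x i → ⊥
  X∩Y {i = i} p h = h i p (ar-refl i)

  ≤v : ∀ x → x ≤ v
  ≤v x = ⊆⇒≤ λ i _ → top i

  L : List (Fin K)
  L = filter (Y? u) (allFin K)

  L-sorted : AllPairs Fin._<_ L
  L-sorted = AllPairsₚ.filter⁺ (Y? u) (AllPairsₚ.tabulate⁺-< λ h → h)

  ∈L : ∀ {i} → Y u i → i ∈ L
  ∈L {i} h = ∈-filter⁺ (Y? u) (∈-allFin i) h

  L⇒Y : ∀ {i} → i ∈ L → Y u i
  L⇒Y {i} h = proj₂ (∈-filter⁻ (Y? u) {xs = allFin K} h)

  -- `perp` requires `Y u i`. Sending all other labels to the top `v` makes it total, so that `el`
  -- can fold it over any list; hence the guard `Y u i` in both properties.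
  point : ∀ i → Σ A λ z → (∀ j → X z j → Y u i → ¬ ar j i) × (∀ j → (Y u i → ¬ ar j i) → X z j)
  point i with Y? u i
  ... | no h = v , (λ j _ y → ⊥-elim (h y)) , λ j _ → top j
  ... | yes h with perp i h
  ...   | z , f , g = z , (λ j p _ → f j p) , λ j k → g j (k h)

  pt : Fin K → A
  pt i = proj₁ (point i)

  pt-Y : ∀ {i} → Y u i → Y (pt i) i
  pt-Y {i} h j p = proj₁ (proj₂ (point i)) j p h

  pt-max : ∀ {i} x → Y x i → x ≤ pt i
  pt-max {i} x h = ⊆⇒≤ λ j p → proj₂ (proj₂ (point i)) j λ _ → h j p

  -- The other half of the Galois connection: the largest element whose `Y`-half contains the labels
  -- of `R`, those outside `Y u` being ignored.
  el : List (Fin K) → A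
  el []      = v
  el (i ∷ R) = proj₁ (meet (pt i) (el R))

  el⁻ : ∀ R {j} → X (el R) j → ∀ {i} → i ∈ R → Y u i → ¬ ar j i
  el⁻ (i ∷ R) {j} p (here refl) y = pt-Y y j (proj₁ (proj₁ (proj₂ (meet (pt i) (el R))) j p))
  el⁻ (i ∷ R) {j} p (there k)   y = el⁻ R (proj₂ (proj₁ (proj₂ (meet (pt i) (el R))) j p)) k y

  el⁺ : ∀ R {j} → (∀ {i} → i ∈ R → Y u i → ¬ ar j i) → X (el R) j
  el⁺ []      {j} h = top j
  el⁺ (i ∷ R) {j} h = proj₂ (proj₂ (meet (pt i) (el R))) j (proj₂ (proj₂ (point i)) j (h (here refl))) (el⁺ R (λ k → h (there k)))

  el-Y : ∀ R {i} → i ∈ R → Y u i → Y (el R) i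
  el-Y R k y j p = el⁻ R p k y

  Rset : A → List (Fin K)
  Rset x = filter (Y? x) L

  -- `sep` expresses that `X x` is closed: a label outside it has an arrow into some label of `Y x`.
  el-Rset : ∀ x → el (Rset x) ≈ x
  el-Rset x = antisym (⊆⇒≤ below) (⊆⇒≤ λ j p → el⁺ (Rset x) λ k _ → proj₂ (∈-filter⁻ (Y? x) {xs = L} k) j p)
    where
    below : ∀ j → X (el (Rset x)) j → X x j
    below j p with X? x j
    ... | yes q = q
    ... | no nq with sep x j nq
    ...   | i , a , y = ⊥-elim (el⁻ (Rset x) p (∈-filter⁺ (Y? x) (∈L (Y-u x y)) y) (Y-u x y) a)

  elements : List A
  elements = map el (sublists L)

  ≈-sym : ∀ {x y} → x ≈ y → y ≈ x
  ≈-sym e = antisym (≈⇒≥ e) (≈⇒≤ e)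

  finite : Finite
  finite = elements , λ x → lose (∈-map⁺ el (filter-∈-sublists (Y? x) L)) (≈-sym (el-Rset x))

  meets : ∀ x y → Σ A (IsMeet x y)
  meets x y with meet x y
  ... | z , f , g = z , ⊆⇒≤ (λ i p → proj₁ (f i p)) , ⊆⇒≤ (λ i p → proj₂ (f i p)) ,
                    λ w h k → ⊆⇒≤ λ i p → g i (≤⇒⊆ h i p) (≤⇒⊆ k i p)

  IsMeet-X : ∀ {x y w i} → IsMeet x y w → X x i → X y i → X w i
  IsMeet-X {x} {y} {w} {i} (_ , _ , h) p q with meet x y
  ... | z , f , g = ≤⇒⊆ (h z (⊆⇒≤ λ i p → proj₁ (f i p)) (⊆⇒≤ λ i p → proj₂ (f i p))) i (g i p q)

  -- Dually to meets, joins intersect the `Y`-halves; their `X`-halves may exceed the union.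
  joins : ∀ x y → Σ A (IsJoin x y)
  joins x y = el R , ⊆⇒≤ (λ j p → el⁺ R λ k _ → proj₁ (mem k) j p) , ⊆⇒≤ (λ j p → el⁺ R λ k _ → proj₂ (mem k) j p) ,
      λ z h k → ⊆⇒≤ λ j p → least z h k j p
    where
    both? : ∀ i → Dec (Y x i × Y y i)
    both? i = Y? x i ×-dec Y? y i
    R = filter both? L
    mem : ∀ {i} → i ∈ R → Y x i × Y y i
    mem k = proj₂ (∈-filter⁻ both? {xs = L} k)
    least : ∀ z → x ≤ z → y ≤ z → ∀ j → X (el R) j → X z j
    least z h k j p with X? z j
    ... | yes q = q
    ... | no nq with sep z j nq
    ...   | i , a , yz = ⊥-elim (el⁻ R p (∈-filter⁺ both? (∈L (Y-u z yz)) (Y-anti h yz , Y-anti k yz)) (Y-u z yz) a)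

  -- `pt i` is the largest element with `i` in its `Y`-half, so it bounds the join as soon as it
  -- bounds `x` and `y`.
  IsJoin-Y : ∀ {x y j i} → IsJoin x y j → Y x i → Y y i → Y j i
  IsJoin-Y {x} {y} {j} {i} (_ , _ , h) p q = Y-anti (≤-trans (h (pt i) (pt-max x p) (pt-max y q)) ≤-refl) (pt-Y (Y-u x p))

  lattice : FiniteLattice
  lattice = record
    { isPreorder = record
        { isEquivalence = record { refl = antisym ≤-refl ≤-refl ; sym = ≈-sym
                                 ; trans = λ e f → antisym (≤-trans (≈⇒≤ e) (≈⇒≤ f)) (≤-trans (≈⇒≥ f) (≈⇒≥ e)) }
        ; reflexive = ≈⇒≤ ; trans = ≤-trans }
    ; antisym = antisym } , finite , λ x y → joins x y , meets x y

  <⇒≱ : ∀ {x y} → x < y → ¬ y ≤ x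
  <⇒≱ (h , ne) k = ne (antisym h k)

  ≤∧≱⇒< : ∀ {x y} → x ≤ y → ¬ y ≤ x → x < y
  ≤∧≱⇒< h k = h , λ e → k (≈⇒≥ e)

  label : ∀ {x y} → x < y → Σ (Fin K) λ i → X y i × Y x i
  label {x} {y} h = witness x y (proj₁ h) (<⇒≱ h)

  -- The form in which `witness` is applied below: an inequality can only fail at a label, and
  -- labels are excluded by cases.
  ≥-by-label : ∀ {x y} → x ≤ y → (∀ i → X y i → Y x i → ⊥) → y ≤ x
  ≥-by-label {x} {y} h k with ≤? y x
  ... | yes p = p
  ... | no np with witness x y h np
  ...   | i , p , q = ⊥-elim (k i p q)

  <-≤-trans : ∀ {x y z} → x < y → y ≤ z → x < z
  <-≤-trans h k = ≤∧≱⇒< (≤-trans (proj₁ h) k) λ p → <⇒≱ h (≤-trans k p)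

  ≤-<-trans : ∀ {x y z} → x ≤ y → y < z → x < z
  ≤-<-trans h k = ≤∧≱⇒< (≤-trans h (proj₁ k)) λ p → <⇒≱ k (≤-trans p h)

  size : A → ℕ
  size x = count K (X? x)

  size-< : ∀ {x y} → x < y → size x ℕ.< size y
  size-< {x} {y} h with label h
  ... | i , p , q = count-strict K (X? x) (X? y) (≤⇒⊆ (proj₁ h)) i (λ r → X∩Y r q) p

  <? : ∀ x y → Dec (x < y)
  <? x y with ≤? x y | ≤? y x
  ... | no h | _ = no λ k → h (proj₁ k)
  ... | yes h | yes k = no λ l → <⇒≱ l k
  ... | yes h | no k = yes (≤∧≱⇒< h k)

  between? : ∀ x y → Dec (Σ A λ z → x < z × z < y)
  between? x y with Any.any? (λ z → <? x z ×-dec <? z y) elements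
  ... | yes h = yes (Any.satisfied h)
  ... | no h = no λ { (z , p , q) → h (Any.map (λ e → <-≤-trans p (≈⇒≤ e) , ≤-<-trans (≈⇒≥ e) q) (proj₂ finite z)) }

  -- `fuel` bounds `size y - size x`, which drops whenever an intermediate element replaces `y`.
  upperCover : ∀ fuel x y → size y ℕ.≤ size x ℕ.+ fuel → x < y → Σ A λ z → x ⋖ z × z ≤ y
  upperCover fuel x y s h with between? x y
  ... | no nb = y , (h , λ z p q → nb (z , p , q)) , ≤-refl
  upperCover zero x y s h | yes (z , p , q) = ⊥-elim (ℕₚ.<⇒≱ (size-< h) (subst (size y ℕ.≤_) (ℕₚ.+-identityʳ _) s))
  upperCover (suc fuel) x y s h | yes (z , p , q) with upperCover fuel x z
    (ℕₚ.≤-pred (ℕₚ.≤-trans (size-< q) (subst (size y ℕ.≤_) (ℕₚ.+-suc (size x) fuel) s))) p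
  ... | w , c , l = w , c , ≤-trans l (proj₁ q)

  lowerCover : ∀ fuel x y → size y ℕ.≤ size x ℕ.+ fuel → x < y → Σ A λ z → x ≤ z × z ⋖ y
  lowerCover fuel x y s h with between? x y
  ... | no nb = x , ≤-refl , (h , λ z p q → nb (z , p , q))
  lowerCover zero x y s h | yes (z , p , q) = ⊥-elim (ℕₚ.<⇒≱ (size-< h) (subst (size y ℕ.≤_) (ℕₚ.+-identityʳ _) s))
  lowerCover (suc fuel) x y s h | yes (z , p , q) with lowerCover fuel z y
    (ℕₚ.≤-trans s (ℕₚ.≤-trans (ℕₚ.≤-reflexive (ℕₚ.+-suc (size x) fuel)) (ℕₚ.+-monoˡ-≤ fuel (size-< p)))) q
  ... | w , l , c = w , ≤-trans (proj₁ p) l , c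

  above : ∀ {x y} → x < y → Σ A λ z → x ⋖ z × z ≤ y
  above {x} {y} = upperCover (size y) x y (ℕₚ.m≤n+m (size y) (size x))

  beneath : ∀ {x y} → x < y → Σ A λ z → x ≤ z × z ⋖ y
  beneath {x} {y} = lowerCover (size y) x y (ℕₚ.m≤n+m (size y) (size x))

  -- The left-modular chain: the elements el R for the suffixes R of L.
  module Suffix (P R : List (Fin K)) (split : L ≡ P ++ R) where

    before : ∀ {i j} → i ∈ P → j ∈ R → i Fin.< j
    before = AllPairs-++⁻ P (subst (AllPairs Fin._<_) split L-sorted)

    cases : ∀ {i} → Y u i → i ∈ P ⊎ i ∈ R
    cases {i} y = ∈-++⁻ P (subst (i ∈_) split (∈L y))

    R⇒Y : ∀ {i} → i ∈ R → Y u i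
    R⇒Y {i} k = L⇒Y (subst (i ∈_) (sym split) (∈-++⁺ʳ P k))

    -- Arrows never lead to a later label, so none leads from `P` into `R`.
    P⇒X : ∀ {i} → i ∈ P → X (el R) i
    P⇒X {i} k = el⁺ R λ {j} l _ a → ℕₚ.<⇒≱ (before k l) (ar-ord i j a)

    R⇒Yel : ∀ {i} → i ∈ R → Y (el R) i
    R⇒Yel k = el-Y R k (R⇒Y k)

    -- Every label in `Y u` is in the `X`-half of `el R` if it belongs to `P`, and in its `Y`-half
    -- if it belongs to `R`. A label of `b` over `d` would in the first case lie in `X` of the meet
    -- `c ≤ d`, in the second case in `Y` of the join `a ≥ b`.
    leftModular : LeftModular (el R)
    leftModular y z a b c d y<z ja mb mc jd = antisym b≤d d≤b
      where
      d≤b : d ≤ b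
      d≤b = proj₂ (proj₂ jd) b (proj₂ (proj₂ mb) y (proj₁ ja) (proj₁ y<z))
        (proj₂ (proj₂ mb) c (≤-trans (proj₁ mc) (proj₁ (proj₂ ja))) (proj₁ (proj₂ mc)))
      b≤d : b ≤ d
      b≤d = ≥-by-label d≤b λ i p q → go i p q (cases (Y-u d q))
        where
        go : ∀ i → X b i → Y d i → i ∈ P ⊎ i ∈ R → ⊥
        go i p q (inj₂ k) = X∩Y (≤⇒⊆ (proj₁ mb) i p) (IsJoin-Y ja (Y-anti (proj₁ jd) q) (R⇒Yel k))
        go i p q (inj₁ k) = X∩Y (IsMeet-X mc (P⇒X k) (≤⇒⊆ (proj₁ (proj₂ mb)) i p)) (Y-anti (proj₁ (proj₂ jd)) q)

  module Step (P : List (Fin K)) (t : Fin K) (R : List (Fin K)) (split : L ≡ P ++ t ∷ R) where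
    module S  = Suffix P (t ∷ R) split
    module S' = Suffix (P ++ t ∷ []) R (trans split (sym (++-assoc P (t ∷ []) R)))

    lo hi : A
    lo = el (t ∷ R)
    hi = el R

    lo≤hi : lo ≤ hi
    lo≤hi = ⊆⇒≤ λ j p → el⁺ R λ k y → el⁻ (t ∷ R) p (there k) y

    X-hi-t : X hi t
    X-hi-t = S'.P⇒X (∈-++⁺ʳ P (here refl))

    Y-lo-t : Y lo t
    Y-lo-t = S.R⇒Yel (here refl)

    Y-u-t : Y u t
    Y-u-t = S.R⇒Y (here refl)

    lo<hi : lo < hi
    lo<hi = ≤∧≱⇒< lo≤hi λ k → X∩Y (≤⇒⊆ k t X-hi-t) Y-lo-t

    only : ∀ {i} → X hi i → Y lo i → i ≡ t
    only {i} p q with S.cases (Y-u lo q)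
    ... | inj₁ k = ⊥-elim (X∩Y (S.P⇒X k) q)
    ... | inj₂ (here e) = e
    ... | inj₂ (there k) = ⊥-elim (X∩Y p (S'.R⇒Yel k))

    -- Two strict steps between `lo` and `hi` would need two labels, and `t` is the only one
    -- available.
    cover : lo ⋖ hi
    cover = lo<hi , λ z p q → clash (label p) (label q) (proj₁ p) (proj₁ q)
      where
      clash : ∀ {z} → (Σ (Fin K) λ i → X z i × Y lo i) → (Σ (Fin K) λ i → X hi i × Y z i) → lo ≤ z → z ≤ hi → ⊥
      clash {z} (i , p , q) (j , p' , q') l h with only (≤⇒⊆ h i p) q | only p' (Y-anti l q')
      ... | refl | refl = X∩Y p q'

  chainMono : ∀ k (f : Fin (suc k) → A) → (∀ i → f (inject₁ i) ≤ f (fsuc i)) → ∀ i j → i Fin.≤ j → f i ≤ f j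
  chainMono k f h fzero fzero _ = ≤-refl
  chainMono (suc k) f h fzero (fsuc j) _ = ≤-trans (h fzero) (chainMono k (λ i → f (fsuc i)) (λ i → h (fsuc i)) fzero j z≤n)
  chainMono (suc k) f h (fsuc i) (fsuc j) (s≤s l) = chainMono k (λ i → f (fsuc i)) (λ i → h (fsuc i)) i j l

  module ChainLabels (k : ℕ) (f : Fin (suc k) → A) (ch : Chain k f) where
    lab : Fin k → Fin K
    lab a = proj₁ (label (ch a))

    lab-Y : ∀ a → Y u (lab a)
    lab-Y a = Y-u _ (proj₂ (proj₂ (label (ch a))))

    index : Fin k → Fin (length L)
    index a = Any.index (∈L (lab-Y a))

    index-lookup : ∀ a → lookup L (index a) ≡ lab a
    index-lookup a = sym (lookup-index (∈L (lab-Y a)))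

    -- A label stays in `X` of all later elements of the chain, so it cannot be in `Y` of one of
    -- them.
    lab-≢ : ∀ a b → a Fin.< b → lab a ≢ lab b
    lab-≢ a b l e = X∩Y (≤⇒⊆ (chainMono k f (λ i → proj₁ (ch i)) (fsuc a) (inject₁ b) (subst (suc (toℕ a) ℕ.≤_) (sym (Finₚ.toℕ-inject₁ b)) l)) _
      (proj₁ (proj₂ (label (ch a))))) (subst (Y (f (inject₁ b))) (sym e) (proj₂ (proj₂ (label (ch b)))))

    index-injective : Injective _≡_ _≡_ index
    index-injective {a} {b} e with Finₚ.<-cmp a b
    ... | tri≈ _ eq _ = eq
    ... | tri< l _ _ = ⊥-elim (lab-≢ a b l (trans (sym (index-lookup a)) (trans (cong (lookup L) e) (index-lookup b))))
    ... | tri> _ _ l = ⊥-elim (lab-≢ b a l (trans (sym (index-lookup b)) (trans (cong (lookup L) (sym e)) (index-lookup a))))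

    bounded : k ℕ.≤ length L
    bounded = Finₚ.injective⇒≤ index-injective

    -- Serves the graded case, where it shows that a maximal chain cannot avoid any label.
    missing : ∀ {t} → t ∈ L → (∀ a → lab a ≢ t) → suc k ℕ.≤ length L
    missing {t} t∈ h = Finₚ.injective⇒≤ {f = ext} ext-injective
      where
      ext : Fin (suc k) → Fin (length L)
      ext fzero    = Any.index t∈
      ext (fsuc a) = index a
      clash : ∀ a → Any.index t∈ ≢ index a
      clash a e = h a (trans (sym (index-lookup a)) (trans (cong (lookup L) (sym e)) (sym (lookup-index t∈))))
      ext-injective : Injective _≡_ _≡_ ext
      ext-injective {fzero} {fzero} e = refl
      ext-injective {fzero} {fsuc b} e = ⊥-elim (clash b e)
      ext-injective {fsuc a} {fzero} e = ⊥-elim (clash a (sym e))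
      ext-injective {fsuc a} {fsuc b} e = cong fsuc (index-injective e)

  len : ℕ
  len = length L

  spine : Fin (suc len) → A
  spine a = el (dropL (toℕ a) L)

  spine-split : ∀ (a : Fin (suc len)) → L ≡ takeL (toℕ a) L ++ dropL (toℕ a) L
  spine-split a = sym (take++drop≡id (toℕ a) L)

  stepAt : ∀ (a : Fin len) → L ≡ takeL (toℕ a) L ++ lookup L a ∷ dropL (suc (toℕ a)) L
  stepAt a = trans (sym (take++drop≡id (toℕ a) L)) (cong (takeL (toℕ a) L ++_) (drop-lookup L a))

  spine-inject : ∀ a → spine (inject₁ a) ≡ el (lookup L a ∷ dropL (suc (toℕ a)) L)
  spine-inject a = cong el (trans (cong (λ z → dropL z L) (Finₚ.toℕ-inject₁ a)) (drop-lookup L a))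

  spine-cover : ∀ a → spine (inject₁ a) ⋖ spine (fsuc a)
  spine-cover a = subst (_⋖ spine (fsuc a)) (sym (spine-inject a)) (Step.cover _ (lookup L a) _ (stepAt a))

  spine-max : MaximalChain len spine
  spine-max = spine-cover , (λ y → ≤-trans (⊆⇒≤ least) (bot y)) ,
      λ y → subst (y ≤_) (sym (cong el (trans (cong (λ z → dropL z L) (Finₚ.toℕ-fromℕ len)) (drop-all len L ℕₚ.≤-refl)))) (≤v y)
    where
    least : ∀ j → X (el L) j → X u j
    least j p with X? u j
    ... | yes q = q
    ... | no nq with sep u j nq
    ...   | i , a , y = ⊥-elim (el⁻ L p (∈L y) y a)

  hasLength : HasLength len
  hasLength = (spine , λ a → proj₁ (spine-cover a)) , λ k f ch → ChainLabels.bounded k f ch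

  minWith : Fin K → List A → A
  minWith i []       = v
  minWith i (x ∷ xs) = if does (X? x i) then proj₁ (meet x (minWith i xs)) else minWith i xs

  minWith-X : ∀ i xs → X (minWith i xs) i
  minWith-X i []       = top i
  minWith-X i (x ∷ xs) with X? x i
  ... | yes p = proj₂ (proj₂ (meet x (minWith i xs))) i p (minWith-X i xs)
  ... | no _  = minWith-X i xs

  minWith-≤ : ∀ i xs {x} → x ∈ xs → X x i → minWith i xs ≤ x
  minWith-≤ i (x ∷ xs) (here refl) p with X? x i
  ... | yes q = ⊆⇒≤ λ j r → proj₁ (proj₁ (proj₂ (meet x (minWith i xs))) j r)
  ... | no nq = ⊥-elim (nq p)
  minWith-≤ i (y ∷ xs) (there k) p with X? y i
  ... | yes q = ≤-trans (⊆⇒≤ λ j r → proj₂ (proj₁ (proj₂ (meet y (minWith i xs))) j r)) (minWith-≤ i xs k p)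
  ... | no nq = minWith-≤ i xs k p

  ji : Fin K → A
  ji i = minWith i elements

  ji-X : ∀ i → X (ji i) i
  ji-X i = minWith-X i elements

  ji-least : ∀ i x → X x i → ji i ≤ x
  ji-least i x p = ≤-trans (minWith-≤ i elements (∈-map⁺ el (filter-∈-sublists (Y? x) L)) (≤⇒⊆ (≈⇒≥ (el-Rset x)) i p)) (≈⇒≤ (el-Rset x))

  module Irreducibles (P : List (Fin K)) (t : Fin K) (R : List (Fin K)) (split : L ≡ P ++ t ∷ R) where
    open Step P t R split

    ji≤hi : ji t ≤ hi
    ji≤hi = ji-least t hi X-hi-t

    -- No label separates `x` from `x ∧ lo`: labels of `P` are in `X lo`, the label `t` would put
    -- `ji t` below `x`, and labels of `R` are in `Y hi` although `x ≤ hi`. Hence `ji t ∧ lo` is the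
    -- only lower cover of `ji t`.
    below-lo : ∀ {x} → x < ji t → x ≤ lo
    below-lo {x} h with meet x lo
    ... | z , f , g = ≤-trans x≤z (⊆⇒≤ λ i p → proj₂ (f i p))
      where
      x≤z : x ≤ z
      x≤z = ≥-by-label (⊆⇒≤ λ i p → proj₁ (f i p)) λ i p q → go i p q (S.cases (Y-u z q))
        where
        go : ∀ i → X x i → Y z i → i ∈ P ⊎ i ∈ t ∷ R → ⊥
        go i p q (inj₁ k) = X∩Y (g i p (S.P⇒X k)) q
        go i p q (inj₂ (here refl)) = <⇒≱ h (ji-least t x p)
        go i p q (inj₂ (there k)) = X∩Y (≤⇒⊆ (≤-trans (proj₁ h) ji≤hi) i p) (S'.R⇒Yel k)

    joinIrreducible : JoinIrreducible (ji t)
    joinIrreducible with meet (ji t) lo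
    ... | y , f , g = y , (y<ji , λ z p q → <⇒≱ p (low q)) ,
        λ y' c → antisym (low (proj₁ c)) (upto y' c)
      where
      y<ji : y < ji t
      y<ji = ≤∧≱⇒< (⊆⇒≤ λ i p → proj₁ (f i p)) λ k → X∩Y (proj₂ (f t (≤⇒⊆ k t (ji-X t)))) Y-lo-t
      low : ∀ {x} → x < ji t → x ≤ y
      low h = ⊆⇒≤ λ i p → g i (≤⇒⊆ (proj₁ h) i p) (≤⇒⊆ (below-lo h) i p)
      upto : ∀ y' → y' ⋖ ji t → y ≤ y'
      upto y' c with ≤? y y'
      ... | yes k = k
      ... | no nk = ⊥-elim (proj₂ c y (≤∧≱⇒< (low (proj₁ c)) nk) y<ji)

    lo≤pt : lo ≤ pt t
    lo≤pt = pt-max lo Y-lo-t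

    -- The dual argument; it makes `pt t ∨ hi` the only upper cover of `pt t`.
    above-hi : ∀ {x} → pt t < x → hi ≤ x
    above-hi {x} h with joins x hi
    ... | w , j = ≤-trans (proj₁ (proj₂ j)) w≤x
      where
      w≤x : w ≤ x
      w≤x = ≥-by-label (proj₁ j) λ i p q → go i p q (S.cases (Y-u x q))
        where
        go : ∀ i → X w i → Y x i → i ∈ P ⊎ i ∈ t ∷ R → ⊥
        go i p q (inj₁ k) = X∩Y (≤⇒⊆ (≤-trans lo≤pt (proj₁ h)) i (S.P⇒X k)) q
        go i p q (inj₂ (here refl)) = <⇒≱ h (pt-max x q)
        go i p q (inj₂ (there k)) = X∩Y p (IsJoin-Y j q (S'.R⇒Yel k))

    meetIrreducible : MeetIrreducible (pt t)
    meetIrreducible with joins (pt t) hi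
    ... | y , j = y , (pt<y , λ z p q → <⇒≱ q (up p)) ,
        λ y' c → antisym (upto y' c) (up (proj₁ c))
      where
      pt<y : pt t < y
      pt<y = ≤∧≱⇒< (proj₁ j) λ k → X∩Y (≤⇒⊆ (≤-trans (proj₁ (proj₂ j)) k) t X-hi-t) (pt-Y Y-u-t)
      up : ∀ {x} → pt t < x → y ≤ x
      up {x} h = proj₂ (proj₂ j) x (proj₁ h) (above-hi h)
      upto : ∀ y' → pt t ⋖ y' → y' ≤ y
      upto y' c with ≤? y' y
      ... | yes k = k
      ... | no nk = ⊥-elim (proj₂ c y pt<y (≤∧≱⇒< (up (proj₁ c)) nk))

    ji-distinct : ∀ {t'} → t' ∈ R → ¬ ji t ≈ ji t'
    ji-distinct {t'} k e = X∩Y (≤⇒⊆ (≤-trans (≈⇒≥ e) ji≤hi) t' (ji-X t')) (S'.R⇒Yel k)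

    pt-distinct : ∀ {t'} → t' ∈ R → ¬ pt t ≈ pt t'
    pt-distinct {t'} k e = X∩Y (≤⇒⊆ (≤-trans (pt-max hi (S'.R⇒Yel k)) (≈⇒≥ e)) t X-hi-t) (pt-Y Y-u-t)

  irreducibles : ∀ P R → L ≡ P ++ R → All JoinIrreducible (map ji R) × AllPairs (λ a b → ¬ a ≈ b) (map ji R)
    × All MeetIrreducible (map pt R) × AllPairs (λ a b → ¬ a ≈ b) (map pt R)
  irreducibles P []      split = [] , [] , [] , []
  irreducibles P (t ∷ R) split with irreducibles (P ++ t ∷ []) R (trans split (sym (++-assoc P (t ∷ []) R)))
  ... | a , b , c , d = I.joinIrreducible ∷ a , allMap ji I.ji-distinct ∷ b , I.meetIrreducible ∷ c , allMap pt I.pt-distinct ∷ d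
    where
    module I = Irreducibles P t R split
    allMap : ∀ (f : Fin K → A) → (∀ {t'} → t' ∈ R → ¬ f t ≈ f t') → All (λ b → ¬ f t ≈ b) (map f R)
    allMap f h = All.tabulate λ m → lem (∈-map⁻ f m)
      where
      lem : ∀ {y} → (Σ (Fin K) λ t' → t' ∈ R × y ≡ f t') → ¬ f t ≈ y
      lem (t' , k , refl) = h k

  -- For completeness, let `i` label the step from the only lower cover of `x` up to `x`. If `ji i`
  -- were strictly below `x`, it would lie below that cover, whose `X`-half omits `i`.
  manyJI : ExactlyMany JoinIrreducible len
  manyJI with irreducibles [] L refl
  ... | a , b , _ = map ji L , length-map ji L , a , b , complete
    where
    complete : ∀ x → JoinIrreducible x → Any (x ≈_) (map ji L)
    complete x (y , c , uniq) with label (proj₁ c)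
    ... | i , p , q = lose (∈-map⁺ ji (∈L (Y-u y q))) (antisym x≤ji (ji-least i x p))
      where
      x≤ji : x ≤ ji i
      x≤ji with ≤? x (ji i)
      ... | yes h = h
      ... | no nh with beneath (≤∧≱⇒< (ji-least i x p) nh)
      ...   | y' , l , c' = ⊥-elim (X∩Y (≤⇒⊆ (≤-trans l (≈⇒≤ (uniq y' c'))) i (ji-X i)) q)

  manyMI : ExactlyMany MeetIrreducible len
  manyMI with irreducibles [] L refl
  ... | _ , _ , a , b = map pt L , length-map pt L , a , b , complete
    where
    complete : ∀ x → MeetIrreducible x → Any (x ≈_) (map pt L)
    complete x (y , c , uniq) with label (proj₁ c)
    ... | i , p , q = lose (∈-map⁺ pt (∈L (Y-u x q))) (antisym (pt-max x q) pt≤x)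
      where
      pt≤x : pt i ≤ x
      pt≤x with ≤? (pt i) x
      ... | yes h = h
      ... | no nh with above (≤∧≱⇒< (pt-max x q) nh)
      ...   | y' , c' , l = ⊥-elim (X∩Y (≤⇒⊆ (≤-trans (≈⇒≥ (uniq y' c')) l) i p) (pt-Y (Y-u x q)))

  trim : Trim
  trim = lattice , len , hasLength ,
    (spine , spine-max , λ a → Suffix.leftModular (takeL (toℕ a) L) (dropL (toℕ a) L) (spine-split a)) , manyJI , manyMI

  -- Chains in inductive form, for building them by recursion with a record `Q` of every step; `fun`
  -- returns to functions on `Fin`.
  data Saturated (Q : A → A → Set) (b : A) : ℕ → A → Set where
    nil  : ∀ {a} → a ≈ b → Saturated Q b 0 a
    cons : ∀ {k} a {a'} → a ⋖ a' → Q a a' → Saturated Q b k a' → Saturated Q b (suc k) a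

  fun : ∀ {Q b k a} → Saturated Q b k a → Fin (suc k) → A
  fun {a = a} (nil e)        i        = a
  fun         (cons a c q s) fzero    = a
  fun         (cons a c q s) (fsuc i) = fun s i

  fun-start : ∀ {Q b k a} (s : Saturated Q b k a) → fun s fzero ≡ a
  fun-start (nil e)        = refl
  fun-start (cons a c q s) = refl

  fun-end : ∀ {Q b k a} (s : Saturated Q b k a) → fun s (fromℕ k) ≈ b
  fun-end (nil e)        = e
  fun-end (cons a c q s) = fun-end s

  fun-step : ∀ {Q b k a} (s : Saturated Q b k a) i → fun s (inject₁ i) ⋖ fun s (fsuc i) × Q (fun s (inject₁ i)) (fun s (fsuc i))
  fun-step {Q} (cons a c q s) fzero = subst (a ⋖_) (sym (fun-start s)) c , subst (Q a) (sym (fun-start s)) q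
  fun-step (cons a c q s) (fsuc i) = fun-step s i

  -- In continuation style: `start` supplies the rest of the chain from `b` on. It must accept any
  -- `x ≈ b`, because the climb reaches `b` only up to `≈`.
  saturate : ∀ {Q : A → A → Set} fuel a b → size b ℕ.≤ size a ℕ.+ fuel → a ≤ b →
    (∀ c c' → a ≤ c → c' ≤ b → Q c c') → ∀ {e} → (∀ {x} → x ≈ b → Σ ℕ λ k → Saturated Q e k x) →
    Σ ℕ λ k' → Saturated Q e k' a
  saturate fuel a b s h q start with ≤? b a
  ... | yes h' = start (antisym h h')
  ... | no nh with above (≤∧≱⇒< h nh)
  saturate zero a b s h q start | no nh | a' , c , l =
    ⊥-elim (ℕₚ.<⇒≱ (size-< (≤∧≱⇒< h nh)) (subst (size b ℕ.≤_) (ℕₚ.+-identityʳ _) s))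
  saturate (suc fuel) a b s h q start | no nh | a' , c , l with saturate fuel a' b
      (ℕₚ.≤-trans s (ℕₚ.≤-trans (ℕₚ.≤-reflexive (ℕₚ.+-suc (size a) fuel)) (ℕₚ.+-monoˡ-≤ fuel (size-< (proj₁ c))))) l
      (λ d d' p p' → q d d' (≤-trans (proj₁ (proj₁ c)) p) p') start
  ... | k' , S = suc k' , cons a c (q a a' ≤-refl l) S

  -- In a graded lattice every maximal chain uses all labels, so X and Y are complementary on L.
  complement : Graded → ∀ x {t} → t ∈ L → X x t ⊎ Y x t
  complement gr x {t} t∈ with X? x t | Y? x t
  ... | yes p | _ = inj₁ p
  ... | no _  | yes q = inj₂ q
  ... | no np | no nq = ⊥-elim (avoid (saturate {Avoids} (size x) u x (ℕₚ.m≤n+m (size x) (size u)) (bot x)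
          (λ c c' _ l → inj₁ λ p → np (≤⇒⊆ l t p))
          (λ {x'} e → saturate {Avoids} (size v) x' v (ℕₚ.m≤n+m (size v) (size x')) (≤v x')
            (λ c c' l _ → inj₂ λ q → nq (Y-anti (≤-trans (≈⇒≥ e) l) q)) λ {x''} e' → 0 , nil e')))
    where
    -- In a chain through `x`, no element below `x` has `t` in its `X`-half and none above `x` has
    -- `t` in its `Y`-half, so every step has this property and `t` labels no step.
    Avoids : A → A → Set
    Avoids c c' = ¬ X c' t ⊎ ¬ Y c t
    avoid : (Σ ℕ λ k → Saturated Avoids v k u) → ⊥
    avoid (k , S) = ℕₚ.<⇒≱ (ChainLabels.missing k f ch t∈ miss) (ℕₚ.≤-reflexive (gr len k spine f spine-max
        ((λ i → proj₁ (fun-step S i)) , (λ y → subst (_≤ y) (sym (fun-start S)) (bot y)) , λ y → ≤-trans (≤v y) (≈⇒≥ (fun-end S)))))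
      where
      f = fun S
      ch : Chain k f
      ch i = proj₁ (proj₁ (fun-step S i))
      miss : ∀ a → ChainLabels.lab k f ch a ≢ t
      miss a e with proj₂ (fun-step S a)
      ... | inj₁ h = h (subst (X (f (fsuc a))) e (proj₁ (proj₂ (label (ch a)))))
      ... | inj₂ h = h (subst (Y (f (inject₁ a))) e (proj₂ (proj₂ (label (ch a)))))

  -- Once the halves are complementary, joins are unions of `X`-halves: a label missing from both
  -- `X y` and `X z` lies in both `Y`-halves, hence in that of the join.
  distributive : Graded → Distributive
  distributive gr = lattice , λ x y z j a b c d jn ma mb mc jd → antisym
      (a≤d x y z j a b c d jn ma mb mc jd)
      (proj₂ (proj₂ jd) a
        (proj₂ (proj₂ ma) b (proj₁ mb) (≤-trans (proj₁ (proj₂ mb)) (proj₁ jn)))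
        (proj₂ (proj₂ ma) c (proj₁ mc) (≤-trans (proj₁ (proj₂ mc)) (proj₁ (proj₂ jn)))))
    where
    a≤d : ∀ x y z j a b c d → IsJoin y z j → IsMeet x j a → IsMeet x y b → IsMeet x z c → IsJoin b c d → a ≤ d
    a≤d x y z j a b c d jn ma mb mc jd = ≥-by-label
        (proj₂ (proj₂ jd) a
          (proj₂ (proj₂ ma) b (proj₁ mb) (≤-trans (proj₁ (proj₂ mb)) (proj₁ jn)))
          (proj₂ (proj₂ ma) c (proj₁ mc) (≤-trans (proj₁ (proj₂ mc)) (proj₁ (proj₂ jn)))))
        λ i p q → go i p q (complement gr y (∈L (Y-u d q))) (complement gr z (∈L (Y-u d q)))
      where
      go : ∀ i → X a i → Y d i → X y i ⊎ Y y i → X z i ⊎ Y z i → ⊥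
      go i p q (inj₁ r) _ = X∩Y (IsMeet-X mb (≤⇒⊆ (proj₁ ma) i p) r) (Y-anti (proj₁ jd) q)
      go i p q (inj₂ r) (inj₁ s) = X∩Y (IsMeet-X mc (≤⇒⊆ (proj₁ ma) i p) s) (Y-anti (proj₁ (proj₂ jd)) q)
      go i p q (inj₂ r) (inj₂ s) = X∩Y (≤⇒⊆ (proj₁ (proj₂ ma)) i p) (IsJoin-Y jn r s)

-- Integer vectors and adjacency operators of paths.

open import Data.Nat.Divisibility using (_∣_; _∣?_; divides; ∣m+n∣m⇒∣n; ∣⇒≤; _∣0; ∣m∣n⇒∣m+n; n∣m*n; ∣-trans; m∣m*n)
open import Data.Nat.DivMod using (_/_; _%_; m≡m%n+[m/n]*n; m%n<n)
open import Data.Integer using (ℤ; +_; -_; _+_; _*_; _≤_; _<_; 0ℤ; 1ℤ; _-_; -[1+_]; +≤+; -≤+; +<+; _⊔_; ∣_∣)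
open import Data.Integer.Tactic.RingSolver using (solve-∀)
open import Data.Maybe using (Maybe; just; nothing)
open import Relation.Nullary.Decidable using (dec-true; dec-false)
open import Data.Maybe.Properties using (just-injective)
open import Data.Fin.Properties using (_≟_)
open import Data.List using (reverse; _∷ʳ_)
open import Data.List.Properties using (unfold-reverse; reverse-involutive; reverse-++; map-++; map-∘; map-cong; map-id)
open import Data.Unit using (⊤; tt)
open import Data.List.Relation.Unary.Any.Properties using (reverse⁻)
open import Data.Product.Properties using (≡-dec)
import Data.Integer.Properties as ℤₚ
import Data.List.Relation.Unary.All.Properties as Allₚ

0≤+ : ∀ {a b} → 0ℤ ≤ a → 0ℤ ≤ b → 0ℤ ≤ a + b
0≤+ p q = ℤₚ.+-mono-≤ p q

0≤* : ∀ {a b} → 0ℤ ≤ a → 0ℤ ≤ b → 0ℤ ≤ a * b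
0≤* {+ a} {+ b} _ _ = subst (0ℤ ≤_) (ℤₚ.pos-* a b) (+≤+ z≤n)

0≤-⇒≤0 : ∀ {a} → 0ℤ ≤ - a → a ≤ 0ℤ
0≤-⇒≤0 {a} p = subst (_≤ 0ℤ) (ℤₚ.neg-involutive a) (ℤₚ.neg-mono-≤ p)

Σ< : ℕ → (ℕ → ℤ) → ℤ
Σ< zero    f = 0ℤ
Σ< (suc N) f = Σ< N f + f N

Σ<-cong : ∀ N {f g} → (∀ p → p ℕ.< N → f p ≡ g p) → Σ< N f ≡ Σ< N g
Σ<-cong zero    h = refl
Σ<-cong (suc N) h = cong₂ _+_ (Σ<-cong N λ p l → h p (ℕₚ.m<n⇒m<1+n l)) (h N ℕₚ.≤-refl)

+-exchange : ∀ a b c d → (a + b) + (c + d) ≡ (a + c) + (b + d)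
+-exchange = solve-∀

Σ<-+ : ∀ N f g → Σ< N (λ p → f p + g p) ≡ Σ< N f + Σ< N g
Σ<-+ zero    f g = refl
Σ<-+ (suc N) f g = trans (cong (_+ (f N + g N)) (Σ<-+ N f g)) (+-exchange (Σ< N f) (Σ< N g) (f N) (g N))

Σ<-neg : ∀ N f → Σ< N (λ p → - f p) ≡ - Σ< N f
Σ<-neg zero    f = refl
Σ<-neg (suc N) f = trans (cong (_+ - f N) (Σ<-neg N f)) (sym (ℤₚ.neg-distrib-+ (Σ< N f) (f N)))

Σ<-nonneg : ∀ N {f} → (∀ p → p ℕ.< N → 0ℤ ≤ f p) → 0ℤ ≤ Σ< N f
Σ<-nonneg zero    h = ℤₚ.≤-refl
Σ<-nonneg (suc N) h = 0≤+ (Σ<-nonneg N λ p l → h p (ℕₚ.m<n⇒m<1+n l)) (h N ℕₚ.≤-refl)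

+≡0ʳ : ∀ {a b} → 0ℤ ≤ a → 0ℤ ≤ b → a + b ≤ 0ℤ → b ≡ 0ℤ
+≡0ʳ {a} {b} 0≤a 0≤b h =
  ℤₚ.≤-antisym (ℤₚ.≤-trans (subst (_≤ a + b) (ℤₚ.+-identityˡ b) (ℤₚ.+-monoˡ-≤ b 0≤a)) h) 0≤b

+≡0ˡ : ∀ {a b} → 0ℤ ≤ a → 0ℤ ≤ b → a + b ≤ 0ℤ → a ≡ 0ℤ
+≡0ˡ {a} {b} 0≤a 0≤b h = +≡0ʳ 0≤b 0≤a (subst (_≤ 0ℤ) (ℤₚ.+-comm a b) h)

Σ<≡0 : ∀ N {f} → (∀ p → p ℕ.< N → 0ℤ ≤ f p) → Σ< N f ≤ 0ℤ → ∀ p → p ℕ.< N → f p ≡ 0ℤ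
Σ<≡0 (suc N) {f} h s p p<N with p ℕ.≟ N
... | yes refl = +≡0ʳ (Σ<-nonneg N λ q l → h q (ℕₚ.m<n⇒m<1+n l)) (h N ℕₚ.≤-refl) s
... | no p≢N = Σ<≡0 N (λ q l → h q (ℕₚ.m<n⇒m<1+n l))
  (ℤₚ.≤-reflexive (+≡0ˡ (Σ<-nonneg N λ q l → h q (ℕₚ.m<n⇒m<1+n l)) (h N ℕₚ.≤-refl) s))
  p (ℕₚ.≤∧≢⇒< (ℕₚ.≤-pred p<N) p≢N)

Σ<-shift : ∀ N f → Σ< N (λ p → f (suc p)) + f 0 ≡ Σ< N f + f N
Σ<-shift zero    f = refl
Σ<-shift (suc N) f = trans (rearr (Σ< N (λ p → f (suc p))) (f (suc N)) (f 0))
  (cong (_+ f (suc N)) (Σ<-shift N f))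
  where
  rearr : ∀ a b c → (a + b) + c ≡ (a + c) + b
  rearr = solve-∀

Mo : Set
Mo = ℕ → ℤ

infixl 6 _⊕_ _⊖_
_⊕_ : Mo → Mo → Mo
(f ⊕ g) p = f p + g p

⊝_ : Mo → Mo
(⊝ f) p = - f p

_⊖_ : Mo → Mo → Mo
f ⊖ g = f ⊕ (⊝ g)

𝟘 : Mo
𝟘 _ = 0ℤ

𝟙 : Mo
𝟙 _ = 1ℤ

-- The edge of the path graph between p − 1 and p is cut when d divides p.
gate : ℕ → ℕ → ℤ → ℤ
gate d p z = if does (d ∣? p) then 0ℤ else z

gate-cut : ∀ {d p} z → d ∣ p → gate d p z ≡ 0ℤ
gate-cut {d} {p} z h = cong (λ b → if b then 0ℤ else z) (dec-true (d ∣? p) h)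

gate-open : ∀ {d p} z → ¬ d ∣ p → gate d p z ≡ z
gate-open {d} {p} z h = cong (λ b → if b then 0ℤ else z) (dec-false (d ∣? p) h)

gate-+ : ∀ d p x y → gate d p (x + y) ≡ gate d p x + gate d p y
gate-+ d p x y with does (d ∣? p)
... | true  = refl
... | false = refl

gate-neg : ∀ d p x → gate d p (- x) ≡ - gate d p x
gate-neg d p x with does (d ∣? p)
... | true  = refl
... | false = refl

gate-*ʳ : ∀ d p x y → gate d p x * y ≡ gate d p (x * y)
gate-*ʳ d p x y with does (d ∣? p)
... | true  = refl
... | false = refl

gate-0≤ : ∀ d p {x} → (¬ d ∣ p → 0ℤ ≤ x) → 0ℤ ≤ gate d p x
gate-0≤ d p h with d ∣? p
... | yes _ = ℤₚ.≤-refl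
... | no q  = h q

gate-cong : ∀ d p {x y} → (¬ d ∣ p → x ≡ y) → gate d p x ≡ gate d p y
gate-cong d p h with d ∣? p
... | yes _ = refl
... | no q  = h q

-- Disjoint union of paths with d vertices, the Coxeter graphs of type A_d, laid out along ℕ.
path : ℕ → Mo → Mo
path d f p = gate d p (f (pred p)) + gate d (suc p) (f (suc p))

-- Adjacency operators playing the role of multiplication by 2cos(π/m).
κ : Maybe ℕ → Mo → Mo
κ nothing              f = f ⊕ f
κ (just 0)             f = 𝟘
κ (just 1)             f = 𝟘
κ (just (suc (suc k))) f = path (suc k) f

-- The block length: `κ m` mixes coordinates only within blocks of this size.
width : Maybe ℕ → ℕ
width (just (suc (suc k))) = suc k
width _                    = 1

κ-⊕ : ∀ m f g p → κ m (f ⊕ g) p ≡ (κ m f ⊕ κ m g) p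
κ-⊕ nothing f g p = +-exchange (f p) (g p) (f p) (g p)
κ-⊕ (just 0) f g p = refl
κ-⊕ (just 1) f g p = refl
κ-⊕ (just (suc (suc k))) f g p =
  trans (cong₂ _+_ (gate-+ (suc k) p (f (pred p)) (g (pred p))) (gate-+ (suc k) (suc p) (f (suc p)) (g (suc p))))
    (+-exchange (gate (suc k) p (f (pred p))) (gate (suc k) p (g (pred p)))
      (gate (suc k) (suc p) (f (suc p))) (gate (suc k) (suc p) (g (suc p))))

κ-⊝ : ∀ m f p → κ m (⊝ f) p ≡ - κ m f p
κ-⊝ nothing f p = sym (ℤₚ.neg-distrib-+ (f p) (f p))
κ-⊝ (just 0) f p = refl
κ-⊝ (just 1) f p = refl
κ-⊝ (just (suc (suc k))) f p =
  trans (cong₂ _+_ (gate-neg (suc k) p (f (pred p))) (gate-neg (suc k) (suc p) (f (suc p))))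
    (sym (ℤₚ.neg-distrib-+ (gate (suc k) p (f (pred p))) _))

module Bounded (N : ℕ) where

  infix 4 _≐_
  _≐_ : Mo → Mo → Set
  f ≐ g = ∀ p → p ℕ.< N → f p ≡ g p

  0≤_ : Mo → Set
  0≤ f = ∀ p → p ℕ.< N → 0ℤ ≤ f p

  ≐-refl : ∀ {f} → f ≐ f
  ≐-refl p _ = refl

  ≐-trans : ∀ {f g k} → f ≐ g → g ≐ k → f ≐ k
  ≐-trans h k p l = trans (h p l) (k p l)

  0≤-resp : ∀ {f g} → f ≐ g → 0≤ f → 0≤ g
  0≤-resp h k p l = subst (0ℤ ≤_) (h p l) (k p l)

  0≤-⊕ : ∀ {f g} → 0≤ f → 0≤ g → 0≤ (f ⊕ g)
  0≤-⊕ h k p l = 0≤+ (h p l) (k p l)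

  0≤-antisym : ∀ {f} → 0≤ f → 0≤ (⊝ f) → f ≐ 𝟘
  0≤-antisym h k p l = ℤₚ.≤-antisym (0≤-⇒≤0 (k p l)) (h p l)

  0≤𝟙 : 0≤ 𝟙
  0≤𝟙 p _ = +≤+ z≤n

  0≤𝟘 : 0≤ 𝟘
  0≤𝟘 p _ = ℤₚ.≤-refl

  ⟨_,_⟩ : Mo → Mo → ℤ
  ⟨ f , g ⟩ = Σ< N (λ p → f p * g p)

  ⟨⟩-cong : ∀ {f f' g g'} → f ≐ f' → g ≐ g' → ⟨ f , g ⟩ ≡ ⟨ f' , g' ⟩
  ⟨⟩-cong h k = Σ<-cong N λ p l → cong₂ _*_ (h p l) (k p l)

  ⟨⟩-comm : ∀ f g → ⟨ f , g ⟩ ≡ ⟨ g , f ⟩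
  ⟨⟩-comm f g = Σ<-cong N λ p _ → ℤₚ.*-comm (f p) (g p)

  ⟨⟩-⊕ˡ : ∀ f g h → ⟨ f ⊕ g , h ⟩ ≡ ⟨ f , h ⟩ + ⟨ g , h ⟩
  ⟨⟩-⊕ˡ f g h = trans (Σ<-cong N λ p _ → ℤₚ.*-distribʳ-+ (h p) (f p) (g p))
    (Σ<-+ N (λ p → f p * h p) (λ p → g p * h p))

  ⟨⟩-⊝ˡ : ∀ f h → ⟨ ⊝ f , h ⟩ ≡ - ⟨ f , h ⟩
  ⟨⟩-⊝ˡ f h = trans (Σ<-cong N λ p _ → sym (ℤₚ.neg-distribˡ-* (f p) (h p))) (Σ<-neg N _)

  ⟨⟩-⊕ʳ : ∀ f g h → ⟨ f , g ⊕ h ⟩ ≡ ⟨ f , g ⟩ + ⟨ f , h ⟩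
  ⟨⟩-⊕ʳ f g h = trans (⟨⟩-comm f (g ⊕ h)) (trans (⟨⟩-⊕ˡ g h f) (cong₂ _+_ (⟨⟩-comm g f) (⟨⟩-comm h f)))

  ⟨⟩-⊝ʳ : ∀ f h → ⟨ f , ⊝ h ⟩ ≡ - ⟨ f , h ⟩
  ⟨⟩-⊝ʳ f h = trans (⟨⟩-comm f (⊝ h)) (trans (⟨⟩-⊝ˡ h f) (cong -_ (⟨⟩-comm h f)))

  ⟨⟩-0≤ : ∀ {f g} → 0≤ f → 0≤ g → 0ℤ ≤ ⟨ f , g ⟩
  ⟨⟩-0≤ h k = Σ<-nonneg N λ p l → 0≤* (h p l) (k p l)

  ⟨𝟙⟩≡0 : ∀ {f} → 0≤ f → ⟨ 𝟙 , f ⟩ ≤ 0ℤ → f ≐ 𝟘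
  ⟨𝟙⟩≡0 {f} h s p l = trans (sym (ℤₚ.*-identityˡ (f p)))
    (Σ<≡0 N (λ q l' → 0≤* (0≤𝟙 q l') (h q l')) s p l)

  ⟨𝟙,𝟙⟩ : ∀ n → Σ< n (λ p → 1ℤ * 1ℤ) ≡ + n
  ⟨𝟙,𝟙⟩ zero    = refl
  ⟨𝟙,𝟙⟩ (suc n) = trans (cong (_+ 1ℤ) (⟨𝟙,𝟙⟩ n)) (cong +_ (ℕₚ.+-comm n 1))

  -- Both sides sum over the edges in the two directions. The index shift between the two sums costs
  -- nothing, since the gates at 0 and at `N` are cut.
  path-adj : ∀ d → d ∣ N → ∀ f g → ⟨ path d f , g ⟩ ≡ ⟨ f , path d g ⟩
  path-adj d d∣N f g = trans (lem f g) (trans (ℤₚ.+-comm (Σ< N (F f g)) _) (sym (trans (⟨⟩-comm f (path d g)) (lem g f))))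
    where
    F : Mo → Mo → Mo
    F x y p = gate d p (x (pred p) * y p)
    shift : ∀ x y → Σ< N (λ p → F x y (suc p)) ≡ Σ< N (F x y)
    shift x y = trans (trans (sym (ℤₚ.+-identityʳ _)) (cong (_+_ (Σ< N (λ p → F x y (suc p)))) (sym (gate-cut (x 0 * y 0) (d ∣0)))))
      (trans (Σ<-shift N (F x y)) (trans (cong (_+_ (Σ< N (F x y))) (gate-cut (x (pred N) * y N) d∣N)) (ℤₚ.+-identityʳ _)))
    lem : ∀ x y → ⟨ path d x , y ⟩ ≡ Σ< N (F x y) + Σ< N (F y x)
    lem x y = trans (Σ<-cong N λ p _ → trans (ℤₚ.*-distribʳ-+ (y p) (gate d p (x (pred p))) (gate d (suc p) (x (suc p))))
        (cong₂ _+_ (gate-*ʳ d p (x (pred p)) (y p))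
          (trans (gate-*ʳ d (suc p) (x (suc p)) (y p)) (cong (gate d (suc p)) (ℤₚ.*-comm (x (suc p)) (y p))))))
      (trans (Σ<-+ N (F x y) (λ p → F y x (suc p))) (cong (_+_ (Σ< N (F x y))) (shift y x)))

  κ-adj : ∀ m → width m ∣ N → ∀ f g → ⟨ κ m f , g ⟩ ≡ ⟨ f , κ m g ⟩
  κ-adj nothing h f g = trans (⟨⟩-⊕ˡ f f g) (sym (⟨⟩-⊕ʳ f g g))
  κ-adj (just 0) h f g = Σ<-cong N λ p _ → sym (ℤₚ.*-zeroʳ (f p))
  κ-adj (just 1) h f g = Σ<-cong N λ p _ → sym (ℤₚ.*-zeroʳ (f p))
  κ-adj (just (suc (suc k))) h f g = path-adj (suc k) h f g

  private
    suc<N : ∀ {d p} → d ∣ N → p ℕ.< N → ¬ d ∣ suc p → suc p ℕ.< N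
    suc<N {d} {p} d∣N l h = ℕₚ.≤∧≢⇒< l λ e → h (subst (d ∣_) (sym e) d∣N)

    pred<N : ∀ {p} → p ℕ.< N → pred p ℕ.< N
    pred<N l = ℕₚ.≤-<-trans ℕₚ.pred[n]≤n l

  -- No coordinate from `N` on is ever read: the gate at `N` is cut because the width divides `N`.
  κ-cong : ∀ m → width m ∣ N → ∀ {f g} → f ≐ g → κ m f ≐ κ m g
  κ-cong nothing h e p l = cong₂ _+_ (e p l) (e p l)
  κ-cong (just 0) h e p l = refl
  κ-cong (just 1) h e p l = refl
  κ-cong (just (suc (suc k))) h e p l =
    cong₂ _+_ (cong (gate (suc k) p) (e (pred p) (pred<N l)))
      (gate-cong (suc k) (suc p) λ q → e (suc p) (suc<N h l q))

  κ-0≤ : ∀ m → width m ∣ N → ∀ {f} → 0≤ f → 0≤ κ m f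
  κ-0≤ nothing h e p l = 0≤+ (e p l) (e p l)
  κ-0≤ (just 0) h e p l = ℤₚ.≤-refl
  κ-0≤ (just 1) h e p l = ℤₚ.≤-refl
  κ-0≤ (just (suc (suc k))) h e p l =
    0≤+ (gate-0≤ (suc k) p λ _ → e (pred p) (pred<N l))
      (gate-0≤ (suc k) (suc p) λ q → e (suc p) (suc<N h l q))

-- Chebyshev relations for path operators.

-- A discrete wave equation with Dirichlet boundary; its solution is symmetric in time and space.
module Wave (m : ℕ) (H : ℕ → ℕ → ℤ)
  (left : ∀ k → H k 0 ≡ 0ℤ) (right : ∀ k → H k m ≡ 0ℤ) (start : ∀ i → H 0 i ≡ 0ℤ)
  (wave : ∀ k i → suc i ℕ.< m → H (2 ℕ.+ k) (suc i) ≡ H (suc k) i + H (suc k) (2 ℕ.+ i) - H k (suc i))  where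

  private
    alg₁ : ∀ x y z → (x + y) + z - x ≡ z + y
    alg₁ = solve-∀
    alg₂ : ∀ x y z → x + (z + y) - z ≡ x + y
    alg₂ = solve-∀
    alg₃ : ∀ x y z w → x + w ≡ z → (x + y - z) + w ≡ y
    alg₃ x y z w refl = lem x y w
      where
      lem : ∀ x y w → (x + y - (x + w)) + w ≡ y
      lem = solve-∀

  -- A discrete d'Alembert formula: a step along an anti-diagonal changes `H` by an entry of row 1.
  -- `climb` is its analogue for diagonals, and `reflect` continues it past the left boundary.
  descend : ∀ k j → suc (k ℕ.+ j) ℕ.≤ m → H (suc k) (k ℕ.+ j) ≡ H k (suc (k ℕ.+ j)) + H 1 j
  descend zero    j h = sym (trans (cong (_+ H 1 j) (start (suc j))) (ℤₚ.+-identityˡ _))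
  descend (suc k) j h = trans (wave k (k ℕ.+ j) h)
    (trans (cong (λ z → z + H (suc k) (2 ℕ.+ (k ℕ.+ j)) - H k (suc (k ℕ.+ j))) (descend k j (ℕₚ.<⇒≤ h)))
      (alg₁ (H k (suc (k ℕ.+ j))) (H 1 j) (H (suc k) (2 ℕ.+ (k ℕ.+ j)))))

  climb : ∀ k i → suc (k ℕ.+ i) ℕ.≤ m → H (suc k) (suc i) ≡ H k i + H 1 (suc (k ℕ.+ i))
  climb zero    i h = sym (trans (cong (_+ H 1 (suc i)) (start i)) (ℤₚ.+-identityˡ _))
  climb (suc k) i h = trans (wave k i (ℕₚ.≤-trans (s≤s (s≤s (ℕₚ.m≤n+m i k))) h))
    (trans (cong (λ z → H (suc k) i + z - H k (suc i))
      (trans (climb k (suc i) (subst (ℕ._≤ m) (cong suc (sym (ℕₚ.+-suc k i))) h))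
        (cong (λ z → H k (suc i) + H 1 (suc z)) (ℕₚ.+-suc k i))))
      (alg₂ (H (suc k) i) (H 1 (2 ℕ.+ (k ℕ.+ i))) (H k (suc i))))

  column : ∀ j → j ℕ.≤ m → H j 1 ≡ H 1 j
  column zero    h = trans (start 1) (sym (left 1))
  column (suc j) h = trans (climb j 0 (subst (ℕ._≤ m) (cong suc (sym (ℕₚ.+-identityʳ j))) h))
    (trans (cong₂ _+_ (left j) (cong (λ z → H 1 (suc z)) (ℕₚ.+-identityʳ j))) (ℤₚ.+-identityˡ _))

  reflect : ∀ i j → i ℕ.< m → j ℕ.≤ m → H (suc (i ℕ.+ j)) i + H 1 j ≡ H (i ℕ.+ j) (suc i)
  reflect zero    j _ h = trans (cong (_+ H 1 j) (left (suc j))) (trans (ℤₚ.+-identityˡ _) (sym (column j h)))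
  reflect (suc i) j l h = trans (cong (_+ H 1 j) (wave (i ℕ.+ j) i l))
    (alg₃ (H (suc (i ℕ.+ j)) i) (H (suc (i ℕ.+ j)) (2 ℕ.+ i)) (H (i ℕ.+ j) (suc i)) (H 1 j) (reflect i j (ℕₚ.<-trans (ℕₚ.n<1+n i) l) h))

  -- Induction on the distance from the diagonal in steps of two. `descend` moves inward on one side
  -- and `reflect` outward on the other, and both pick up the same entry `H 1 (suc g)`.
  symmetric : ∀ g k → k ℕ.+ g ℕ.≤ m → H k (k ℕ.+ g) ≡ H (k ℕ.+ g) k
  symmetric zero k h = trans (cong (H k) (ℕₚ.+-identityʳ k)) (cong (λ z → H z k) (sym (ℕₚ.+-identityʳ k)))
  symmetric (suc zero) k h rewrite ℕₚ.+-comm k 1 = sym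
    (trans (cong (H (suc k)) (sym (ℕₚ.+-identityʳ k)))
     (trans (descend k 0 (subst (ℕ._≤ m) (cong suc (sym (ℕₚ.+-identityʳ k))) h))
      (trans (cong₂ _+_ (cong (λ z → H k (suc z)) (ℕₚ.+-identityʳ k)) (left 1)) (ℤₚ.+-identityʳ _))))
  symmetric (suc (suc g)) k h rewrite ℕₚ.+-suc k (suc g) | ℕₚ.+-suc k g =
    cancel (H 1 (suc g))
      (trans (subst (λ z → H k (suc z) + H 1 (suc g) ≡ H (suc k) z) (ℕₚ.+-suc k g)
                (sym (descend k (suc g) (subst (ℕ._≤ m) (cong suc (sym (ℕₚ.+-suc k g))) h))))
        (trans (symmetric g (suc k) (ℕₚ.<⇒≤ h))
          (subst (λ z → H z (suc k) ≡ H (suc z) k + H 1 (suc g)) (ℕₚ.+-suc k g)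
            (sym (reflect k (suc g) (ℕₚ.≤-trans (s≤s (ℕₚ.m≤m+n k g)) (ℕₚ.<⇒≤ h))
              (ℕₚ.≤-trans (s≤s (ℕₚ.m≤n+m g k)) (ℕₚ.<⇒≤ h)))))))
    where
    cancel : ∀ {x y} c → x + c ≡ y + c → x ≡ y
    cancel {x} {y} c e = trans (lem x c) (trans (cong (_- c) e) (sym (lem y c)))
      where
      lem : ∀ x c → x ≡ x + c - c
      lem = solve-∀

  nonneg-above : (∀ i → 0ℤ ≤ H 1 i) → ∀ k i → k ℕ.≤ i → i ℕ.≤ m → 0ℤ ≤ H k i
  nonneg-above init zero    i _ _ = ℤₚ.≤-reflexive (sym (start i))
  nonneg-above init (suc k) i k<i i≤m with i ℕ.≟ m
  ... | yes refl = ℤₚ.≤-reflexive (sym (right (suc k)))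
  ... | no i≢m = subst (λ z → 0ℤ ≤ H (suc k) z) k+j≡i (subst (0ℤ ≤_) (sym (descend k j sk+j≤m))
        (0≤+ (subst (λ z → 0ℤ ≤ H k (suc z)) (sym k+j≡i)
               (nonneg-above init k (suc i) (ℕₚ.≤-trans (ℕₚ.<⇒≤ k<i) (ℕₚ.n≤1+n i)) i<m))
             (init j)))
    where
    j = i ℕ.∸ k
    k+j≡i : k ℕ.+ j ≡ i
    k+j≡i = ℕₚ.m+[n∸m]≡n (ℕₚ.<⇒≤ k<i)
    i<m : i ℕ.< m
    i<m = ℕₚ.≤∧≢⇒< i≤m i≢m
    sk+j≤m : suc (k ℕ.+ j) ℕ.≤ m
    sk+j≤m = subst (λ z → suc z ℕ.≤ m) (sym k+j≡i) i<m

  sym≤ : ∀ k i → k ℕ.≤ i → i ℕ.≤ m → H k i ≡ H i k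
  sym≤ k i h i≤m = subst (λ z → H k z ≡ H z k) (ℕₚ.m+[n∸m]≡n h)
    (symmetric (i ℕ.∸ k) k (subst (ℕ._≤ m) (sym (ℕₚ.m+[n∸m]≡n h)) i≤m))

  nonneg : (∀ i → 0ℤ ≤ H 1 i) → ∀ k i → k ℕ.≤ m → i ℕ.≤ m → 0ℤ ≤ H k i
  nonneg init k i k≤m i≤m with ℕₚ.≤-total k i
  ... | inj₁ k≤i = nonneg-above init k i k≤i i≤m
  ... | inj₂ i≤k = subst (0ℤ ≤_) (sym≤ i k i≤k k≤m) (nonneg-above init i k i≤k k≤m)

  -- By symmetry the last row is the right boundary. For a path with m - 1 vertices this says that
  -- the Chebyshev polynomial of degree m - 1 annihilates its adjacency matrix.
  end : ∀ i → i ℕ.≤ m → H m i ≡ 0ℤ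
  end i i≤m = trans (sym (sym≤ i m i≤m ℕₚ.≤-refl)) (right i)

-- Chebyshev polynomials of the second kind, shifted: S (i + 1) = U i evaluated at κ/2.
S : Maybe ℕ → ℕ → Mo → Mo
S m 0             f = 𝟘
S m 1             f = f
S m (suc (suc i)) f = κ m (S m (suc i) f) ⊖ S m i f

-- The `q`-th block as a string with fixed ends: the shift by one makes index 0 and the indices
-- beyond `d` the Dirichlet boundary.
block : ℕ → ℕ → Mo → Mo
block d q f zero    = 0ℤ
block d q f (suc i) = if does (i ℕ.<? d) then f (q ℕ.* d ℕ.+ i) else 0ℤ

block-in : ∀ {d i} q f → i ℕ.< d → block d q f (suc i) ≡ f (q ℕ.* d ℕ.+ i)
block-in {d} {i} q f l = cong (λ b → if b then f (q ℕ.* d ℕ.+ i) else 0ℤ) (dec-true (i ℕ.<? d) l)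

block-out : ∀ {d i} q f → ¬ i ℕ.< d → block d q f (suc i) ≡ 0ℤ
block-out {d} {i} q f l = cong (λ b → if b then f (q ℕ.* d ℕ.+ i) else 0ℤ) (dec-false (i ℕ.<? d) l)

path-block : ∀ k q f {i} → i ℕ.< suc k →
  path (suc k) f (q ℕ.* suc k ℕ.+ i) ≡ block (suc k) q f i + block (suc k) q f (2 ℕ.+ i)
path-block k q f {i} i<d = cong₂ _+_ (lhs i i<d) rhs
  where
  d = suc k
  base : d ∣ q ℕ.* d
  base = n∣m*n q
  inside : ∀ j → suc j ℕ.< d → ¬ d ∣ q ℕ.* d ℕ.+ suc j
  inside j l h = ℕₚ.<⇒≱ l (∣⇒≤ (∣m+n∣m⇒∣n h base))
  lhs : ∀ i → i ℕ.< d → gate d (q ℕ.* d ℕ.+ i) (f (pred (q ℕ.* d ℕ.+ i))) ≡ block d q f i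
  lhs zero    l = gate-cut _ (∣m∣n⇒∣m+n base (d ∣0))
  lhs (suc j) l = trans (gate-open _ (inside j l))
    (trans (cong (λ z → f (pred z)) (ℕₚ.+-suc (q ℕ.* d) j))
      (sym (block-in q f (ℕₚ.<-trans (ℕₚ.n<1+n j) l))))
  edge : Dec (suc i ℕ.< d) → gate d (q ℕ.* d ℕ.+ suc i) (f (q ℕ.* d ℕ.+ suc i)) ≡ block d q f (2 ℕ.+ i)
  edge (yes l) = trans (gate-open _ (inside i l)) (sym (block-in q f l))
  edge (no ¬l) = trans (gate-cut _ (subst (λ z → d ∣ q ℕ.* d ℕ.+ z) (sym si≡d)
                     (∣m∣n⇒∣m+n base (divides 1 (sym (ℕₚ.+-identityʳ d))))))
                   (sym (block-out q f ¬l))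
    where
    si≡d : suc i ≡ d
    si≡d = ℕₚ.≤-antisym i<d (ℕₚ.≮⇒≥ ¬l)
  rhs : gate d (suc (q ℕ.* d ℕ.+ i)) (f (suc (q ℕ.* d ℕ.+ i))) ≡ block d q f (2 ℕ.+ i)
  rhs = trans (cong (λ z → gate d z (f z)) (sym (ℕₚ.+-suc (q ℕ.* d) i))) (edge (suc i ℕ.<? d))

module Chebyshev (N : ℕ) where
  open Bounded N

  module PathOperator (k : ℕ) (d∣N : suc k ∣ N) where
    private
      d = suc k
      H : ℕ → Mo → ℕ → ℕ → ℤ
      H q f j i = block d q (S (just (suc d)) j f) i

    module Block (q : ℕ) (f : Mo) where

      H-wave : ∀ j i → suc i ℕ.< suc d →
        H q f (2 ℕ.+ j) (suc i) ≡ H q f (suc j) i + H q f (suc j) (2 ℕ.+ i) - H q f j (suc i)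
      H-wave j i (s≤s l) = trans (block-in q (S (just (suc d)) (2 ℕ.+ j) f) l)
        (cong₂ _+_ (path-block k q (S (just (suc d)) (suc j) f) l)
          (cong -_ (sym (block-in q (S (just (suc d)) j f) l))))

      H-right : ∀ j → H q f j (suc d) ≡ 0ℤ
      H-right j = block-out q (S (just (suc d)) j f) (ℕₚ.n≮n d)

      H-start : ∀ i → H q f 0 i ≡ 0ℤ
      H-start zero = refl
      H-start (suc i) with does (i ℕ.<? d)
      ... | true = refl
      ... | false = refl

      module W = Wave (suc d) (H q f) (λ _ → refl) H-right H-start H-wave

    block-0≤ : ∀ {f} → 0≤ f → ∀ q → q ℕ.* d ℕ.< N → ∀ i → 0ℤ ≤ block d q f i
    block-0≤ h q l zero = ℤₚ.≤-refl
    block-0≤ {f} h q l (suc i) with i ℕ.<? d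
    ... | no ¬p = ℤₚ.≤-reflexive (sym (block-out q f ¬p))
    ... | yes i<d = subst (0ℤ ≤_) (sym (block-in q f i<d)) (h _ (inN d∣N))
      where
      inN : d ∣ N → q ℕ.* d ℕ.+ i ℕ.< N
      inN (divides r e) = ℕₚ.<-≤-trans (ℕₚ.+-monoʳ-< (q ℕ.* d) i<d)
        (subst (q ℕ.* d ℕ.+ d ℕ.≤_) (sym e)
          (subst (ℕ._≤ r ℕ.* d) (ℕₚ.+-comm d (q ℕ.* d))
            (ℕₚ.*-monoˡ-≤ d (ℕₚ.*-cancelʳ-< d q r (subst (q ℕ.* d ℕ.<_) e l)))))

    position : ∀ p → p ≡ p / d ℕ.* d ℕ.+ p % d
    position p = trans (m≡m%n+[m/n]*n p d) (ℕₚ.+-comm (p % d) _)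

    value : ∀ g p → g p ≡ block d (p / d) g (suc (p % d))
    value g p = trans (cong g (position p)) (sym (block-in (p / d) g (m%n<n p d)))

    path-S-0≤ : ∀ {f} → 0≤ f → ∀ j → j ℕ.≤ suc d → 0≤ S (just (suc d)) j f
    path-S-0≤ {f} h j j≤m p p<N = subst (0ℤ ≤_) (sym (value (S (just (suc d)) j f) p))
      (Block.W.nonneg (p / d) f (block-0≤ h (p / d) (ℕₚ.≤-<-trans (ℕₚ.m≤m+n _ _) (subst (ℕ._< N) (position p) p<N)))
        j (suc (p % d)) j≤m (ℕₚ.<⇒≤ (s≤s (m%n<n p d))))

    path-S-zero : ∀ f → S (just (suc d)) (suc d) f ≐ 𝟘
    path-S-zero f p _ = trans (value (S (just (suc d)) (suc d) f) p) (Block.W.end (p / d) f (suc (p % d)) (ℕₚ.<⇒≤ (s≤s (m%n<n p d))))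

  S-0≤ : ∀ {m k} → width m ∣ N → m ≡ just k → 2 ℕ.≤ k → ∀ {f} → 0≤ f → ∀ j → j ℕ.≤ k → 0≤ S m j f
  S-0≤ {k = suc (suc k)} w refl (s≤s (s≤s _)) = PathOperator.path-S-0≤ k w

  S-zero : ∀ {m k} → width m ∣ N → m ≡ just k → 2 ℕ.≤ k → ∀ f → S m k f ≐ 𝟘
  S-zero {k = suc (suc k)} w refl (s≤s (s≤s _)) = PathOperator.path-S-zero k w

  S-∞ : ∀ j f p → S nothing j f p ≡ + j * f p
  S-∞ zero          f p = refl
  S-∞ (suc zero)    f p = sym (ℤₚ.*-identityˡ (f p))
  S-∞ (suc (suc j)) f p = trans (cong₂ (λ x y → (x + x) - y) (S-∞ (suc j) f p) (S-∞ j f p))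
    (lem (+ j) (f p))
    where
    lem : ∀ j x → ((1ℤ + j) * x + (1ℤ + j) * x) - j * x ≡ (1ℤ + (1ℤ + j)) * x
    lem = solve-∀

  S-0≤-∞ : ∀ {m} → m ≡ nothing → ∀ {f} → 0≤ f → ∀ j → 0≤ S m j f
  S-0≤-∞ refl {f} h j p l = subst (0ℤ ≤_) (sym (S-∞ j f p)) (0≤* {+ j} (+≤+ z≤n) (h p l))

  -- The analogue of sin(kθ + iθ) = - sin(kθ - iθ) for sin(kθ) = 0: the recursion is symmetric under
  -- reversing the index, so a zero makes its solution odd about that point.
  S-reflect : ∀ {m} → width m ∣ N → ∀ k f → S m k f ≐ 𝟘 →
              ∀ i a → a ℕ.+ i ≡ k → S m (k ℕ.+ i) f ≐ ⊝ S m a f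
  S-reflect {m} w k f z = λ i a e → proj₁ (go i) a e
    where
    Refl : ℕ → Set
    Refl i = ∀ a → a ℕ.+ i ≡ k → S m (k ℕ.+ i) f ≐ ⊝ S m a f
    zero-case : Refl 0
    zero-case a e p l rewrite ℕₚ.+-identityʳ a | e | ℕₚ.+-identityʳ k = trans (z p l) (cong -_ (sym (z p l)))
    one-case : Refl 1
    one-case a e p l rewrite ℕₚ.+-comm a 1 | ℕₚ.+-comm k 1 | sym e =
      trans (cong (_+ (- S m a f p)) (trans (κ-cong m w z p l) (κ-𝟘 m p))) (ℤₚ.+-identityˡ (- S m a f p))
      where
      κ-𝟘 : ∀ m p → κ m 𝟘 p ≡ 0ℤ
      κ-𝟘 nothing p = refl
      κ-𝟘 (just 0) p = refl
      κ-𝟘 (just 1) p = refl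
      κ-𝟘 (just (suc (suc j))) p = cong₂ _+_ (gate-0 (suc j) p) (gate-0 (suc j) (suc p))
        where
        gate-0 : ∀ d p → gate d p 0ℤ ≡ 0ℤ
        gate-0 d p with does (d ∣? p)
        ... | true = refl
        ... | false = refl
    go : ∀ i → Refl i × Refl (suc i)
    go zero = zero-case , one-case
    go (suc i) = proj₂ (go i) , step
      where
      step : Refl (2 ℕ.+ i)
      step a e p l rewrite ℕₚ.+-suc k (suc i) | ℕₚ.+-suc k i =
        trans (cong₂ _-_ (trans (κ-cong m w (subst (λ z → S m z f ≐ ⊝ S m (suc a) f) (ℕₚ.+-suc k i)
                              (proj₂ (go i) (suc a) (trans (sym (ℕₚ.+-suc a (suc i))) e))) p l)
                            (κ-⊝ m (S m (suc a) f) p))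
                         (proj₁ (go i) (2 ℕ.+ a) (trans (cong suc (sym (ℕₚ.+-suc a i))) (trans (sym (ℕₚ.+-suc a (suc i))) e)) p l))
          (lem (κ m (S m (suc a) f) p) (S m a f p))
        where
        lem : ∀ x y → - x - (- (x - y)) ≡ - y
        lem = solve-∀

-- The geometric representation over the integers.

∏ : ∀ k → (Fin k → ℕ) → ℕ
∏ zero    f = 1
∏ (suc k) f = f fzero ℕ.* ∏ k (λ i → f (fsuc i))

∏-∣ : ∀ k f i → f i ∣ ∏ k f
∏-∣ (suc k) f fzero    = m∣m*n _
∏-∣ (suc k) f (fsuc i) = ∣-trans (∏-∣ k _ i) (n∣m*n (f fzero))

∏-pos : ∀ k f → (∀ i → 0 ℕ.< f i) → 0 ℕ.< ∏ k f
∏-pos zero    f h = s≤s z≤n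
∏-pos (suc k) f h = ℕₚ.*-mono-≤ (h fzero) (∏-pos k _ (λ i → h (fsuc i)))

width-pos : ∀ m → 0 ℕ.< width m
width-pos nothing = s≤s z≤n
width-pos (just 0) = s≤s z≤n
width-pos (just 1) = s≤s z≤n
width-pos (just (suc (suc k))) = s≤s z≤n

alt-shift : ∀ {n} (x y : Fin n) k → alt x y k ++ x ∷ [] ≡ x ∷ alt y x k
alt-shift x y zero    = refl
alt-shift x y (suc k) = cong (λ w → x ∷ y ∷ w) (alt-shift x y k)

alt-snoc : ∀ {n} (x y : Fin n) k → alt x y k ++ x ∷ y ∷ [] ≡ alt x y (suc k)
alt-snoc x y zero    = refl
alt-snoc x y (suc k) = cong (λ w → x ∷ y ∷ w) (alt-snoc x y k)

reverse-alt : ∀ {n} (x y : Fin n) k → reverse (alt x y k) ≡ alt y x k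
reverse-alt x y zero = refl
reverse-alt x y (suc k) = trans (unfold-reverse x (y ∷ alt x y k))
  (trans (cong (_∷ʳ x) (unfold-reverse y (alt x y k)))
    (trans (++-assoc (reverse (alt x y k)) (y ∷ []) (x ∷ []))
      (trans (cong (_++ y ∷ x ∷ []) (reverse-alt x y k)) (alt-snoc y x k))))

altw : ∀ {n} → Fin n → Fin n → ℕ → Word n
altw x y zero    = []
altw x y (suc j) = x ∷ altw y x j

altw-alt : ∀ {n} (x y : Fin n) k → altw x y (k ℕ.+ k) ≡ alt x y k
altw-alt x y zero = refl
altw-alt x y (suc k) rewrite ℕₚ.+-suc k k = cong (λ w → x ∷ y ∷ w) (altw-alt x y k)

module Geometry {n : ℕ} (M : CoxeterMatrix n) where
  open CoxeterMatrix M public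
  open Coxeter M public

  -- Every block length divides N, so that the first N coordinates consist of whole blocks.
  N : ℕ
  N = ∏ n (λ i → ∏ n (λ j → width (m i j)))

  width∣N : ∀ i j → width (m i j) ∣ N
  width∣N i j = ∣-trans (∏-∣ n (λ j → width (m i j)) j) (∏-∣ n (λ i → ∏ n (λ j → width (m i j))) i)

  N-pos : 0 ℕ.< N
  N-pos = ∏-pos n _ λ i → ∏-pos n _ λ j → width-pos (m i j)

  open Bounded N public
  open Chebyshev N public

  V : Set
  V = Fin n → Mo

  infix 4 _≋_
  _≋_ : V → V → Set
  v ≋ w = ∀ r → v r ≐ w r

  ≋-refl : ∀ {v} → v ≋ v
  ≋-refl r p l = refl

  ≋-sym : ∀ {v w} → v ≋ w → w ≋ v
  ≋-sym e r p l = sym (e r p l)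

  ≋-trans : ∀ {u v w} → u ≋ v → v ≋ w → u ≋ w
  ≋-trans e f r p l = trans (e r p l) (f r p l)

  ≡⇒≋ : ∀ {v w} → v ≡ w → v ≋ w
  ≡⇒≋ refl r p l = refl

  infixl 6 _+ᵥ_
  _+ᵥ_ : V → V → V
  (v +ᵥ w) r = v r ⊕ w r

  -ᵥ_ : V → V
  (-ᵥ v) r = ⊝ v r

  0ᵥ : V
  0ᵥ _ = 𝟘

  +ᵥ-cong : ∀ {u v w z} → u ≋ v → w ≋ z → (u +ᵥ w) ≋ (v +ᵥ z)
  +ᵥ-cong e f r p l = cong₂ _+_ (e r p l) (f r p l)

  Nonneg : V → Set
  Nonneg v = ∀ r → 0≤ v r

  Nonneg-resp : ∀ {v w} → v ≋ w → Nonneg v → Nonneg w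
  Nonneg-resp e h r = 0≤-resp (e r) (h r)

  Nonneg-+ : ∀ {v w} → Nonneg v → Nonneg w → Nonneg (v +ᵥ w)
  Nonneg-+ h k r = 0≤-⊕ (h r) (k r)

  Nonneg-0 : Nonneg 0ᵥ
  Nonneg-0 r = 0≤𝟘

  Nonneg-antisym : ∀ {v} → Nonneg v → Nonneg (-ᵥ v) → v ≋ 0ᵥ
  Nonneg-antisym h k r = 0≤-antisym (h r) (k r)

  upd : Fin n → Mo → V → V
  upd s x v q = if does (s ≟ q) then x else v q

  upd-same : ∀ s x v → upd s x v s ≡ x
  upd-same s x v = cong (λ b → if b then x else v s) (dec-true (s ≟ s) refl)

  upd-other : ∀ {s q} x v → s ≢ q → upd s x v q ≡ v q
  upd-other {s} {q} x v h = cong (λ b → if b then x else v q) (dec-false (s ≟ q) h)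

  upd-elim : ∀ (s : Fin n) (P : Fin n → Set) → P s → (∀ q → s ≢ q → P q) → ∀ q → P q
  upd-elim s P ps po q with s ≟ q
  ... | yes refl = ps
  ... | no h = po q h

  α : Fin n → Mo → V
  α s f = upd s f 0ᵥ

  α-same : ∀ s f p → α s f s p ≡ f p
  α-same s f p = cong (λ g → g p) (upd-same s f 0ᵥ)

  α-other : ∀ {s q} f p → s ≢ q → α s f q p ≡ 0ℤ
  α-other f p h = cong (λ g → g p) (upd-other f 0ᵥ h)

  α-cong : ∀ s {f g} → f ≐ g → α s f ≋ α s g
  α-cong s {f} {g} e = upd-elim s _ (λ p l → trans (α-same s f p) (trans (e p l) (sym (α-same s g p))))
    λ q h p l → trans (α-other f p h) (sym (α-other g p h))

  α-⊕ : ∀ s f g → α s (f ⊕ g) ≋ (α s f +ᵥ α s g)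
  α-⊕ s f g = upd-elim s _ (λ p l → trans (α-same s _ p) (sym (cong₂ _+_ (α-same s f p) (α-same s g p))))
    λ q h p l → trans (α-other _ p h) (sym (cong₂ _+_ (α-other f p h) (α-other g p h)))

  α-⊝ : ∀ s f → α s (⊝ f) ≋ (-ᵥ α s f)
  α-⊝ s f = upd-elim s _ (λ p l → trans (α-same s _ p) (sym (cong -_ (α-same s f p))))
    λ q h p l → trans (α-other _ p h) (sym (cong -_ (α-other f p h)))

  α-𝟘 : ∀ s {f} → f ≐ 𝟘 → α s f ≋ 0ᵥ
  α-𝟘 s {f} e = upd-elim s _ (λ p l → trans (α-same s _ p) (e p l)) λ q h p l → α-other _ p h

  Nonneg-α : ∀ s {f} → 0≤ f → Nonneg (α s f)
  Nonneg-α s {f} h = upd-elim s _ (λ p l → subst (0ℤ ≤_) (sym (α-same s f p)) (h p l))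
    λ q k p l → ℤₚ.≤-reflexive (sym (α-other f p k))

  ΣF : ∀ k → (Fin k → Mo) → Mo
  ΣF zero    f = 𝟘
  ΣF (suc k) f = f fzero ⊕ ΣF k (λ i → f (fsuc i))

  ΣF-cong : ∀ k {f g : Fin k → Mo} → (∀ i → f i ≐ g i) → ΣF k f ≐ ΣF k g
  ΣF-cong zero    e p l = refl
  ΣF-cong (suc k) e p l = cong₂ _+_ (e fzero p l) (ΣF-cong k (λ i → e (fsuc i)) p l)

  ΣF-⊕ : ∀ k (f g : Fin k → Mo) → ΣF k (λ i → f i ⊕ g i) ≐ (ΣF k f ⊕ ΣF k g)
  ΣF-⊕ zero    f g p l = refl
  ΣF-⊕ (suc k) f g p l = trans (cong (_+_ (f fzero p + g fzero p)) (ΣF-⊕ k (λ i → f (fsuc i)) (λ i → g (fsuc i)) p l))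
    (+-exchange (f fzero p) (g fzero p) (ΣF k (λ i → f (fsuc i)) p) (ΣF k (λ i → g (fsuc i)) p))

  ΣF-⊝ : ∀ k (f : Fin k → Mo) → ΣF k (λ i → ⊝ f i) ≐ (⊝ ΣF k f)
  ΣF-⊝ zero    f p l = refl
  ΣF-⊝ (suc k) f p l = trans (cong (_+_ (- f fzero p)) (ΣF-⊝ k (λ i → f (fsuc i)) p l))
    (sym (ℤₚ.neg-distrib-+ (f fzero p) (ΣF k (λ i → f (fsuc i)) p)))

  ΣF-𝟘 : ∀ k p → ΣF k (λ _ → 𝟘) p ≡ 0ℤ
  ΣF-𝟘 zero    p = refl
  ΣF-𝟘 (suc k) p = trans (ℤₚ.+-identityˡ _) (ΣF-𝟘 k p)

  ΣF-single : ∀ k (f : Fin k → Mo) s → (∀ i → s ≢ i → f i ≐ 𝟘) → ΣF k f ≐ f s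
  ΣF-single (suc k) f fzero h p l = trans (cong (_+_ (f fzero p)) (trans (ΣF-cong k {g = λ _ → 𝟘} (λ i → h (fsuc i) λ ()) p l) (ΣF-𝟘 k p)))
    (ℤₚ.+-identityʳ (f fzero p))
  ΣF-single (suc k) f (fsuc s) h p l = trans (cong₂ _+_ (h fzero (λ ()) p l)
    (ΣF-single k (λ i → f (fsuc i)) s (λ i s≢i → h (fsuc i) λ { refl → s≢i refl }) p l))
    (ℤₚ.+-identityˡ (f (fsuc s) p))

  κ-self : ∀ s f p → κ (m s s) f p ≡ 0ℤ
  κ-self s f p rewrite m-diag s = refl

  κ-𝟘 : ∀ s r {f} → f ≐ 𝟘 → κ (m s r) f ≐ 𝟘
  κ-𝟘 s r {f} e p l = trans (κ-cong (m s r) (width∣N s r) e p l) (lem (κ (m s r) 𝟘 p) (κ-⊕ (m s r) 𝟘 𝟘 p))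
    where
    lem : ∀ x → x ≡ x + x → x ≡ 0ℤ
    lem x e = sym (trans (sym (ℤₚ.+-inverseʳ x)) (trans (cong (_- x) e) (trans (ℤₚ.+-assoc x x (- x)) (trans (cong (_+_ x) (ℤₚ.+-inverseʳ x)) (ℤₚ.+-identityʳ x)))))

  Nb : Fin n → V → Mo
  Nb s v = ΣF n (λ r → κ (m s r) (v r))

  Nb-cong : ∀ s {v w} → (∀ r → s ≢ r → v r ≐ w r) → Nb s v ≐ Nb s w
  Nb-cong s {v} {w} e = ΣF-cong n (upd-elim s _
    (λ p l → trans (κ-self s (v s) p) (sym (κ-self s (w s) p)))
    λ r h → κ-cong (m s r) (width∣N s r) (e r h))

  Nb-+ : ∀ s v w → Nb s (v +ᵥ w) ≐ (Nb s v ⊕ Nb s w)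
  Nb-+ s v w = ≐-trans (ΣF-cong n λ r p l → κ-⊕ (m s r) (v r) (w r) p)
    (ΣF-⊕ n (λ r → κ (m s r) (v r)) (λ r → κ (m s r) (w r)))

  Nb-neg : ∀ s v → Nb s (-ᵥ v) ≐ (⊝ Nb s v)
  Nb-neg s v = ≐-trans (ΣF-cong n λ r p l → κ-⊝ (m s r) (v r) p) (ΣF-⊝ n (λ r → κ (m s r) (v r)))

  Nb-α : ∀ s r f → Nb s (α r f) ≐ κ (m s r) f
  Nb-α s r f = ≐-trans (ΣF-single n (λ q → κ (m s q) (α r f q)) r λ q h → κ-𝟘 s q λ p l → α-other f p h)
    (κ-cong (m s r) (width∣N s r) λ p l → α-same r f p)

  -- The usual reflection, written in the coordinate at s. Since m s s = 1 makes `κ (m s s)` zero,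
  -- `Nb` collects the neighbours of s only.
  rf : Fin n → V → V
  rf s v = upd s (Nb s v ⊖ v s) v

  rf-same : ∀ s v p → rf s v s p ≡ Nb s v p - v s p
  rf-same s v p = cong (λ g → g p) (upd-same s (Nb s v ⊖ v s) v)

  rf-other : ∀ {s q} v p → s ≢ q → rf s v q p ≡ v q p
  rf-other {s} v p h = cong (λ g → g p) (upd-other (Nb s v ⊖ v s) v h)

  rf-cong : ∀ s {v w} → v ≋ w → rf s v ≋ rf s w
  rf-cong s {v} {w} e = upd-elim s _
    (λ p l → trans (rf-same s v p) (trans (cong₂ _-_ (Nb-cong s (λ r _ → e r) p l) (e s p l)) (sym (rf-same s w p))))
    λ q h p l → trans (rf-other v p h) (trans (e q p l) (sym (rf-other w p h)))

  rf-+ : ∀ s v w → rf s (v +ᵥ w) ≋ (rf s v +ᵥ rf s w)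
  rf-+ s v w = upd-elim s _
    (λ p l → trans (rf-same s (v +ᵥ w) p) (trans (cong (_- (v s p + w s p)) (Nb-+ s v w p l))
      (trans (lem (Nb s v p) (Nb s w p) (v s p) (w s p)) (sym (cong₂ _+_ (rf-same s v p) (rf-same s w p))))))
    λ q h p l → trans (rf-other (v +ᵥ w) p h) (sym (cong₂ _+_ (rf-other v p h) (rf-other w p h)))
    where
    lem : ∀ a b c d → (a + b) - (c + d) ≡ (a - c) + (b - d)
    lem = solve-∀

  rf-neg : ∀ s v → rf s (-ᵥ v) ≋ (-ᵥ rf s v)
  rf-neg s v = upd-elim s _
    (λ p l → trans (rf-same s (-ᵥ v) p) (trans (cong (_- (- v s p)) (Nb-neg s v p l))
      (trans (lem (Nb s v p) (v s p)) (sym (cong -_ (rf-same s v p))))))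
    λ q h p l → trans (rf-other (-ᵥ v) p h) (sym (cong -_ (rf-other v p h)))
    where
    lem : ∀ a c → - a - (- c) ≡ - (a - c)
    lem = solve-∀

  rf-invol : ∀ s v → rf s (rf s v) ≋ v
  rf-invol s v = upd-elim s _
    (λ p l → trans (rf-same s (rf s v) p) (trans (cong₂ _-_ (Nb-cong s (λ r h p l → rf-other v p h) p l) (rf-same s v p))
      (lem (Nb s v p) (v s p))))
    λ q h p l → trans (rf-other (rf s v) p h) (rf-other v p h)
    where
    lem : ∀ a c → a - (a - c) ≡ c
    lem = solve-∀

  rf-α-self : ∀ s f → rf s (α s f) ≋ α s (⊝ f)
  rf-α-self s f = upd-elim s _
    (λ p l → trans (rf-same s (α s f) p) (trans (cong₂ _-_ (trans (Nb-α s s f p l) (κ-self s f p)) (α-same s f p))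
      (trans (ℤₚ.+-identityˡ (- f p)) (sym (α-same s _ p)))))
    λ q h p l → trans (rf-other (α s f) p h) (trans (α-other f p h) (sym (α-other (⊝ f) p h)))

  rf-shift : ∀ s v → rf s v ≋ (v +ᵥ α s (rf s v s ⊖ v s))
  rf-shift s v = upd-elim s _
    (λ p l → sym (trans (cong (_+_ (v s p)) (α-same s _ p)) (lem (v s p) (rf s v s p))))
    λ q h p l → trans (rf-other v p h) (sym (trans (cong (_+_ (v q p)) (α-other _ p h)) (ℤₚ.+-identityʳ (v q p))))
    where
    lem : ∀ a c → a + (c - a) ≡ c
    lem = solve-∀

  rf-α : ∀ {r s} f → r ≢ s → rf r (α s f) ≋ (α s f +ᵥ α r (κ (m r s) f))
  rf-α {r} {s} f r≢s = ≋-trans (rf-shift r (α s f)) (+ᵥ-cong (≋-refl {α s f}) (α-cong r λ p l →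
    trans (cong₂ _-_ (trans (rf-same r (α s f) p) (cong₂ _-_ (Nb-α r s f p l) (α-other f p (≢-sym r≢s))))
       (α-other f p (≢-sym r≢s))) (lem (κ (m r s) f p))))
    where
    lem : ∀ a → (a - 0ℤ) - 0ℤ ≡ a
    lem = solve-∀

  -- iact w is the action of w⁻¹.
  iact : Word n → V → V
  iact []      v = v
  iact (a ∷ w) v = iact w (rf a v)

  iact-++ : ∀ u w v → iact (u ++ w) v ≡ iact w (iact u v)
  iact-++ []      w v = refl
  iact-++ (a ∷ u) w v = iact-++ u w (rf a v)

  iact-cong : ∀ w {u v} → u ≋ v → iact w u ≋ iact w v
  iact-cong []      e = e
  iact-cong (a ∷ w) e = iact-cong w (rf-cong a e)

  iact-+ : ∀ w u v → iact w (u +ᵥ v) ≋ (iact w u +ᵥ iact w v)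
  iact-+ []      u v = ≋-refl
  iact-+ (a ∷ w) u v = ≋-trans (iact-cong w (rf-+ a u v)) (iact-+ w (rf a u) (rf a v))

  iact-neg : ∀ w v → iact w (-ᵥ v) ≋ (-ᵥ iact w v)
  iact-neg []      v = ≋-refl
  iact-neg (a ∷ w) v = ≋-trans (iact-cong w (rf-neg a v)) (iact-neg w (rf a v))

  iact-0 : ∀ w {v} → v ≋ 0ᵥ → iact w v ≋ 0ᵥ
  iact-0 []      e = e
  iact-0 (a ∷ w) {v} e = iact-0 w (≋-trans (rf-cong a e)
    (upd-elim a _ (λ p l → trans (rf-same a 0ᵥ p) (cong (_- 0ℤ) (trans (Nb-cong a {w = α a 𝟘} (λ r h p l → sym (α-other 𝟘 p h)) p l)
        (trans (Nb-α a a 𝟘 p l) (κ-self a 𝟘 p)))))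
      λ q h p l → rf-other 0ᵥ p h))

  iact-other : ∀ w v {q} → q ∉ w → ∀ p → iact w v q p ≡ v q p
  iact-other []      v h p = refl
  iact-other (a ∷ w) v {q} h p = trans (iact-other w (rf a v) (λ k → h (there k)) p)
    (rf-other v p λ e → h (here (sym e)))

  iact-cancel : ∀ w v → iact w (iact (reverse w) v) ≋ v
  iact-cancel []      v = ≋-refl
  iact-cancel (a ∷ w) v = ≋-trans (iact-cong w (≋-trans (rf-cong a (≡⇒≋ (trans (cong (λ z → iact z v) (unfold-reverse a w)) (iact-++ (reverse w) (a ∷ []) v))))
    (rf-invol a _))) (iact-cancel w v)

  -- Swapping `x` and `y` with the parity of `j` keeps track of which letter of an alternating word
  -- comes next.
  pairV : ℕ → Fin n → Fin n → Mo → Mo → V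
  pairV zero    x y a b = α y a +ᵥ α x b
  pairV (suc j) x y a b = pairV j y x a b

  pairV-double : ∀ k x y a b → pairV (k ℕ.+ k) x y a b ≡ (α y a +ᵥ α x b)
  pairV-double zero    x y a b = refl
  pairV-double (suc k) x y a b rewrite ℕₚ.+-suc k k = pairV-double k x y a b

  pairV-cong : ∀ j x y {a a' b b'} → a ≐ a' → b ≐ b' → pairV j x y a b ≋ pairV j x y a' b'
  pairV-cong zero    x y e f = +ᵥ-cong (α-cong y e) (α-cong x f)
  pairV-cong (suc j) x y e f = pairV-cong j y x e f

  rf-pair : ∀ {x y} a b → x ≢ y → rf x (α y a +ᵥ α x b) ≋ (α x (κ (m x y) a ⊖ b) +ᵥ α y a)
  rf-pair {x} {y} a b x≢y = ≋-trans (rf-+ x (α y a) (α x b))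
    (≋-trans (+ᵥ-cong (rf-α a x≢y) (≋-trans (rf-α-self x b) (α-⊝ x b)))
      λ r p l → trans (lem (α y a r p) (α x (κ (m x y) a) r p) (α x b r p))
        (cong (_+ α y a r p) (sym (trans (α-⊕ x (κ (m x y) a) (⊝ b) r p l) (cong (_+_ (α x (κ (m x y) a) r p)) (α-⊝ x b r p l))))))
    where
    lem : ∀ a b c → (a + b) - c ≡ (b - c) + a
    lem = solve-∀

  -- Each reflection replaces a coefficient pair (a , b) by (κ a - b , a), which is the recursion
  -- for `S`; so the index of a consecutive pair advances by one per letter.
  iact-altw : ∀ {c} j i x y f → x ≢ y → m x y ≡ c →
    iact (altw x y j) (α y (S c (suc i) f) +ᵥ α x (S c i f)) ≋ pairV j x y (S c (suc (i ℕ.+ j)) f) (S c (i ℕ.+ j) f)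
  iact-altw zero i x y f x≢y refl rewrite ℕₚ.+-identityʳ i = ≋-refl
  iact-altw (suc j) i x y f x≢y refl rewrite ℕₚ.+-suc i j =
    ≋-trans (iact-cong (altw y x j) (rf-pair (S (m x y) (suc i) f) (S (m x y) i f) x≢y))
      (iact-altw j (suc i) y x f (≢-sym x≢y) (m-sym y x))

  iact-altw₁ : ∀ {c} j x y f → x ≢ y → m x y ≡ c →
    iact (altw x y j) (α y f) ≋ pairV j x y (S c (suc j) f) (S c j f)
  iact-altw₁ j x y f x≢y e = ≋-trans
    (iact-cong (altw x y j) λ r p l → sym (trans (cong (_+_ (α y f r p)) (α-𝟘 x {𝟘} ≐-refl r p l)) (ℤₚ.+-identityʳ _)))
    (iact-altw j 0 x y f x≢y e)

  module Dihedral (x y : Fin n) (x≢y : x ≢ y) (k : ℕ) (e : m x y ≡ just (suc k)) where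
    private
      c = just (suc k)
      -- With m = suc k this is 2m - 1, one less than the length of (xy)^m.
      2k = k ℕ.+ suc k
      w∣N : width c ∣ N
      w∣N = subst (λ z → width z ∣ N) e (width∣N x y)
      Sk : ∀ f → S c (suc k) f ≐ 𝟘
      Sk = S-zero w∣N refl (m-off x y x≢y (suc k) e)
      S-2k : ∀ f → S c (suc 2k) f ≐ 𝟘
      S-2k f = S-reflect w∣N (suc k) f (Sk f) (suc k) 0 refl
      S-2k-1 : ∀ f → S c 2k f ≐ ⊝ f
      S-2k-1 f = subst (λ z → S c z f ≐ ⊝ f) (sym (ℕₚ.+-suc k k)) (S-reflect w∣N (suc k) f (Sk f) k 1 refl)
      S-2k+1 : ∀ f → S c (suc (suc 2k)) f ≐ f
      S-2k+1 f p l = trans (cong₂ _-_ (trans (κ-cong c w∣N (S-2k f) p l) (subst (λ z → κ z 𝟘 ≐ 𝟘) e (κ-𝟘 x y {𝟘} ≐-refl) p l)) (S-2k-1 f p l)) (lem (f p))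
        where
        lem : ∀ a → 0ℤ - (- a) ≡ a
        lem = solve-∀

    g g' : V → V
    g  v = iact (alt x y (suc k)) v
    g' v = iact (alt y x (suc k)) v

    g-αy : ∀ f → g (α y f) ≋ α y f
    g-αy f = ≋-trans (≡⇒≋ (cong (λ w → iact w (α y f)) (sym (altw-alt x y (suc k)))))
      (≋-trans (iact-altw₁ (suc 2k) x y f x≢y e)
       (≋-trans (pairV-cong (suc 2k) x y (S-2k+1 f) (S-2k f))
        (≋-trans (≡⇒≋ (pairV-double (suc k) x y f 𝟘))
          λ r p l → trans (cong (_+_ (α y f r p)) (α-𝟘 x {𝟘} ≐-refl r p l)) (ℤₚ.+-identityʳ _))))

    g-αx : ∀ f → g (α x f) ≋ α x f
    g-αx f = ≋-trans (≡⇒≋ (cong (λ w → iact w (α x f)) (sym (altw-alt x y (suc k)))))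
      (≋-trans (iact-cong (altw y x 2k) (rf-α-self x f))
       (≋-trans (iact-altw₁ 2k y x (⊝ f) (≢-sym x≢y) (trans (m-sym y x) e))
        (≋-trans (pairV-cong 2k y x (S-2k (⊝ f)) (≐-trans (S-2k-1 (⊝ f)) λ p l → ℤₚ.neg-involutive (f p)))
         (≋-trans (≡⇒≋ (pairV-double (suc k) x y 𝟘 f))
          λ r p l → trans (cong (_+ α x f r p) (α-𝟘 y {𝟘} ≐-refl r p l)) (ℤₚ.+-identityˡ _)))))

    conj-x : ∀ v → rf x (g (rf x v)) ≋ g' v
    conj-x v = ≋-trans (≡⇒≋ (sym (trans (cong (λ w → iact w (rf x v)) (sym (alt-shift x y (suc k))))
        (iact-++ (alt x y (suc k)) (x ∷ []) (rf x v)))))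
      (iact-cong (alt y x (suc k)) (rf-invol x v))

    conj-y : ∀ v → rf y (g (rf y v)) ≋ g' v
    conj-y v = ≋-trans (rf-cong y (≡⇒≋ (trans (cong (λ w → iact w v) (sym (alt-shift y x (suc k)))) (iact-++ (alt y x (suc k)) (y ∷ []) v))))
      (rf-invol y _)

    g∘g' : ∀ v → g (g' v) ≋ v
    g∘g' v = ≋-trans (≡⇒≋ (cong (λ w → g (iact w v)) (sym (reverse-alt x y (suc k))))) (iact-cancel (alt x y (suc k)) v)

    module _ (v : V) where
      -- `g` is already known to fix the span of the two simple roots. For arbitrary `v` the
      -- displacement lies in that span, so it remains to kill a vector there.
      u : V
      u = g v +ᵥ (-ᵥ v)

      u-other : ∀ {q} → q ≢ x → q ≢ y → ∀ p → u q p ≡ 0ℤ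
      u-other {q} q≢x q≢y p = trans (cong (_- v q p) (iact-other (alt x y (suc k)) v (q∉ (suc k)) p)) (ℤₚ.+-inverseʳ (v q p))
        where
        q∉ : ∀ k → q ∉ alt x y k
        q∉ (suc k) (here h) = q≢x h
        q∉ (suc k) (there (here h)) = q≢y h
        q∉ (suc k) (there (there h)) = q∉ k h

      span : ∀ z → (∀ {q} → q ≢ x → q ≢ y → z q ≐ 𝟘) → g z ≋ z
      span z h = ≋-trans (iact-cong (alt x y (suc k)) split)
        (≋-trans (iact-+ (alt x y (suc k)) (α x (z x)) (α y (z y)))
          (≋-trans (+ᵥ-cong (g-αx (z x)) (g-αy (z y))) (≋-sym split)))
        where
        split : z ≋ (α x (z x) +ᵥ α y (z y))
        split q p l with q ≟ x
        ... | yes refl = sym (trans (cong₂ _+_ (α-same x (z x) p) (α-other (z y) p (≢-sym x≢y))) (ℤₚ.+-identityʳ _))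
        ... | no q≢x with q ≟ y
        ...   | yes refl = sym (trans (cong₂ _+_ (α-other (z x) p x≢y) (α-same y (z y) p)) (ℤₚ.+-identityˡ _))
        ...   | no q≢y = trans (h q≢x q≢y p l) (sym (cong₂ _+_ (α-other (z x) p (≢-sym q≢x)) (α-other (z y) p (≢-sym q≢y))))

      -- g′ = zgz = g⁻¹ for z ∈ {x , y}, which forces u to be anti-invariant under z.
      anti : ∀ z → z ≡ x ⊎ z ≡ y → (∀ v → rf z (g (rf z v)) ≋ g' v) → (∀ f → g (α z f) ≋ α z f) →
             (u +ᵥ rf z u) ≋ 0ᵥ
      anti z z∈ conj g-α r p l = cancel (v r p) (u r p + rf z u r p)
        (trans (sym (g∘g' v r p l)) (trans (iact-cong (alt x y (suc k)) g'v r p l)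
          (trans (iact-+ (alt x y (suc k)) v (rf z u) r p l)
            (trans (cong₂ _+_ (gv r p) (span (rf z u) rfu r p l)) (ℤₚ.+-assoc (v r p) (u r p) (rf z u r p))))))
        where
        cancel : ∀ a b → a ≡ a + b → b ≡ 0ℤ
        cancel a b e = trans (lem a b) (trans (cong (_- a) (sym e)) (ℤₚ.+-inverseʳ a))
          where
          lem : ∀ a b → b ≡ (a + b) - a
          lem = solve-∀
        gv : ∀ r p → g v r p ≡ v r p + u r p
        gv r p = lem (g v r p) (v r p)
          where
          lem : ∀ a b → a ≡ b + (a - b)
          lem = solve-∀
        d : Mo
        d = rf z v z ⊖ v z
        g-rf : g (rf z v) ≋ (rf z v +ᵥ u)
        g-rf = ≋-trans (iact-cong (alt x y (suc k)) (rf-shift z v))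
          (≋-trans (iact-+ (alt x y (suc k)) v (α z d))
            λ r p l → trans (cong₂ _+_ (gv r p) (g-α d r p l))
              (trans (lem (v r p) (u r p) (α z d r p)) (cong (_+ u r p) (sym (rf-shift z v r p l)))))
          where
          lem : ∀ a b c → (a + b) + c ≡ (a + c) + b
          lem = solve-∀
        g'v : g' v ≋ (v +ᵥ rf z u)
        g'v = ≋-trans (≋-sym (conj v)) (≋-trans (rf-cong z g-rf)
          (≋-trans (rf-+ z (rf z v) u) (+ᵥ-cong (rf-invol z v) ≋-refl)))
        rfu : ∀ {q} → q ≢ x → q ≢ y → rf z u q ≐ 𝟘
        rfu {q} q≢x q≢y p l = trans (rf-other u p (z≢ z∈)) (u-other q≢x q≢y p)
          where
          z≢ : z ≡ x ⊎ z ≡ y → z ≢ q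
          z≢ (inj₁ refl) refl = q≢x refl
          z≢ (inj₂ refl) refl = q≢y refl

      private
        half : ∀ {a} → a + a ≡ 0ℤ → a ≡ 0ℤ
        half {+ zero} _ = refl

      -- The reflection in y leaves the coordinate at x alone, so anti-invariance under y reads 2 u
      -- x = 0 there; likewise with x and y exchanged.
      u≋0 : u ≋ 0ᵥ
      u≋0 q p l with q ≟ x
      ... | yes refl = half (trans (cong (_+_ (u x p)) (sym (rf-other u p (≢-sym x≢y)))) (anti y (inj₂ refl) conj-y g-αy x p l))
      ... | no q≢x with q ≟ y
      ...   | yes refl = half (trans (cong (_+_ (u y p)) (sym (rf-other u p x≢y))) (anti x (inj₁ refl) conj-x g-αx y p l))
      ...   | no q≢y = u-other q≢x q≢y p

    g-id : ∀ v → g v ≋ v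
    g-id v r p l = trans (lem (g v r p) (v r p)) (trans (cong (_+_ (v r p)) (u≋0 v r p l)) (ℤₚ.+-identityʳ _))
      where
      lem : ∀ a b → a ≡ b + (a - b)
      lem = solve-∀

  iact-rel : ∀ i j k → m i j ≡ just k → ∀ v → iact (alt i j k) v ≋ v
  iact-rel i j k e v with i ≟ j
  iact-rel i .i k e v | yes refl with just-injective (trans (sym (m-diag i)) e)
  ... | refl = rf-invol i v
  iact-rel i j zero e v | no h = ≋-refl
  iact-rel i j (suc k) e v | no h = Dihedral.g-id i j h k e v

  iact-~ : ∀ {x y} → x ~ y → ∀ v → iact x v ≋ iact y v
  iact-~ (rel i j k e) v = iact-rel i j k e v
  iact-~ ~refl v = ≋-refl
  iact-~ (~sym h) v = ≋-sym (iact-~ h v)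
  iact-~ (~trans h k) v = ≋-trans (iact-~ h v) (iact-~ k v)
  iact-~ (~cong a b {x} {y} h) v = ≋-trans (≡⇒≋ (expand x))
    (≋-trans (iact-cong b (iact-~ h (iact a v))) (≡⇒≋ (sym (expand y))))
    where
    expand : ∀ x → iact (a ++ x ++ b) v ≡ iact b (iact x (iact a v))
    expand x = trans (iact-++ a (x ++ b) v) (iact-++ x b (iact a v))

-- Signs of roots, reduced words and the exchange property.

length-altw : ∀ {n} (x y : Fin n) j → length (altw x y j) ≡ j
length-altw x y zero    = refl
length-altw x y (suc j) = cong suc (length-altw y x j)

nxt : ∀ {n} → Fin n → Fin n → ℕ → Fin n
nxt x y zero    = x
nxt x y (suc j) = nxt y x j

altw-snoc : ∀ {n} (x y : Fin n) j → altw x y (suc j) ≡ altw x y j ++ nxt x y j ∷ []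
altw-snoc x y zero    = refl
altw-snoc x y (suc j) = cong (x ∷_) (altw-snoc y x j)

nxt-pair : ∀ {n} (P : Fin n → Set) x y j → P (nxt x y j) → P (nxt x y (suc j)) → P x × P y
nxt-pair P x y zero    p q = p , q
nxt-pair P x y (suc j) p q = proj₂ (nxt-pair P y x j p q) , proj₁ (nxt-pair P y x j p q)

module Signs {n : ℕ} (M : CoxeterMatrix n) where
  open Geometry M public

  ≡⇒~ : ∀ {x y} → x ≡ y → x ~ y
  ≡⇒~ refl = ~refl

  ~ˡ : ∀ a {x y} → x ~ y → a ++ x ~ a ++ y
  ~ˡ a {x} {y} h = subst₂ _~_ (cong (a ++_) (++-identityʳ x)) (cong (a ++_) (++-identityʳ y)) (~cong a [] h)

  ~ʳ : ∀ b {x y} → x ~ y → x ++ b ~ y ++ b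
  ~ʳ b h = ~cong [] b h

  ~∷ : ∀ a {x y} → x ~ y → a ∷ x ~ a ∷ y
  ~∷ a = ~ˡ (a ∷ [])

  ~sq : ∀ s w → s ∷ s ∷ w ~ w
  ~sq s w = ~ʳ w (rel s s 1 (m-diag s))

  ~∷-move : ∀ {s x y} → s ∷ x ~ y → x ~ s ∷ y
  ~∷-move {s} {x} h = ~trans (~sym (~sq s x)) (~∷ s h)

  ~invʳ : ∀ w → w ++ reverse w ~ []
  ~invʳ [] = ~refl
  ~invʳ (a ∷ w) = ~trans (≡⇒~ (trans (cong (λ z → a ∷ w ++ z) (unfold-reverse a w)) (cong (a ∷_) (sym (++-assoc w (reverse w) (a ∷ []))))))
    (~trans (~cong (a ∷ []) (a ∷ []) (~invʳ w)) (~sq a []))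

  ~invˡ : ∀ w → reverse w ++ w ~ []
  ~invˡ w = subst (λ z → reverse w ++ z ~ []) (reverse-involutive w) (~invʳ (reverse w))

  ~cancelˡ : ∀ u {x y} → u ++ x ~ u ++ y → x ~ y
  ~cancelˡ u {x} {y} h = ~trans (~sym (strip x)) (~trans (~ˡ (reverse u) h) (strip y))
    where
    strip : ∀ x → reverse u ++ u ++ x ~ x
    strip x = ~trans (≡⇒~ (sym (++-assoc (reverse u) u x))) (~ʳ x (~invˡ u))

  iact-cancel′ : ∀ w v → iact (reverse w) (iact w v) ≋ v
  iact-cancel′ w v = subst (λ z → iact (reverse w) (iact z v) ≋ v) (reverse-involutive w) (iact-cancel (reverse w) v)

  -- The sign of the root w⁻¹αₛ; f ranges over the nonnegative multiples of αₛ by scalars in Mo.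
  record PosI (w : Word n) (s : Fin n) : Set where
    constructor mkPos
    field pos : ∀ f → 0≤ f → Nonneg (iact w (α s f))
  open PosI public

  record NegI (w : Word n) (s : Fin n) : Set where
    constructor mkNeg
    field neg : ∀ f → 0≤ f → Nonneg (-ᵥ iact w (α s f))
  open NegI public

  α𝟙≢0 : ∀ s → ¬ α s 𝟙 ≋ 0ᵥ
  α𝟙≢0 s e with trans (sym (α-same s 𝟙 0)) (e s 0 N-pos)
  ... | ()

  iact-α𝟙≢0 : ∀ w s → ¬ iact w (α s 𝟙) ≋ 0ᵥ
  iact-α𝟙≢0 w s e = α𝟙≢0 s (≋-trans (≋-sym (iact-cancel′ w (α s 𝟙))) (iact-0 (reverse w) e))

  Pos∧Neg : ∀ w s → PosI w s → NegI w s → ⊥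
  Pos∧Neg w s p q = iact-α𝟙≢0 w s (Nonneg-antisym (pos p 𝟙 0≤𝟙) (neg q 𝟙 0≤𝟙))

  PosI-~ : ∀ {w w' s} → w ~ w' → PosI w s → PosI w' s
  PosI-~ {s = s} h p = mkPos λ f k → Nonneg-resp (iact-~ h (α s f)) (pos p f k)

  NegI-~ : ∀ {w w' s} → w ~ w' → NegI w s → NegI w' s
  NegI-~ {s = s} h p = mkNeg λ f k → Nonneg-resp (λ r q l → cong -_ (iact-~ h (α s f) r q l)) (neg p f k)

  iact-∷-self : ∀ w s f → iact (s ∷ w) (α s f) ≋ (-ᵥ iact w (α s f))
  iact-∷-self w s f = ≋-trans (iact-cong w (≋-trans (rf-α-self s f) (α-⊝ s f))) (iact-neg w (α s f))

  -ᵥ-invol : ∀ v → (-ᵥ (-ᵥ v)) ≋ v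
  -ᵥ-invol v r p l = ℤₚ.neg-involutive (v r p)

  Pos⇒Neg∷ : ∀ {w s} → PosI w s → NegI (s ∷ w) s
  Pos⇒Neg∷ {w} {s} p = mkNeg λ f k → Nonneg-resp (≋-sym (≋-trans (λ r q l → cong -_ (iact-∷-self w s f r q l)) (-ᵥ-invol _))) (pos p f k)

  Neg∷⇒Pos : ∀ {w s} → NegI (s ∷ w) s → PosI w s
  Neg∷⇒Pos {w} {s} p = mkPos λ f k → Nonneg-resp (≋-trans (λ r q l → cong -_ (iact-∷-self w s f r q l)) (-ᵥ-invol _)) (neg p f k)

  Neg⇒Pos∷ : ∀ {w s} → NegI w s → PosI (s ∷ w) s
  Neg⇒Pos∷ {w} {s} p = mkPos λ f k → Nonneg-resp (≋-sym (iact-∷-self w s f)) (neg p f k)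

  -- Reducedness in inductive form: each letter lengthens the suffix after it. `PR⇒Reduced` and
  -- `Reduced⇒PR` identify it with minimal length.
  PR : Word n → Set
  PR []      = ⊤
  PR (a ∷ w) = PosI w a × PR w

  PR-suffix : ∀ u {w} → PR (u ++ w) → PR w
  PR-suffix []      p = p
  PR-suffix (a ∷ u) p = PR-suffix u (proj₂ p)

  PR-~ : ∀ u {w w'} → w ~ w' → PR w' → PR (u ++ w) → PR (u ++ w')
  PR-~ []      h q p = q
  PR-~ (a ∷ u) h q p = PosI-~ (~ˡ u h) (proj₁ p) , PR-~ u h q (proj₂ p)

  pairV-0≤ : ∀ v j {x y a b} → PosI v x → PosI v y → 0≤ a → 0≤ b → Nonneg (iact v (pairV j x y a b))
  pairV-0≤ v zero {x} {y} {a} {b} px py ha hb = Nonneg-resp (≋-sym (iact-+ v (α y a) (α x b))) (Nonneg-+ (pos py a ha) (pos px b hb))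
  pairV-0≤ v (suc j) px py ha hb = pairV-0≤ v j py px ha hb

  -- The presentation gives (xy)^k ~ 1 only. Moving k letters, each its own inverse, to the other
  -- side one at a time yields the braid relation; the alternatives in `iter` record the parity.
  altw-braid : ∀ {x y k} → m x y ≡ just k → altw x y k ~ altw y x k
  altw-braid {x} {y} {k} e with iter k k 0 x y (~trans (≡⇒~ (altw-alt x y k)) (rel x y k e))
    where
    iter : ∀ t i j p q → altw p q (t ℕ.+ i) ~ altw q p j →
           (altw p q i ~ altw q p (t ℕ.+ j)) ⊎ (altw q p i ~ altw p q (t ℕ.+ j))
    iter zero    i j p q h = inj₁ h
    iter (suc t) i j p q h = subst (λ z → (altw p q i ~ altw q p z) ⊎ (altw q p i ~ altw p q z)) (ℕₚ.+-suc t j)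
      (swap (iter t i (suc j) q p (~∷-move h)))
  ... | inj₁ h = subst (λ z → altw x y k ~ altw y x z) (ℕₚ.+-identityʳ k) h
  ... | inj₂ h = ~sym (subst (λ z → altw y x k ~ altw x y z) (ℕₚ.+-identityʳ k) h)

  module Alternating {x y : Fin n} (x≢y : x ≢ y) {v : Word n} (px : PosI v x) (py : PosI v y) where

    altw-Pos : ∀ j → (∀ i → i ℕ.≤ suc j → ∀ {f} → 0≤ f → 0≤ S (m x y) i f) → PosI (altw x y j ++ v) y
    altw-Pos j h = mkPos λ f k → Nonneg-resp (≋-sym (≋-trans (≡⇒≋ (iact-++ (altw x y j) v (α y f)))
        (iact-cong v (iact-altw₁ j x y f x≢y refl))))
      (pairV-0≤ v j px py (h (suc j) ℕₚ.≤-refl k) (h j (ℕₚ.n≤1+n j) k))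

  altw-Pos< : ∀ {x y k v} → x ≢ y → m x y ≡ just k → PosI v x → PosI v y → ∀ j → j ℕ.< k → PosI (altw x y j ++ v) y
  altw-Pos< {x} {y} {k} x≢y e px py j l = Alternating.altw-Pos x≢y px py j
    λ i i≤ h → S-0≤ (width∣N x y) e (m-off x y x≢y k e) h i (ℕₚ.≤-trans i≤ l)

  altw-PR : ∀ {x y k v} → x ≢ y → m x y ≡ just k → PosI v x → PosI v y → PR v → ∀ j → j ℕ.≤ k → PR (altw x y j ++ v)
  altw-PR x≢y e px py pv zero l = pv
  altw-PR {x} {y} x≢y e px py pv (suc j) l =
    altw-Pos< (≢-sym x≢y) (trans (m-sym y x) e) py px j l , altw-PR (≢-sym x≢y) (trans (m-sym y x) e) py px pv j (ℕₚ.<⇒≤ l)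

  -- The negative case carries a factorisation starting with s, which is the exchange property and
  -- lets the recursion continue on a shorter reduced word.
  Res : Word n → Fin n → Set
  Res w s = PosI w s ⊎ (NegI w s × Σ (Word n) λ w' → PR w' × suc (length w') ≡ length w × w ~ s ∷ w')

  -- The rank-two argument: split off the longest prefix of w alternating in r and s.
  module RankTwo (L : ℕ) (IH : ∀ w → length w ℕ.≤ L → PR w → ∀ s → Res w s)
           (r s : Fin n) (r≢s : r ≢ s) (w : Word n) where

    Split : Set
    Split = Σ ℕ λ j → Σ (Word n) λ v → w ~ altw r s (suc j) ++ v × PR (altw r s (suc j) ++ v)
      × suc j ℕ.+ length v ≡ length w × PosI v r × PosI v s

    split : ∀ ℓ j v → length v ℕ.≤ ℓ → length v ℕ.≤ L → w ~ altw r s (suc j) ++ v → PR (altw r s (suc j) ++ v) →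
            suc j ℕ.+ length v ≡ length w → Split
    split ℓ j v v≤ℓ v≤L w~ pr len with IH v v≤L (PR-suffix (altw r s (suc j)) pr) (nxt r s (suc j))
    ... | inj₁ ps = j , v , w~ , pr , len , nxt-pair (PosI v) r s j
            (proj₁ (PR-suffix (altw r s j) (subst PR (trans (cong (_++ v) (altw-snoc r s j)) (++-assoc (altw r s j) (nxt r s j ∷ []) v)) pr))) ps
    split zero j [] v≤ℓ v≤L w~ pr len | inj₂ (_ , v' , pv' , () , v~)
    split (suc ℓ) j v v≤ℓ v≤L w~ pr len | inj₂ (ng , v' , pv' , lv , v~) =
      split ℓ (suc j) v' (ℕₚ.≤-pred (subst (ℕ._≤ suc ℓ) (sym lv) v≤ℓ))
        (ℕₚ.≤-trans (ℕₚ.n≤1+n (length v')) (subst (ℕ._≤ L) (sym lv) v≤L))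
        (~trans w~ (~trans (~ˡ (altw r s (suc j)) v~) (≡⇒~ (sym eq))))
        (subst PR (sym eq) (PR-~ (altw r s (suc j)) v~ (Neg∷⇒Pos (NegI-~ v~ ng) , pv') pr))
        (trans (sym (ℕₚ.+-suc (suc j) (length v'))) (trans (cong (suc j ℕ.+_) lv) len))
      where
      eq : altw r s (suc (suc j)) ++ v' ≡ altw r s (suc j) ++ nxt r s (suc j) ∷ v'
      eq = trans (cong (_++ v') (altw-snoc r s (suc j))) (++-assoc (altw r s (suc j)) (nxt r s (suc j) ∷ []) v')

    tooLong : ∀ {v} k x y → x ≢ y → m x y ≡ just (suc k) → PosI v x → PosI v y → PR (altw x y (suc (suc k)) ++ v) → ⊥
    tooLong {v} k x y x≢y e px py pr = Pos∧Neg _ x (proj₁ pr)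
      (NegI-~ (~ʳ v (altw-braid e)) (Pos⇒Neg∷ (altw-Pos< (≢-sym x≢y) (trans (m-sym y x) e) py px k ℕₚ.≤-refl)))

    drop : ∀ {v} i l x y → PR (altw x y (i ℕ.+ l) ++ v) → PR (altw x y l ++ v) ⊎ PR (altw y x l ++ v)
    drop zero    l x y p = inj₁ p
    drop (suc i) l x y p = swap (drop i l y x (proj₂ p))

    -- The alternating prefix has `suc j` letters and m r s = suc k. If it is shorter than m,
    -- Chebyshev positivity applies; if it has length m, the braid relation brings s to the front.
    finish : ∀ c → m r s ≡ c → Split → Res w s
    finish nothing e (j , v , w~ , pr , len , pvr , pvs) = inj₁ (PosI-~ (~sym w~)
      (Alternating.altw-Pos r≢s pvr pvs (suc j) λ i _ h → S-0≤-∞ e h i))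
    finish (just zero) e _ with m-off r s r≢s 0 e
    ... | ()
    finish (just (suc k)) e (j , v , w~ , pr , len , pvr , pvs) with ℕₚ.<-cmp j k
    ... | tri< j<k _ _ = inj₁ (PosI-~ (~sym w~) (altw-Pos< r≢s e pvr pvs (suc j) (s≤s j<k)))
    ... | tri≈ _ refl _ = inj₂ (NegI-~ (~sym w~s) (Pos⇒Neg∷ ps) , w' ,
            altw-PR r≢s e pvr pvs (PR-suffix (altw r s (suc j)) pr) j (ℕₚ.n≤1+n j) ,
            trans (cong suc (trans (length-++ (altw r s j)) (cong (ℕ._+ length v) (length-altw r s j)))) len , w~s)
      where
      w' = altw r s j ++ v
      w~s : w ~ s ∷ w'
      w~s = ~trans w~ (~ʳ v (altw-braid e))
      ps : PosI w' s
      ps = altw-Pos< r≢s e pvr pvs j ℕₚ.≤-refl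
    -- A longer alternating prefix contains an alternating word with m + 1 letters, which is not
    -- reduced.
    ... | tri> _ _ k<j with drop (j ℕ.∸ suc k) (suc (suc k)) r s
                              (subst (λ z → PR (altw r s z ++ v)) (sym (trans (ℕₚ.+-suc (j ℕ.∸ suc k) (suc k)) (cong suc (ℕₚ.m∸n+n≡m k<j)))) pr)
    ...   | inj₁ p = ⊥-elim (tooLong k r s r≢s e pvr pvs p)
    ...   | inj₂ p = ⊥-elim (tooLong k s r (≢-sym r≢s) (trans (m-sym s r) e) pvs pvr p)

  classify≤ : ∀ L w → length w ℕ.≤ L → PR w → ∀ s → Res w s
  classify≤ L [] h p s = inj₁ (mkPos λ f k → Nonneg-α s k)
  classify≤ (suc L) (r ∷ w) (s≤s h) p s with r ≟ s
  ... | yes refl = inj₂ (Pos⇒Neg∷ (proj₁ p) , w , proj₂ p , refl , ~refl)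
  ... | no r≢s = finish (m r s) refl (split L 0 w h h ~refl p refl)
    where open RankTwo L (classify≤ L) r s r≢s (r ∷ w)

  classify : ∀ w → PR w → ∀ s → Res w s
  classify w = classify≤ (length w) w ℕₚ.≤-refl

  reduce : ∀ w → Σ (Word n) λ w' → PR w' × w' ~ w × length w' ℕ.≤ length w
  reduce [] = [] , tt , ~refl , z≤n
  reduce (a ∷ w) with reduce w
  ... | w' , pr , e , l with classify w' pr a
  ...   | inj₁ ps = a ∷ w' , (ps , pr) , ~∷ a e , s≤s l
  ...   | inj₂ (_ , w'' , pr'' , l'' , e'') = w'' , pr'' , ~sym (~trans (~∷ a (~trans (~sym e) e'')) (~sq a w'')) ,
            ℕₚ.≤-trans (ℕₚ.n≤1+n _) (ℕₚ.≤-trans (ℕₚ.≤-reflexive l'') (ℕₚ.≤-trans l (ℕₚ.n≤1+n _)))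

  sign : ∀ w s → PosI w s ⊎ NegI w s
  sign w s with reduce w
  ... | w' , pr , e , _ with classify w' pr s
  ...   | inj₁ ps = inj₁ (PosI-~ e ps)
  ...   | inj₂ (ng , _) = inj₂ (NegI-~ e ng)

  ¬Neg⇒Pos : ∀ {w s} → ¬ NegI w s → PosI w s
  ¬Neg⇒Pos {w} {s} h with sign w s
  ... | inj₁ p = p
  ... | inj₂ q = ⊥-elim (h q)

  ¬Pos⇒Neg : ∀ {w s} → ¬ PosI w s → NegI w s
  ¬Pos⇒Neg {w} {s} h with sign w s
  ... | inj₁ p = ⊥-elim (h p)
  ... | inj₂ q = q

  PR-length : ∀ w w' → PR w → PR w' → w ~ w' → length w ≡ length w'
  PR-length [] [] _ _ _ = refl
  PR-length [] (a ∷ w') _ p h = ⊥-elim (Pos∧Neg [] a (mkPos λ f k → Nonneg-α a k) (NegI-~ (~sym h) (Pos⇒Neg∷ (proj₁ p))))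
  PR-length (a ∷ w) w' (pa , pw) p h with classify w' p a
  ... | inj₁ ps = ⊥-elim (Pos∧Neg w' a ps (NegI-~ h (Pos⇒Neg∷ pa)))
  ... | inj₂ (_ , w'' , pr'' , l'' , e'') = trans (cong suc (PR-length w w'' pw pr''
          (~cancelˡ (a ∷ []) (~trans h e'')))) l''

  PR⇒Reduced : ∀ {w} → PR w → Reduced w
  PR⇒Reduced {w} p v e with reduce v
  ... | v' , pv' , e' , l = subst (ℕ._≤ length v) (PR-length v' w pv' p (~trans e' e)) l

  Reduced-suffix : ∀ u {w} → Reduced (u ++ w) → Reduced w
  Reduced-suffix u {w} h v e = ℕₚ.+-cancelˡ-≤ (length u) _ _
    (subst₂ ℕ._≤_ (length-++ u) (length-++ u) (h (u ++ v) (~ˡ u e)))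

  Reduced-prefix : ∀ u {w} → Reduced (u ++ w) → Reduced u
  Reduced-prefix u {w} h v e = ℕₚ.+-cancelʳ-≤ (length w) _ _
    (subst₂ ℕ._≤_ (length-++ u) (length-++ v) (h (v ++ w) (~ʳ w e)))

  Reduced⇒PR : ∀ {w} → Reduced w → PR w
  Reduced⇒PR {[]} _ = tt
  Reduced⇒PR {a ∷ w} h with Reduced⇒PR (Reduced-suffix (a ∷ []) h)
  ... | pw with classify w pw a
  ...   | inj₁ ps = ps , pw
  ...   | inj₂ (_ , w' , _ , l , e) = ⊥-elim (ℕₚ.<-irrefl refl (ℕₚ.<-≤-trans
            (s≤s (ℕₚ.≤-trans (ℕₚ.n≤1+n _) (ℕₚ.≤-reflexive l)))
            (h w' (~sym (~trans (~∷ a e) (~sq a w'))))))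

  reverse-~ : ∀ {x y} → x ~ y → reverse x ~ reverse y
  reverse-~ {x} {y} h = ~cancelˡ y (~trans (~ʳ (reverse x) (~sym h)) (~trans (~invʳ x) (~sym (~invʳ y))))

-- Roots, inversion sets and the weak order.

module Roots {n : ℕ} (M : CoxeterMatrix n) where
  open Signs M public

  iact-∷ʳ : ∀ h a v → iact (h ∷ʳ a) v ≡ rf a (iact h v)
  iact-∷ʳ h a v = iact-++ h (a ∷ []) v

  iact-⊖ : ∀ w s f g → iact w (α s (f ⊖ g)) ≋ (iact w (α s f) +ᵥ (-ᵥ iact w (α s g)))
  iact-⊖ w s f g = ≋-trans (iact-cong w (≋-trans (α-⊕ s f (⊝ g)) (+ᵥ-cong (≋-refl {α s f}) (α-⊝ s g))))
    (≋-trans (iact-+ w (α s f) (-ᵥ α s g)) (+ᵥ-cong (≋-refl {iact w (α s f)}) (iact-neg w (α s g))))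

  infixl 7 _··_
  _··_ : ℕ → Mo → Mo
  (C ·· f) p = + C * f p

  private
    ··-suc : ∀ C f p → (suc C ·· f) p ≡ f p + (C ·· f) p
    ··-suc C f p = lem (+ C) (f p)
      where
      lem : ∀ c x → (1ℤ + c) * x ≡ x + c * x
      lem = solve-∀

  iact-·· : ∀ w s C f → iact w (α s (C ·· f)) ≋ (λ r → C ·· iact w (α s f) r)
  iact-·· w s zero    f = ≋-trans (iact-0 w (α-𝟘 s {0 ·· f} λ p _ → ℤₚ.*-zeroˡ (f p)))
    λ r p l → sym (ℤₚ.*-zeroˡ (iact w (α s f) r p))
  iact-·· w s (suc C) f = ≋-trans (iact-cong w (≋-trans (α-cong s {suc C ·· f} {f ⊕ (C ·· f)} λ p _ → ··-suc C f p) (α-⊕ s f (C ·· f))))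
    (≋-trans (iact-+ w (α s f) (α s (C ·· f)))
      λ r p l → trans (cong (_+_ (iact w (α s f) r p)) (iact-·· w s C f r p l)) (sym (··-suc C (iact w (α s f) r) p)))

  bound : ∀ K (f : Mo) → Σ ℕ λ C → ∀ p → p ℕ.< K → f p ≤ + C
  bound zero    f = 0 , λ p ()
  bound (suc K) f with bound K f
  ... | C , h = C ℕ.+ ∣ f K ∣ , λ p l → go p l (p ℕ.≟ K)
    where
    i≤∣i∣ : ∀ i → i ≤ + ∣ i ∣
    i≤∣i∣ (+ i)    = ℤₚ.≤-refl
    i≤∣i∣ -[1+ i ] = -≤+
    go : ∀ p → p ℕ.< suc K → Dec (p ≡ K) → f p ≤ + (C ℕ.+ ∣ f K ∣)
    go p l (yes refl) = ℤₚ.≤-trans (i≤∣i∣ (f p)) (+≤+ (ℕₚ.m≤n+m ∣ f K ∣ C))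
    go p l (no h') = ℤₚ.≤-trans (h p (ℕₚ.≤∧≢⇒< (ℕₚ.≤-pred l) h')) (+≤+ (ℕₚ.m≤m+n C ∣ f K ∣))

  -- `sign` is uniform in f and the vector at `𝟙` is nonzero, so this single test decides.
  sign-𝟙 : ∀ {w s} → Nonneg (iact w (α s 𝟙)) → PosI w s
  sign-𝟙 {w} {s} h = ¬Neg⇒Pos λ ng → iact-α𝟙≢0 w s (Nonneg-antisym h (neg ng 𝟙 0≤𝟙))

  sign-𝟙⁻ : ∀ {w s} → Nonneg (-ᵥ iact w (α s 𝟙)) → NegI w s
  sign-𝟙⁻ {w} {s} h = ¬Pos⇒Neg λ ps → iact-α𝟙≢0 w s (Nonneg-antisym (pos ps 𝟙 0≤𝟙) h)

  0≰-1 : ∀ {x} → x ≡ 1ℤ → ¬ 0ℤ ≤ - x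
  0≰-1 refl ()

  concentrated : ∀ {v} a → (∀ r → a ≢ r → v r ≐ 𝟘) → v ≋ α a (v a)
  concentrated {v} a h = upd-elim a _ (λ p l → sym (α-same a (v a) p)) λ r k p l → trans (h r k p l) (sym (α-other (v a) p k))

  -- A positive root made negative by a simple reflection is the corresponding simple root,
  -- up to a permutation of the coordinates of each block.
  module Simple {h : Word n} {q a : Fin n} (ps : PosI h q) (ng : NegI (h ∷ʳ a) q) where

    at⁺ : ∀ f → 0≤ f → ∀ r → a ≢ r → iact h (α q f) r ≐ 𝟘
    at⁺ f k r a≢r = 0≤-antisym (pos ps f k r) λ p l → subst (λ z → 0ℤ ≤ - z)
      (trans (cong (λ v → v r p) (iact-∷ʳ h a (α q f))) (rf-other (iact h (α q f)) p a≢r)) (neg ng f k r p l)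

    private
      _⁺ _⁻ : Mo → Mo
      (f ⁺) p = 0ℤ ⊔ f p
      (f ⁻) p = 0ℤ ⊔ (- f p)
      parts : ∀ z → z ≡ (0ℤ ⊔ z) - (0ℤ ⊔ (- z))
      parts (+ zero)  = refl
      parts (+ suc z) = sym (ℤₚ.+-identityʳ (+ suc z))
      parts -[1+ z ]  = refl

    -- Only the coordinate at a can change sign under a, so for f ≥ 0 the others are both
    -- nonnegative and nonpositive. Arbitrary f follow by splitting into positive and negative
    -- parts.
    at : ∀ f r → a ≢ r → iact h (α q f) r ≐ 𝟘
    at f r a≢r p l = trans (iact-cong h (α-cong q {f} {(f ⁺) ⊖ (f ⁻)} λ p _ → parts (f p)) r p l)
      (trans (iact-⊖ h q (f ⁺) (f ⁻) r p l)
        (cong₂ _-_ (at⁺ (f ⁺) (λ p _ → ℤₚ.i≤i⊔j 0ℤ (f p)) r a≢r p l)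
          (at⁺ (f ⁻) (λ p _ → ℤₚ.i≤i⊔j 0ℤ (- f p)) r a≢r p l)))

    coef : Mo → Mo
    coef f = iact h (α q f) a

    to : ∀ f → iact h (α q f) ≋ α a (coef f)
    to f = concentrated a (at f)

    from : ∀ f → iact (reverse h) (α a (coef f)) ≋ α q f
    from f = ≋-trans (iact-cong (reverse h) (≋-sym (to f))) (iact-cancel′ h (α q f))

    0≤coef : ∀ {f} → 0≤ f → 0≤ coef f
    0≤coef {f} k = pos ps f k a

    inv-pos : PosI (reverse h) a
    inv-pos = ¬Neg⇒Pos λ ng' → 0≰-1 (trans (from 𝟙 q 0 N-pos) (α-same q 𝟙 0)) (neg ng' (coef 𝟙) (0≤coef 0≤𝟙) q 0 N-pos)

    inv-neg : NegI (reverse h ∷ʳ q) a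
    inv-neg = ¬Pos⇒Neg λ ps' → 0≰-1 {1ℤ} refl
      (subst (0ℤ ≤_) (trans (trans (cong (λ v → v q 0) (iact-∷ʳ (reverse h) q (α a (coef 𝟙))))
         (trans (rf-cong q (from 𝟙) q 0 N-pos) (rf-α-self q 𝟙 q 0 N-pos))) (α-same q (⊝ 𝟙) 0))
        (pos ps' (coef 𝟙) (0≤coef 0≤𝟙) q 0 N-pos))

  module Conjugate {h : Word n} {q a : Fin n} (ps : PosI h q) (ng : NegI (h ∷ʳ a) q) where
    open Simple ps ng
    private
      module Inverse = Simple inv-pos inv-neg
      T G : Word n
      T = h ++ a ∷ reverse h
      G = q ∷ T

      iact-T : ∀ v → iact T v ≡ iact (reverse h) (rf a (iact h v))
      iact-T v = iact-++ h (a ∷ reverse h) v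

      T-q : ∀ f → iact T (α q f) ≋ (-ᵥ α q f)
      T-q f = ≋-trans (≡⇒≋ (iact-T (α q f))) (≋-trans (iact-cong (reverse h)
          (≋-trans (rf-cong a (to f)) (≋-trans (rf-α-self a (coef f)) (α-⊝ a (coef f)))))
        (≋-trans (iact-neg (reverse h) (α a (coef f))) λ r p l → cong -_ (from f r p l)))

      T-shift : ∀ v r → q ≢ r → iact T v r ≐ v r
      T-shift v r q≢r p l = trans (cong (λ z → z r p) (iact-T v))
        (trans (iact-cong (reverse h) (rf-shift a (iact h v)) r p l)
          (trans (iact-+ (reverse h) (iact h v) _ r p l)
            (trans (cong₂ _+_ (iact-cancel′ h v r p l) (Inverse.at _ r q≢r p l)) (ℤₚ.+-identityʳ (v r p)))))

      G-pos : ∀ r → PosI G r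
      G-pos r with q ≟ r
      ... | yes refl = Neg⇒Pos∷ (mkNeg λ f k → Nonneg-resp (≋-sym (≋-trans (λ r p l → cong -_ (T-q f r p l)) (-ᵥ-invol (α q f)))) (Nonneg-α q k))
      ... | no q≢r = ¬Neg⇒Pos λ ng' → 0≰-1 {1ℤ} refl (subst (λ z → 0ℤ ≤ - z)
              (trans (T-shift (rf q (α r 𝟙)) r q≢r 0 N-pos) (trans (rf-other (α r 𝟙) 0 q≢r) (α-same r 𝟙 0)))
              (neg ng' 𝟙 0≤𝟙 r 0 N-pos))

    -- `T` = h a h⁻¹ negates α_q and changes no coordinate except that at q. Hence `G` makes no
    -- simple root negative, whereas a nonempty reduced word makes its first letter negative.
    -- Comparing the matrices of `T` and q is thereby avoided.
    G~[] : G ~ []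
    G~[] with reduce G
    ... | [] , _ , e , _ = ~sym e
    ... | b ∷ w , p , e , _ = ⊥-elim (Pos∧Neg G b (G-pos b) (NegI-~ e (Pos⇒Neg∷ (proj₁ p))))

    conjugate : q ∷ h ~ h ∷ʳ a
    conjugate = ~trans (~sym (~trans (~ˡ (q ∷ h) (~trans (~∷ a (~trans (≡⇒~ (sym (++-assoc (reverse h) h (a ∷ [])))) (~ʳ (a ∷ []) (~invˡ h)))) (~sq a []))) (≡⇒~ (cong (q ∷_) (++-identityʳ h)))))
      (~trans (≡⇒~ assoc) (~ʳ (h ∷ʳ a) G~[]))
      where
      assoc : (q ∷ h) ++ a ∷ (reverse h ++ (h ∷ʳ a)) ≡ G ++ (h ∷ʳ a)
      assoc = sym (cong (q ∷_) (++-assoc h (a ∷ reverse h) (h ∷ʳ a)))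

    private
      δ : ℕ → Mo
      δ p r = if does (p ℕ.≟ r) then 1ℤ else 0ℤ
      δ-self : ∀ p → δ p p ≡ 1ℤ
      δ-self p = cong (λ b → if b then 1ℤ else 0ℤ) (dec-true (p ℕ.≟ p) refl)

    -- If the entry vanished, `C` times `𝟙` minus the preimage of `δ p` would be nonnegative for
    -- large `C`, but its image has entry - 1 at `p`.
    coef-1≤ : ∀ p → p ℕ.< N → ¬ coef 𝟙 p ≡ 0ℤ
    coef-1≤ p l z with bound N (Inverse.coef (δ p))
    ... | C , hC = 0≰-1 {1ℤ} refl (subst (0ℤ ≤_) eq (pos ps ((C ·· 𝟙) ⊖ x) nn a p l))
      where
      x : Mo
      x = Inverse.coef (δ p)
      nn : 0≤ ((C ·· 𝟙) ⊖ x)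
      nn p l = subst (λ z → 0ℤ ≤ z - x p) (sym (ℤₚ.*-identityʳ (+ C))) (ℤₚ.i≤j⇒0≤j-i (hC p l))
      back : iact h (α q x) ≋ α a (δ p)
      back = ≋-trans (iact-cong h (≋-sym (Inverse.to (δ p)))) (iact-cancel h (α a (δ p)))
      eq : iact h (α q ((C ·· 𝟙) ⊖ x)) a p ≡ - 1ℤ
      eq = trans (iact-⊖ h q (C ·· 𝟙) x a p l)
        (cong₂ _-_ (trans (iact-·· h q C 𝟙 a p l) (trans (cong (+ C *_) z) (ℤₚ.*-zeroʳ (+ C))))
          (trans (back a p l) (trans (α-same a (δ p) p) (δ-self p))))

    1≤coef : 0≤ (coef 𝟙 ⊖ 𝟙)
    1≤coef p l with coef 𝟙 p | 0≤coef 0≤𝟙 p l | coef-1≤ p l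
    ... | + zero  | _ | h' = ⊥-elim (h' refl)
    ... | + suc k | _ | _ = +≤+ z≤n

  module Normalised {h : Word n} {q a : Fin n} (ps : PosI h q) (ng : NegI (h ∷ʳ a) q) where
    open Simple ps ng
    private
      module Inverse = Simple inv-pos inv-neg

    -- `coef` and its inverse preserve nonnegativity and send `𝟙` to vectors that are at least `𝟙`.
    -- With g' the preimage of `𝟙` this gives 𝟙 = coef g' ≥ coef 𝟙 ≥ 𝟙.
    simple-𝟙 : iact h (α q 𝟙) ≋ α a 𝟙
    simple-𝟙 = ≋-trans (to 𝟙) (α-cong a λ p l → ℤₚ.≤-antisym
      (ℤₚ.0≤i-j⇒j≤i (subst (0ℤ ≤_) (eq p l) (pos ps (g' ⊖ 𝟙) (Conjugate.1≤coef inv-pos inv-neg) a p l)))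
      (ℤₚ.0≤i-j⇒j≤i (Conjugate.1≤coef ps ng p l)))
      where
      g' : Mo
      g' = Inverse.coef 𝟙
      eq : ∀ p → p ℕ.< N → iact h (α q (g' ⊖ 𝟙)) a p ≡ 1ℤ - coef 𝟙 p
      eq p l = trans (iact-⊖ h q g' 𝟙 a p l)
        (cong (_- coef 𝟙 p) (trans (iact-cong h (≋-sym (Inverse.to 𝟙)) a p l) (trans (iact-cancel h (α a 𝟙) a p l) (α-same a 𝟙 p))))

  open Conjugate public using (conjugate)
  open Normalised public using (simple-𝟙)

  -- (h , q) stands for the root h⁻¹α_q.
  Root : Set
  Root = Word n × Fin n

  Rv : Root → Mo → V
  Rv (h , q) f = iact h (α q f)

  ρ : Root → V
  ρ t = Rv t 𝟙

  PosR : Root → Set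
  PosR (h , q) = PosI h q

  σ : Fin n → Root
  σ s = [] , s

  infixr 6 _·_
  _·_ : Fin n → Root → Root
  s · (h , q) = h ∷ʳ s , q

  Rv-· : ∀ s t f → Rv (s · t) f ≡ rf s (Rv t f)
  Rv-· s (h , q) f = iact-∷ʳ h s (α q f)

  -- Left inversions: the root h⁻¹α_q is positive and w⁻¹ makes it negative.
  Inv : Word n → Root → Set
  Inv w (h , q) = PosI h q × NegI (h ++ w) q

  Inv-~ : ∀ {w w'} → w ~ w' → ∀ t → Inv w t → Inv w' t
  Inv-~ e (h , q) (p , ng) = p , NegI-~ (~ˡ h e) ng

  Inv? : ∀ w t → Dec (Inv w t)
  Inv? w (h , q) with sign h q | sign (h ++ w) q
  ... | inj₂ a | _ = no λ i → Pos∧Neg h q (proj₁ i) a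
  ... | inj₁ a | inj₁ b = no λ i → Pos∧Neg (h ++ w) q b (proj₂ i)
  ... | inj₁ a | inj₂ b = yes (a , b)

  Inv-[] : ∀ t → ¬ Inv [] t
  Inv-[] (h , q) (p , ng) = Pos∧Neg h q p (subst (λ z → NegI z q) (++-identityʳ h) ng)

  σ-pos : ∀ s → PosR (σ s)
  σ-pos s = mkPos λ f k → Nonneg-α s k

  move : ∀ h s (w : Word n) → (h ∷ʳ s) ++ w ≡ h ++ s ∷ w
  move h s w = ++-assoc h (s ∷ []) w

  ·²-~ : ∀ h s (w : Word n) → (h ∷ʳ s) ++ s ∷ w ~ h ++ w
  ·²-~ h s w = ~trans (≡⇒~ (move h s (s ∷ w))) (~ˡ h (~sq s w))

  iact-simple : ∀ {h q a} (ps : PosI h q) (ng : NegI (h ∷ʳ a) q) w f →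
                iact (h ++ w) (α q f) ≋ iact w (α a (Simple.coef ps ng f))
  iact-simple {h} {q} ps ng w f = ≋-trans (≡⇒≋ (iact-++ h w (α q f))) (iact-cong w (Simple.to ps ng f))

  simple-PosI : ∀ {h q a w} → PosI h q → NegI (h ∷ʳ a) q → PosI w a → PosI (h ++ w) q
  simple-PosI {w = w} ps ng p = mkPos λ f k → Nonneg-resp (≋-sym (iact-simple ps ng w f)) (pos p _ (Simple.0≤coef ps ng k))

  simple-NegI : ∀ {h q a w} → PosI h q → NegI (h ∷ʳ a) q → NegI w a → NegI (h ++ w) q
  simple-NegI {w = w} ps ng p = mkNeg λ f k → Nonneg-resp (λ r q l → cong -_ (sym (iact-simple ps ng w f r q l)))
    (neg p _ (Simple.0≤coef ps ng k))

  -- The first alternative says that t is αₛ, by `simple-𝟙`. Kept as a sign, it also gives access to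
  -- `Simple.coef` for every f.
  Inv-∷⁻ : ∀ s w t → Inv (s ∷ w) t → NegI (proj₁ t ∷ʳ s) (proj₂ t) ⊎ Inv w (s · t)
  Inv-∷⁻ s w (h , q) (p , ng) with sign (h ∷ʳ s) q
  ... | inj₂ b = inj₁ b
  ... | inj₁ a = inj₂ (a , subst (λ z → NegI z q) (sym (move h s w)) ng)

  Inv-∷⁺ : ∀ s w t → PosR t → Inv w (s · t) → Inv (s ∷ w) t
  Inv-∷⁺ s w (h , q) p (_ , ng) = p , subst (λ z → NegI z q) (move h s w) ng

  Inv-∷-σ : ∀ s w t → PosI w s → PosR t → NegI (proj₁ t ∷ʳ s) (proj₂ t) → Inv (s ∷ w) t
  Inv-∷-σ s w (h , q) ps p ng = p , simple-NegI p ng (Pos⇒Neg∷ ps)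

  Inv-· : ∀ s w t → PosI w s → Inv w t → Inv (s ∷ w) (s · t)
  Inv-· s w (h , q) ps (p , ng) with sign (h ∷ʳ s) q
  ... | inj₁ a = a , NegI-~ (~sym (·²-~ h s w)) ng
  ... | inj₂ b = ⊥-elim (Pos∧Neg (h ++ w) q (simple-PosI p b ps) ng)

  Inv-··· : ∀ s w t → PosR t → Inv (s ∷ w) (s · t) → Inv w t
  Inv-··· s w (h , q) p (_ , ng) = p , NegI-~ (·²-~ h s w) ng

  infix 4 _≃_
  -- Only values at `𝟙` are compared, since two words for the same root may differ by a permutation
  -- of coordinates on other f.
  _≃_ : Root → Root → Set
  t ≃ t' = ρ t ≋ ρ t'

  ·-cong : ∀ s {t t'} → t ≃ t' → s · t ≃ s · t'
  ·-cong s {t} {t'} e = ≋-trans (≡⇒≋ (Rv-· s t 𝟙)) (≋-trans (rf-cong s e) (≡⇒≋ (sym (Rv-· s t' 𝟙))))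

  ·-invol : ∀ s t → s · s · t ≃ t
  ·-invol s t = ≋-trans (≡⇒≋ (trans (Rv-· s (s · t) 𝟙) (cong (rf s) (Rv-· s t 𝟙)))) (rf-invol s (ρ t))

  Inv-≃ : ∀ w t t' → t ≃ t' → Inv w t → Inv w t'
  Inv-≃ w (h , q) (h' , q') e (p , ng) = sign-𝟙 (Nonneg-resp e (pos p 𝟙 0≤𝟙)) ,
    sign-𝟙⁻ (Nonneg-resp (λ r q'' l → cong -_ (step r q'' l)) (neg ng 𝟙 0≤𝟙))
    where
    step : iact (h ++ w) (α q 𝟙) ≋ iact (h' ++ w) (α q' 𝟙)
    step = ≋-trans (≡⇒≋ (iact-++ h w (α q 𝟙))) (≋-trans (iact-cong w e) (≡⇒≋ (sym (iact-++ h' w (α q' 𝟙)))))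

  rts : Word n → List Root
  rts []      = []
  rts (s ∷ w) = σ s ∷ map (s ·_) (rts w)

  rts-Inv : ∀ {w} → PR w → ∀ {t} → t ∈ rts w → Inv w t
  rts-Inv {s ∷ w} (ps , pw) (here refl) = σ-pos s , Pos⇒Neg∷ ps
  rts-Inv {s ∷ w} (ps , pw) (there i) with ∈-map⁻ (s ·_) i
  ... | t' , i' , refl = Inv-· s w t' ps (rts-Inv pw i')

  Inv-rts : ∀ w t → Inv w t → Σ Root λ t' → t' ∈ rts w × t ≃ t'
  Inv-rts []      t i = ⊥-elim (Inv-[] t i)
  Inv-rts (s ∷ w) t i with Inv-∷⁻ s w t i
  ... | inj₁ ng = σ s , here refl , simple-𝟙 (proj₁ i) ng
  ... | inj₂ j with Inv-rts w (s · t) j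
  ...   | t' , i' , e = s · t' , there (∈-map⁺ (s ·_) i') , ≋-trans (≋-sym (·-invol s t)) (·-cong s {s · t} {t'} e)

  infix 4 _⊑_
  _⊑_ : Word n → Word n → Set
  x ⊑ y = ∀ t → Inv x t → Inv y t

  -- The first letter of `x` is an inversion of `y`, so by `classify` it can be brought to the front
  -- of `y`; stripping it from both preserves the inclusion.
  ⊑-factor : ∀ x y → PR x → PR y → x ⊑ y → Σ (Word n) λ d → y ~ x ++ d × PR d × length x ℕ.+ length d ≡ length y
  ⊑-factor [] y px py h = y , ~refl , py , refl
  ⊑-factor (s ∷ x) y (ps , px) py h with classify y py s
  ... | inj₁ p = ⊥-elim (Pos∧Neg y s p (proj₂ (h (σ s) (rts-Inv (ps , px) (here refl)))))
  ... | inj₂ (ng , y' , py' , l , e) with ⊑-factor x y' px py' sub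
    where
    sub : x ⊑ y'
    sub t i = Inv-··· s y' t (proj₁ i) (Inv-~ e (s · t) (h (s · t) (Inv-· s x t ps i)))
  ...   | d , e' , pd , l' = d , ~trans e (~∷ s e') , pd , trans (cong suc l') l

  ⊑-++ : ∀ x d → PR (x ++ d) → x ⊑ x ++ d
  ⊑-++ []      d p t i = ⊥-elim (Inv-[] t i)
  ⊑-++ (s ∷ x) d (ps , p) t i with Inv-∷⁻ s x t i
  ... | inj₁ ng = Inv-∷-σ s (x ++ d) t ps (proj₁ i) ng
  ... | inj₂ j = Inv-∷⁺ s (x ++ d) t (proj₁ i) (⊑-++ x d p (s · t) j)

  PR-IsLen : ∀ {w w'} → PR w' → w' ~ w → IsLen w (length w')
  PR-IsLen {w} {w'} p e = (w' , e , refl) , λ v e' → PR⇒Reduced p v (~trans e' (~sym e))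

  IsLen-PR : ∀ {w k} → IsLen w k → Σ (Word n) λ w' → PR w' × w' ~ w × length w' ≡ k
  IsLen-PR ((v , e , l) , h) with reduce v
  ... | w' , p , e' , l' = w' , p , ~trans e' e , ℕₚ.≤-antisym (subst (length w' ℕ.≤_) l l') (h w' (~trans e' e))

  ⊑⇒WeakLe : ∀ {u v} → u ⊑ v → WeakLe u v
  ⊑⇒WeakLe {u} {v} h with reduce u | reduce v
  ... | u' , pu , eu , _ | v' , pv , ev , _
    with ⊑-factor u' v' pu pv (λ t i → Inv-~ (~sym ev) t (h t (Inv-~ eu t i)))
  ...   | d , e , pd , l = length u' , length v' , length d , PR-IsLen pu eu , PR-IsLen pv ev ,
            PR-IsLen pd (~cancelˡ u (~trans (~ʳ d (~sym eu)) (~trans (~sym e) (~trans ev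
              (~sym (~trans (≡⇒~ (sym (++-assoc u (reverse u) v))) (~ʳ v (~invʳ u)))))))) , sym l

  WeakLe⇒⊑ : ∀ {u v} → WeakLe u v → u ⊑ v
  WeakLe⇒⊑ {u} {v} (lu , lv , ld , Lu , Lv , Ld , e) t i with IsLen-PR Lu | IsLen-PR Ld
  ... | u' , pu , eu , refl | d , pd , ed , refl =
    Inv-~ e' t (⊑-++ u' d (Reduced⇒PR λ w ew → subst (ℕ._≤ length w) (trans e (sym (length-++ u'))) (proj₂ Lv w (~trans ew e'))) t
      (Inv-~ (~sym eu) t i))
    where
    e' : u' ++ d ~ v
    e' = ~trans (~ʳ d eu) (~trans (~ˡ u ed) (~trans (≡⇒~ (sym (++-assoc u (reverse u) v))) (~ʳ v (~invʳ u))))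

  ⊑-antisym : ∀ {x y} → x ⊑ y → y ⊑ x → x ~ y
  ⊑-antisym {x} {y} h k with reduce x | reduce y
  ... | x' , px , ex , _ | y' , py , ey , _
    with ⊑-factor x' y' px py (λ t i → Inv-~ (~sym ey) t (h t (Inv-~ ex t i)))
       | ⊑-factor y' x' py px (λ t i → Inv-~ (~sym ex) t (k t (Inv-~ ey t i)))
  ...   | d , e , _ , l | d' , _ , _ , l' = ~trans (~sym ex) (~trans (≡⇒~ (sym (++-identityʳ x'))) (~trans
            (≡⇒~ (cong (x' ++_) (sym (nil d (ℕₚ.+-cancelˡ-≤ (length x') _ _ (ℕₚ.≤-trans (ℕₚ.≤-reflexive l)
              (ℕₚ.≤-trans (ℕₚ.m≤m+n (length y') (length d')) (ℕₚ.≤-reflexive (trans l' (sym (ℕₚ.+-identityʳ _)))))))))))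
            (~trans (~sym e) ey)))
    where
    nil : ∀ (d : Word n) → length d ℕ.≤ 0 → d ≡ []
    nil [] _ = refl

-- Subsequences and cyclic reading of words.

AllPairs-mapWith : ∀ {A : Set} {P : A → Set} {R S : A → A → Set} {xs : List A} →
  (∀ {x y} → P x → P y → R x y → S x y) → All P xs → AllPairs R xs → AllPairs S xs
AllPairs-mapWith f []       []       = []
AllPairs-mapWith {P = P} {R} {S} {x ∷ _} f (p ∷ ps) (r ∷ rs) = go ps r ∷ AllPairs-mapWith f ps rs
  where
  go : ∀ {ys} → All P ys → All (R x) ys → All (S x) ys
  go []       []       = []
  go (q ∷ qs) (t ∷ ts) = f p q t ∷ go qs ts

AllPairs-split : ∀ {A : Set} {R : A → A → Set} xs {y : A} {ys} → AllPairs R (xs ++ y ∷ ys) → ∀ {x} → x ∈ xs → R x y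
AllPairs-split (x ∷ xs) (r ∷ rs) (here refl) = All.lookup r (∈-++⁺ʳ xs (here refl))
AllPairs-split (x ∷ xs) (r ∷ rs) (there i)   = AllPairs-split xs rs i

-- Subsequences up to `R`: inversions of a derived word match those of the given one only up to a
-- change of coordinates (`Fam`) or a reflection (`Twist`).
data Sub {A : Set} (R : A → A → Set) : List A → List A → Set where
  stop : ∀ {ys} → Sub R [] ys
  keep : ∀ {x y xs ys} → R x y → Sub R xs ys → Sub R (x ∷ xs) (y ∷ ys)
  skip : ∀ {y xs ys} → Sub R xs ys → Sub R xs (y ∷ ys)

Sub-remap : ∀ {A : Set} {R : A → A → Set} us (f g k : A → A) {ts} → (∀ t u → R t (g u) → R (f t) (k u)) →
            Sub R ts (map g us) → Sub R (map f ts) (map k us)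
Sub-remap []       f g k h stop       = stop
Sub-remap (u ∷ us) f g k h stop       = stop
Sub-remap (u ∷ us) f g k h (keep r s) = keep (h _ u r) (Sub-remap us f g k h s)
Sub-remap (u ∷ us) f g k h (skip s)   = skip (Sub-remap us f g k h s)

Sub-++ : ∀ {A : Set} {R : A → A → Set} {xs xs' ys'} → All (λ x → R x x) xs → Sub R xs' ys' → Sub R (xs ++ xs') (xs ++ ys')
Sub-++         []       s = s
Sub-++ {R = R} (r ∷ rs) s = keep r (Sub-++ {R = R} rs s)

Sub-mapʳ : ∀ {A : Set} {R : A → A → Set} (f g : A → A) xs → (∀ x → x ∈ xs → R (f x) (g x)) → Sub R (map f xs) (map g xs)
Sub-mapʳ f g []       h = stop
Sub-mapʳ f g (x ∷ xs) h = keep (h x (here refl)) (Sub-mapʳ f g xs λ y i → h y (there i))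

Sub-AllPairs : ∀ {A : Set} {R Q T : A → A → Set} {xs ys} →
  (∀ {x x' y y'} → R x y → R x' y' → Q y y' → T x x') → Sub R xs ys → AllPairs Q ys → AllPairs T xs
Sub-AllPairs f stop       _        = []
Sub-AllPairs f (skip s)   (_ ∷ qs) = Sub-AllPairs f s qs
Sub-AllPairs {R = R} {Q} {T} {x ∷ _} {y ∷ _} f (keep r s) (q ∷ qs) = go s q ∷ Sub-AllPairs f s qs
  where
  go : ∀ {xs ys} → Sub R xs ys → All (Q y) ys → All (T x) xs
  go stop       _        = []
  go (skip s)   (_ ∷ ps) = go s ps
  go (keep t s) (p ∷ ps) = f r t p ∷ go s ps

Distinct : ∀ {n} → Word n → Set
Distinct []       = ⊤
Distinct (s ∷ cs) = s ∉ cs × Distinct cs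

Distinct-∷ʳ : ∀ {n} {s : Fin n} cs → s ∉ cs → Distinct cs → Distinct (cs ∷ʳ s)
Distinct-∷ʳ []       h d       = (λ ()) , tt
Distinct-∷ʳ {s = s} (r ∷ cs) h (k , d) = lem , Distinct-∷ʳ cs (λ i → h (there i)) d
  where
  lem : r ∉ cs ∷ʳ s
  lem i with ∈-++⁻ cs i
  ... | inj₁ j = k j
  ... | inj₂ (here e) = h (here (sym e))

∈-rotate : ∀ {n} {s r : Fin n} cs → r ∈ s ∷ cs → r ∈ cs ∷ʳ s
∈-rotate cs (here refl) = ∈-++⁺ʳ cs (here refl)
∈-rotate cs (there i)   = ∈-++⁺ˡ i

∈-unrotate : ∀ {n} {s r : Fin n} cs → r ∈ cs ∷ʳ s → r ∈ s ∷ cs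
∈-unrotate cs i with ∈-++⁻ cs i
... | inj₁ j = there j
... | inj₂ (here e) = here e

length-rotate : ∀ {n} (s : Fin n) cs → length (cs ∷ʳ s) ≡ suc (length cs)
length-rotate s cs = trans (length-++ cs) (ℕₚ.+-comm (length cs) 1)

_⊆L_ : ∀ {n} → Word n → Word n → Set
w ⊆L cs = ∀ a → a ∈ w → a ∈ cs

firstOccurrence : ∀ {n} (a : Fin n) w → a ∈ w → Σ (Word n) λ x → Σ (Word n) λ y → w ≡ x ++ a ∷ y × a ∉ x
firstOccurrence a (b ∷ w) i with a ≟ b
... | yes refl = [] , w , refl , λ ()
... | no h with i
...   | here e = ⊥-elim (h e)
...   | there j with firstOccurrence a w j
...     | x , y , refl , k = b ∷ x , y , refl , λ { (here e) → h e ; (there l) → k l }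

∉-reverse : ∀ {n} {a : Fin n} {w} → a ∉ w → a ∉ reverse w
∉-reverse h i = h (reverse⁻ i)

-- The letters of cs are read cyclically and each is taken or dropped for ever, so the sets of
-- letters of w in successive blocks decrease.
data Srt {n : ℕ} : Word n → Word n → Set where
  done : ∀ {cs} → Srt cs []
  take : ∀ {s cs w} → Srt (cs ∷ʳ s) w → Srt (s ∷ cs) (s ∷ w)
  drop : ∀ {s cs w} → Srt cs w → Srt (s ∷ cs) w

Srt-letters : ∀ {n} {cs w : Word n} → Srt cs w → w ⊆L cs
Srt-letters (take d) a (here e)  = here e
Srt-letters (take {cs = cs} d) a (there i) = ∈-unrotate cs (Srt-letters d a i)
Srt-letters (drop d) a i = there (Srt-letters d a i)

-- The Euler form and its skew part.

module EulerForm {n : ℕ} (M : CoxeterMatrix n) where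
  open Roots M public

  Supp : Word n → V → Set
  Supp cs v = ∀ r → r ∉ cs → v r ≐ 𝟘

  ΣL : Word n → V → Mo
  ΣL []       f = 𝟘
  ΣL (r ∷ cs) f = f r ⊕ ΣL cs f

  ΣL-cong : ∀ cs {f g} → (∀ r → r ∈ cs → f r ≐ g r) → ΣL cs f ≐ ΣL cs g
  ΣL-cong []       h p l = refl
  ΣL-cong (r ∷ cs) h p l = cong₂ _+_ (h r (here refl) p l) (ΣL-cong cs (λ q i → h q (there i)) p l)

  upd-split : ∀ s v → v ≋ (α s (v s) +ᵥ upd s 𝟘 v)
  upd-split s v = upd-elim s _ (λ p l → sym (trans (cong₂ _+_ (α-same s (v s) p) (cong (λ g → g p) (upd-same s 𝟘 v))) (ℤₚ.+-identityʳ _)))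
    λ q k p l → sym (trans (cong₂ _+_ (α-other (v s) p k) (cong (λ g → g p) (upd-other 𝟘 v k))) (ℤₚ.+-identityˡ _))

  upd-Supp : ∀ s cs {v} → Supp (s ∷ cs) v → Supp cs (upd s 𝟘 v)
  upd-Supp s cs {v} h = upd-elim s _ (λ _ p l → cong (λ g → g p) (upd-same s 𝟘 v))
    λ q k i p l → trans (cong (λ g → g p) (upd-other 𝟘 v k)) (h q (λ { (here e) → k (sym e) ; (there j) → i j }) p l)

  ΣF-ΣL : ∀ cs → Distinct cs → ∀ f → Supp cs f → ΣF n f ≐ ΣL cs f
  ΣF-ΣL [] d f h p l = trans (ΣF-cong n (λ i → h i λ ()) p l) (ΣF-𝟘 n p)
  ΣF-ΣL (s ∷ cs) (s∉ , d) f h p l = trans (ΣF-cong n (upd-split s f) p l) (trans (ΣF-⊕ n (α s (f s)) f∖s p l)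
    (cong₂ _+_ (trans (ΣF-single n (α s (f s)) s (λ i k p l → α-other (f s) p k) p l) (α-same s (f s) p))
      (trans (ΣF-ΣL cs d f∖s (upd-Supp s cs h) p l) (ΣL-cong cs (λ r i p l → cong (λ g → g p) (upd-other 𝟘 f λ e → s∉ (subst (_∈ cs) (sym e) i))) p l))))
    where
    f∖s : V
    f∖s = upd s 𝟘 f

  Nl : Fin n → Word n → V → Mo
  Nl s cs x = ΣL cs (λ r → κ (m s r) (x r))

  Nl-cong : ∀ s cs {x y} → (∀ r → r ∈ cs → x r ≐ y r) → Nl s cs x ≐ Nl s cs y
  Nl-cong s cs h = ΣL-cong cs λ r i → κ-cong (m s r) (width∣N s r) (h r i)

  Nl-+ : ∀ s cs x y → Nl s cs (x +ᵥ y) ≐ (Nl s cs x ⊕ Nl s cs y)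
  Nl-+ s []       x y p l = refl
  Nl-+ s (r ∷ cs) x y p l = trans (cong₂ _+_ (κ-⊕ (m s r) (x r) (y r) p) (Nl-+ s cs x y p l))
    (+-exchange (κ (m s r) (x r) p) (κ (m s r) (y r) p) (Nl s cs x p) (Nl s cs y p))

  Nl-0≤ : ∀ s cs {x} → Nonneg x → 0≤ Nl s cs x
  Nl-0≤ s []       h = 0≤𝟘
  Nl-0≤ s (r ∷ cs) h = 0≤-⊕ (κ-0≤ (m s r) (width∣N s r) (h r)) (Nl-0≤ s cs h)

  Nl-∷ʳ : ∀ s cs r x → Nl s (cs ∷ʳ r) x ≐ (Nl s cs x ⊕ κ (m s r) (x r))
  Nl-∷ʳ s []       r x p l = ℤₚ.+-comm (κ (m s r) (x r) p) 0ℤ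
  Nl-∷ʳ s (q ∷ cs) r x p l = trans (cong (_+_ (κ (m s q) (x q) p)) (Nl-∷ʳ s cs r x p l))
    (sym (ℤₚ.+-assoc (κ (m s q) (x q) p) (Nl s cs x p) _))

  Nl-zero : ∀ s cs {x} → (∀ r → r ∈ cs → x r ≐ 𝟘) → Nl s cs x ≐ 𝟘
  Nl-zero s []       h p l = refl
  Nl-zero s (r ∷ cs) h p l = cong₂ _+_ (κ-𝟘 s r (h r (here refl)) p l) (Nl-zero s cs (λ q i → h q (there i)) p l)

  Nb-Nl : ∀ s cs → Distinct (s ∷ cs) → ∀ {x} → Supp (s ∷ cs) x → Nb s x ≐ Nl s cs x
  Nb-Nl s cs (s∉ , d) {x} h = ΣF-ΣL cs d (λ r → κ (m s r) (x r)) (upd-elim s _ (λ _ p l → κ-self s (x s) p)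
    λ r k i → κ-𝟘 s r (h r λ { (here e) → k (sym e) ; (there j) → i j }))

  rf-Nl : ∀ s cs → Distinct (s ∷ cs) → ∀ {x} → Supp (s ∷ cs) x → rf s x s ≐ (Nl s cs x ⊖ x s)
  rf-Nl s cs d {x} h p l = trans (rf-same s x p) (cong (_- x s p) (Nb-Nl s cs d h p l))

  -- The Euler form of the Coxeter element whose letters are listed by cs.
  E : Word n → V → V → ℤ
  E []       x y = 0ℤ
  E (s ∷ cs) x y = ⟨ x s ⊖ Nl s cs x , y s ⟩ + E cs x y

  E-cong : ∀ cs {x x' y y'} → (∀ r → r ∈ cs → x r ≐ x' r) → (∀ r → r ∈ cs → y r ≐ y' r) → E cs x y ≡ E cs x' y'
  E-cong []       h k = refl
  E-cong (s ∷ cs) h k = cong₂ _+_ (⟨⟩-cong (λ p l → cong₂ _-_ (h s (here refl) p l) (Nl-cong s cs (λ r i → h r (there i)) p l)) (k s (here refl)))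
    (E-cong cs (λ r i → h r (there i)) (λ r i → k r (there i)))

  E-≋ : ∀ cs {x x' y y'} → x ≋ x' → y ≋ y' → E cs x y ≡ E cs x' y'
  E-≋ cs e f = E-cong cs (λ r _ → e r) (λ r _ → f r)

  E-+ˡ : ∀ cs x x' y → E cs (x +ᵥ x') y ≡ E cs x y + E cs x' y
  E-+ˡ []       x x' y = refl
  E-+ˡ (s ∷ cs) x x' y = trans (cong₂ _+_ (trans (⟨⟩-cong {g = y s} (λ p l → trans (cong (_-_ (x s p + x' s p)) (Nl-+ s cs x x' p l))
      (lem (x s p) (x' s p) (Nl s cs x p) (Nl s cs x' p))) ≐-refl) (⟨⟩-⊕ˡ (x s ⊖ Nl s cs x) (x' s ⊖ Nl s cs x') (y s)))
      (E-+ˡ cs x x' y)) (+-exchange ⟨ x s ⊖ Nl s cs x , y s ⟩ ⟨ x' s ⊖ Nl s cs x' , y s ⟩ (E cs x y) (E cs x' y))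
    where
    lem : ∀ a b c d → (a + b) - (c + d) ≡ (a - c) + (b - d)
    lem = solve-∀

  E-+ʳ : ∀ cs x y y' → E cs x (y +ᵥ y') ≡ E cs x y + E cs x y'
  E-+ʳ []       x y y' = refl
  E-+ʳ (s ∷ cs) x y y' = trans (cong₂ _+_ (⟨⟩-⊕ʳ (x s ⊖ Nl s cs x) (y s) (y' s)) (E-+ʳ cs x y y'))
    (+-exchange ⟨ x s ⊖ Nl s cs x , y s ⟩ ⟨ x s ⊖ Nl s cs x , y' s ⟩ (E cs x y) (E cs x y'))

  ⟨⟩-𝟘ˡ : ∀ {f} g → f ≐ 𝟘 → ⟨ f , g ⟩ ≡ 0ℤ
  ⟨⟩-𝟘ˡ g h = trans (⟨⟩-cong {g = g} h ≐-refl) (zeros N)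
    where
    zeros : ∀ K → Σ< K (λ p → 0ℤ * g p) ≡ 0ℤ
    zeros zero    = refl
    zeros (suc K) = trans (cong (_+ 0ℤ * g K) (zeros K)) (trans (ℤₚ.+-identityˡ _) (ℤₚ.*-zeroˡ (g K)))

  ⟨⟩-𝟘ʳ : ∀ f {g} → g ≐ 𝟘 → ⟨ f , g ⟩ ≡ 0ℤ
  ⟨⟩-𝟘ʳ f {g} h = trans (⟨⟩-comm f g) (⟨⟩-𝟘ˡ f h)

  E-zeroˡ : ∀ cs {x} y → (∀ r → r ∈ cs → x r ≐ 𝟘) → E cs x y ≡ 0ℤ
  E-zeroˡ []       y h = refl
  E-zeroˡ (s ∷ cs) y h = cong₂ _+_ (⟨⟩-𝟘ˡ (y s) λ p l → cong₂ _-_ (h s (here refl) p l) (Nl-zero s cs (λ r i → h r (there i)) p l))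
    (E-zeroˡ cs y λ r i → h r (there i))

  E-zeroʳ : ∀ cs x {y} → (∀ r → r ∈ cs → y r ≐ 𝟘) → E cs x y ≡ 0ℤ
  E-zeroʳ []       x h = refl
  E-zeroʳ (s ∷ cs) x h = cong₂ _+_ (⟨⟩-𝟘ʳ (x s ⊖ Nl s cs x) (h s (here refl))) (E-zeroʳ cs x λ r i → h r (there i))

  private
    ≢-of : ∀ {s r : Fin n} {cs} → s ∉ cs → r ∈ cs → s ≢ r
    ≢-of h i refl = h i

  E-αˡ : ∀ s cs → s ∉ cs → ∀ f y → E (s ∷ cs) (α s f) y ≡ ⟨ f , y s ⟩
  E-αˡ s cs s∉ f y = trans (cong₂ _+_ (⟨⟩-cong {g = y s} (λ p l → trans (cong₂ _-_ (α-same s f p) (Nl-zero s cs (λ r i p l → α-other f p (≢-of s∉ i)) p l))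
      (ℤₚ.+-identityʳ (f p))) ≐-refl) (E-zeroˡ cs y λ r i p l → α-other f p (≢-of s∉ i))) (ℤₚ.+-identityʳ _)

  E-αʳ : ∀ s cs → s ∉ cs → ∀ x f → E (s ∷ cs) x (α s f) ≡ ⟨ x s ⊖ Nl s cs x , f ⟩
  E-αʳ s cs s∉ x f = trans (cong₂ _+_ (⟨⟩-cong {x s ⊖ Nl s cs x} ≐-refl λ p l → α-same s f p)
    (E-zeroʳ cs x λ r i p l → α-other f p (≢-of s∉ i))) (ℤₚ.+-identityʳ _)

  E-drop : ∀ s cs x {y} → y s ≐ 𝟘 → E (s ∷ cs) x y ≡ E cs x y
  E-drop s cs x h = trans (cong (_+ E cs x _) (⟨⟩-𝟘ʳ (x s ⊖ Nl s cs x) h)) (ℤₚ.+-identityˡ _)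

  -- A letter at the end has its cross terms in the second argument rather than the first; `κ-adj`
  -- and the symmetry of `m` carry them across.
  E-∷ʳ : ∀ s cs x y → E (cs ∷ʳ s) x y ≡ E cs x y + ⟨ x s , y s ⊖ Nl s cs y ⟩
  E-∷ʳ s [] x y = trans (ℤₚ.+-identityʳ _) (trans (⟨⟩-cong {g = y s} (λ p l → ℤₚ.+-identityʳ (x s p)) ≐-refl)
    (trans (⟨⟩-cong {x s} ≐-refl λ p l → sym (ℤₚ.+-identityʳ (y s p))) (sym (ℤₚ.+-identityˡ _))))
  E-∷ʳ s (r ∷ cs) x y = trans (cong₂ _+_ head (E-∷ʳ s cs x y)) (trans (lem A B (E cs x y) ⟨ x s , y s ⊖ Nl s cs y ⟩)
      (cong (_+_ (A + E cs x y)) (sym tail)))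
    where
    A B : ℤ
    A = ⟨ x r ⊖ Nl r cs x , y r ⟩
    B = ⟨ x s , κ (m s r) (y r) ⟩
    lem : ∀ a b c d → (a - b) + (c + d) ≡ (a + c) + (d - b)
    lem = solve-∀
    lem₁ : ∀ a b c → a - (b + c) ≡ (a - b) - c
    lem₁ = solve-∀
    lem₂ : ∀ a b c → a - (b + c) ≡ (a - c) - b
    lem₂ = solve-∀
    head : ⟨ x r ⊖ Nl r (cs ∷ʳ s) x , y r ⟩ ≡ A - B
    head = trans (⟨⟩-cong {g = y r} (λ p l → trans (cong (_-_ (x r p)) (Nl-∷ʳ r cs s x p l)) (lem₁ (x r p) (Nl r cs x p) _)) ≐-refl)
      (trans (⟨⟩-⊕ˡ (x r ⊖ Nl r cs x) (⊝ κ (m r s) (x s)) (y r)) (cong (_+_ A)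
        (trans (⟨⟩-⊝ˡ (κ (m r s) (x s)) (y r)) (cong -_ (trans (κ-adj (m r s) (width∣N r s) (x s) (y r))
          (cong (λ z → ⟨ x s , κ z (y r) ⟩) (m-sym r s)))))))
    tail : ⟨ x s , y s ⊖ Nl s (r ∷ cs) y ⟩ ≡ ⟨ x s , y s ⊖ Nl s cs y ⟩ - B
    tail = trans (⟨⟩-cong {x s} ≐-refl λ p l → lem₂ (y s p) (κ (m s r) (y r) p) (Nl s cs y p))
      (trans (⟨⟩-⊕ʳ (x s) (y s ⊖ Nl s cs y) (⊝ κ (m s r) (y r))) (cong (_+_ ⟨ x s , y s ⊖ Nl s cs y ⟩) (⟨⟩-⊝ʳ (x s) (κ (m s r) (y r)))))

  -- Reflecting in the initial letter s turns the s-term of the first-letter form into that of the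
  -- last-letter form. This transport along conjugation of γ drives all inductions below.
  E-rotate : ∀ s cs → Distinct (s ∷ cs) → ∀ {x y} → Supp (s ∷ cs) x → Supp (s ∷ cs) y →
             E (cs ∷ʳ s) (rf s x) (rf s y) ≡ E (s ∷ cs) x y
  E-rotate s cs d {x} {y} hx hy = trans (E-∷ʳ s cs (rf s x) (rf s y))
    (trans (cong₂ _+_ (E-cong cs (same x) (same y)) step) (ℤₚ.+-comm (E cs x y) _))
    where
    same : ∀ x r → r ∈ cs → rf s x r ≐ x r
    same x r i p l = rf-other x p (≢-of (proj₁ d) i)
    lem : ∀ a b → (a - b) - a ≡ - b
    lem = solve-∀
    lem' : ∀ a b → - (a - b) ≡ b - a
    lem' = solve-∀
    step : ⟨ rf s x s , rf s y s ⊖ Nl s cs (rf s y) ⟩ ≡ ⟨ x s ⊖ Nl s cs x , y s ⟩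
    step = trans (⟨⟩-cong (rf-Nl s cs d hx) λ p l → trans (cong₂ _-_ (rf-Nl s cs d hy p l) (Nl-cong s cs (same y) p l))
        (lem (Nl s cs y p) (y s p)))
      (trans (⟨⟩-⊝ʳ (Nl s cs x ⊖ x s) (y s)) (trans (sym (⟨⟩-⊝ˡ (Nl s cs x ⊖ x s) (y s)))
        (⟨⟩-cong {g = y s} (λ p l → lem' (Nl s cs x p) (x s p)) ≐-refl)))

  Supp-rf : ∀ s cs {x} → Supp (s ∷ cs) x → Supp (s ∷ cs) (rf s x)
  Supp-rf s cs {x} h r i p l = trans (rf-other x p λ e → i (here (sym e))) (h r i p l)

  Supp-rotate : ∀ s cs {x} → Supp (cs ∷ʳ s) x → Supp (s ∷ cs) x
  Supp-rotate s cs h r i = h r λ j → i (∈-unrotate cs j)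

  ω : Word n → V → V → ℤ
  ω cs x y = E cs x y - E cs y x

  -- For nonnegative f and y the right-hand side is nonnegative: this is where the initial letter
  -- makes itself felt.
  ω-α : ∀ s cs → s ∉ cs → ∀ f y → ω (s ∷ cs) (α s f) y ≡ ⟨ f , Nl s cs y ⟩
  ω-α s cs s∉ f y = trans (cong₂ _-_ (E-αˡ s cs s∉ f y) (trans (E-αʳ s cs s∉ y f)
      (trans (⟨⟩-comm (y s ⊖ Nl s cs y) f) (trans (⟨⟩-⊕ʳ f (y s) (⊝ Nl s cs y)) (cong (_+_ ⟨ f , y s ⟩) (⟨⟩-⊝ʳ f (Nl s cs y)))))))
    (lem ⟨ f , y s ⟩ ⟨ f , Nl s cs y ⟩)
    where
    lem : ∀ a b → a - (a - b) ≡ b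
    lem = solve-∀

  ω-≋ : ∀ cs {x x' y y'} → x ≋ x' → y ≋ y' → ω cs x y ≡ ω cs x' y'
  ω-≋ cs e f = cong₂ _-_ (E-≋ cs e f) (E-≋ cs f e)

  ω-+ˡ : ∀ cs x x' y → ω cs (x +ᵥ x') y ≡ ω cs x y + ω cs x' y
  ω-+ˡ cs x x' y = trans (cong₂ _-_ (E-+ˡ cs x x' y) (E-+ʳ cs y x x')) (lem (E cs x y) (E cs x' y) (E cs y x) (E cs y x'))
    where
    lem : ∀ a b c d → (a + b) - (c + d) ≡ (a - c) + (b - d)
    lem = solve-∀

  ω-neg : ∀ cs x y → ω cs x y ≡ - ω cs y x
  ω-neg cs x y = lem (E cs x y) (E cs y x)
    where
    lem : ∀ a b → a - b ≡ - (b - a)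
    lem = solve-∀

  ω-rotate : ∀ s cs → Distinct (s ∷ cs) → ∀ {x y} → Supp (s ∷ cs) x → Supp (s ∷ cs) y →
             ω (cs ∷ʳ s) (rf s x) (rf s y) ≡ ω (s ∷ cs) x y
  ω-rotate s cs d hx hy = cong₂ _-_ (E-rotate s cs d hx hy) (E-rotate s cs d hy hx)

  ω-drop : ∀ s cs {x y} → x s ≐ 𝟘 → y s ≐ 𝟘 → ω (s ∷ cs) x y ≡ ω cs x y
  ω-drop s cs {x} {y} hx hy = cong₂ _-_ (E-drop s cs x hy) (E-drop s cs y hx)

  -- Letters of w do not touch the coordinate at r ∉ cs, so it is the same before and after the
  -- change of sign, hence zero.
  Inv-Supp : ∀ {cs w} → w ⊆L cs → ∀ t → Inv w t → ∀ f → 0≤ f → Supp cs (Rv t f)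
  Inv-Supp {cs} {w} sub (h , q) (p , ng) f k r i = 0≤-antisym (pos p f k r) λ a l →
    subst (λ z → 0ℤ ≤ - z) (trans (cong (λ v → v r a) (iact-++ h w (α q f)))
      (iact-other w (iact h (α q f)) (λ j → i (sub r j)) a)) (neg ng f k r a l)

-- The skew-form criterion for sortability and parabolic parts.

module Sorting {n : ℕ} (M : CoxeterMatrix n) where
  open EulerForm M public

  Om : Word n → Root → Root → Set
  Om cs t t' = ∀ f g → 0≤ f → 0≤ g → 0ℤ ≤ ω cs (Rv t f) (Rv t' g)

  -- Up to equality in W this characterises the words with Srt cs w: see Srt⇒OS and sort.
  OS : Word n → Word n → Set
  OS cs w = AllPairs (Om cs) (rts w)

  Nonneg-PosR : ∀ t → PosR t → ∀ f → 0≤ f → Nonneg (Rv t f)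
  Nonneg-PosR (h , q) p = pos p

  Srt⇒OS : ∀ {cs w} → Distinct cs → PR w → Srt cs w → OS cs w
  Srt⇒OS d p done = []
  Srt⇒OS {s ∷ cs} {s ∷ w} d@(s∉ , d') (ps , p) (take D) =
    Allₚ.map⁺ (All.tabulate λ {t} i f g 0≤f 0≤g → subst (0ℤ ≤_) (sym (ω-α s cs s∉ f (Rv (s · t) g)))
      (⟨⟩-0≤ 0≤f (Nl-0≤ s cs (Nonneg-PosR (s · t) (proj₁ (Inv-· s w t ps (rts-Inv p i))) g 0≤g)))) ∷
    AllPairsₚ.map⁺ (AllPairs-mapWith {P = λ t → ∀ f → 0≤ f → Supp (s ∷ cs) (Rv t f)}
      (λ {t} {t'} ht ht' o f g 0≤f 0≤g → subst (0ℤ ≤_)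
        (trans (trans (sym (ω-≋ (cs ∷ʳ s) (rf-invol s (Rv t f)) (rf-invol s (Rv t' g))))
          (ω-rotate s cs d (Supp-rf s cs (ht f 0≤f)) (Supp-rf s cs (ht' g 0≤g))))
          (sym (cong₂ (ω (s ∷ cs)) (Rv-· s t f) (Rv-· s t' g))))
        (o f g 0≤f 0≤g))
      (All.tabulate λ {t} i f 0≤f → Supp-rotate s cs (Inv-Supp (Srt-letters D) t (rts-Inv p i) f 0≤f))
      (Srt⇒OS (Distinct-∷ʳ cs s∉ d') p D))
  Srt⇒OS {s ∷ cs} {w} (s∉ , d) p (drop D) = AllPairs-mapWith {P = λ t → ∀ f → 0≤ f → Supp cs (Rv t f)}
      (λ {t} {t'} ht ht' o f g 0≤f 0≤g → subst (0ℤ ≤_) (sym (ω-drop s cs (ht f 0≤f s s∉) (ht' g 0≤g s s∉))) (o f g 0≤f 0≤g))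
      (All.tabulate λ {t} i f 0≤f → Inv-Supp (Srt-letters D) t (rts-Inv p i) f 0≤f)
      (Srt⇒OS d p D)

  OS-drop : ∀ {s cs u} → s ∉ cs → u ⊆L cs → PR u → OS (s ∷ cs) u → OS cs u
  OS-drop {s} {cs} s∉ sub p = AllPairs-mapWith {P = λ t → ∀ f → 0≤ f → Supp cs (Rv t f)}
    (λ ht ht' o f g 0≤f 0≤g → subst (0ℤ ≤_) (ω-drop s cs (ht f 0≤f s s∉) (ht' g 0≤g s s∉)) (o f g 0≤f 0≤g))
    (All.tabulate λ {t} i → Inv-Supp sub t (rts-Inv p i))

  infixr 6 _⋆_
  _⋆_ : Word n → Root → Root
  x ⋆ (h , q) = h ++ reverse x , q

  Rv-⋆ : ∀ x t f → Rv (x ⋆ t) f ≡ iact (reverse x) (Rv t f)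
  Rv-⋆ x (h , q) f = iact-++ h (reverse x) (α q f)

  ⋆-∷ʳ : ∀ z a t → (z ∷ʳ a) ⋆ t ≡ z ⋆ (a · t)
  ⋆-∷ʳ z a (h , q) = cong (_, q) (trans (cong (h ++_) (reverse-++ z (a ∷ []))) (sym (++-assoc h (a ∷ []) (reverse z))))

  ·-⋆ : ∀ a z t → a · (z ⋆ t) ≡ (a ∷ z) ⋆ t
  ·-⋆ a z (h , q) = cong (_, q) (trans (++-assoc h (reverse z) (a ∷ [])) (cong (h ++_) (sym (unfold-reverse a z))))

  rts-++ : ∀ x y → rts (x ++ y) ≡ rts x ++ map (x ⋆_) (rts y)
  rts-++ []      y = sym (trans (map-cong (λ { (h , q) → cong (_, q) (++-identityʳ h) }) (rts y)) (map-id (rts y)))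
  rts-++ (a ∷ x) y = cong (σ a ∷_) (trans (cong (map (a ·_)) (rts-++ x y)) (trans (map-++ (a ·_) (rts x) (map (x ⋆_) (rts y)))
    (cong (map (a ·_) (rts x) ++_) (trans (sym (map-∘ (rts y))) (map-cong (·-⋆ a x) (rts y))))))

  ~-reverse-conj : ∀ {r z a} → r ∷ z ~ z ∷ʳ a → reverse z ∷ʳ r ~ a ∷ reverse z
  ~-reverse-conj {r} {z} {a} h = subst₂ _~_ (unfold-reverse r z) (reverse-++ z (a ∷ [])) (reverse-~ h)

  rf-conj : ∀ {r z a} → r ∷ z ~ z ∷ʳ a → ∀ v → rf r (iact (reverse z) v) ≋ iact (reverse z) (rf a v)
  rf-conj {r} {z} {a} h v = ≋-trans (≡⇒≋ (sym (iact-∷ʳ (reverse z) r v))) (iact-~ (~-reverse-conj h) v)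

  -- t is t' up to a nonnegative change of coordinates in the blocks.
  Fam : Root → Root → Set
  Fam t t' = Σ (Mo → Mo) λ φ → ∀ f → 0≤ f → 0≤ φ f × Rv t f ≋ Rv t' (φ f)

  findNeg : ∀ (J : Word n) z a → (Σ (Fin n) λ r → r ∈ J × NegI (z ∷ʳ a) r) ⊎ (∀ r → r ∈ J → PosI (z ∷ʳ a) r)
  findNeg []      z a = inj₂ λ r ()
  findNeg (r ∷ J) z a with sign (z ∷ʳ a) r | findNeg J z a
  ... | inj₂ ng | _ = inj₁ (r , here refl , ng)
  ... | inj₁ ps | inj₁ (q , i , ng) = inj₁ (q , there i , ng)
  ... | inj₁ ps | inj₂ h = inj₂ λ { q (here refl) → ps ; q (there i) → h q i }

  module Restriction (J : Word n) where

    Minimal : Word n → Set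
    Minimal z = ∀ r → r ∈ J → PosI z r

    record Factor (z w : Word n) : Set where
      field
        u z'    : Word n
        factor  : z ++ w ~ u ++ z'
        minimal : Minimal z'
        letters : u ⊆L J
        lengths : length u ℕ.+ length z' ≡ length z ℕ.+ length w
        roots   : Sub Fam (rts u) (map (z ⋆_) (rts w))

    -- Reads `w` letter by letter, keeping a minimal coset representative. Appending a either leaves
    -- it minimal, or z a = r z for some r in `J` by `conjugate`; then r is emitted and its root is
    -- the inversion just read.
    restrict : ∀ z w → Minimal z → Factor z w
    restrict z [] h = record { u = [] ; z' = z ; factor = ≡⇒~ (++-identityʳ z) ; minimal = h ; letters = λ _ ()
      ; lengths = sym (ℕₚ.+-identityʳ _) ; roots = stop }
    restrict z (a ∷ w) h with findNeg J z a
    ... | inj₁ (r , r∈ , ng) = record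
      { u = r ∷ F.u ; z' = F.z'
      ; factor = ~trans (≡⇒~ (sym (++-assoc z (a ∷ []) w))) (~trans (~ʳ w (~sym conj)) (~∷ r F.factor))
      ; minimal = F.minimal
      ; letters = λ { q (here refl) → r∈ ; q (there i) → F.letters q i }
      ; lengths = trans (cong suc F.lengths) (sym (ℕₚ.+-suc (length z) (length w)))
      ; roots = keep (Simple.coef (h r r∈) ng , λ f k → Simple.0≤coef (h r r∈) ng k , ≋-sym (Simple.from (h r r∈) ng f))
          (subst (Sub Fam (map (r ·_) (rts F.u))) (map-∘ (rts w))
            (Sub-remap (rts w) (r ·_) (z ⋆_) (λ t → z ⋆ (a · t)) conjugated F.roots)) }
      where
      module F = Factor (restrict z w h)
      conj : r ∷ z ~ z ∷ʳ a
      conj = conjugate (h r r∈) ng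
      conjugated : ∀ t t' → Fam t (z ⋆ t') → Fam (r · t) (z ⋆ (a · t'))
      conjugated t t' (φ , k) = φ , λ f 0≤f → proj₁ (k f 0≤f) , ≋-trans (≡⇒≋ (Rv-· r t f)) (≋-trans (rf-cong r (proj₂ (k f 0≤f)))
          (≋-trans (≡⇒≋ (cong (rf r) (Rv-⋆ z t' (φ f)))) (≋-trans (rf-conj {z = z} conj (Rv t' (φ f)))
            (≡⇒≋ (sym (trans (Rv-⋆ z (a · t') (φ f)) (cong (iact (reverse z)) (Rv-· a t' (φ f)))))))))
    ... | inj₂ h' = record
      { u = F.u ; z' = F.z'
      ; factor = ~trans (≡⇒~ (sym (++-assoc z (a ∷ []) w))) F.factor
      ; minimal = F.minimal
      ; letters = F.letters
      ; lengths = trans F.lengths (trans (cong (ℕ._+ length w) (trans (length-++ z) (ℕₚ.+-comm (length z) 1))) (sym (ℕₚ.+-suc (length z) (length w))))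
      ; roots = skip (subst (Sub Fam (rts F.u)) (trans (map-cong (⋆-∷ʳ z a) (rts w)) (map-∘ (rts w))) F.roots) }
      where
      module F = Factor (restrict (z ∷ʳ a) w h')

    Minimal-Nonneg : ∀ {z} K → (∀ r → r ∈ K → PosI z r) → ∀ {v} → Supp K v → Nonneg v → Nonneg (iact z v)
    Minimal-Nonneg {z} []      h {v} sp nn = Nonneg-resp (≋-sym (iact-0 z λ r → sp r λ ())) Nonneg-0
    Minimal-Nonneg {z} (s ∷ K) h {v} sp nn = Nonneg-resp (≋-sym (≋-trans (iact-cong z (upd-split s v)) (iact-+ z (α s (v s)) v∖s)))
      (Nonneg-+ (pos (h s (here refl)) (v s) (nn s)) (Minimal-Nonneg K (λ r i → h r (there i)) (upd-Supp s K sp) nn'))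
      where
      v∖s : V
      v∖s = upd s 𝟘 v
      nn' : Nonneg v∖s
      nn' = upd-elim s _ (subst 0≤_ (sym (upd-same s 𝟘 v)) 0≤𝟘) λ q k → subst 0≤_ (sym (upd-other 𝟘 v k)) (nn q)

    module Parabolic (w : Word n) (red : Reduced w) where
      open Factor (restrict [] w (λ r _ → σ-pos r)) public

      reduced-uz : Reduced (u ++ z')
      reduced-uz v e = subst (ℕ._≤ length v) (trans (sym lengths) (sym (length-++ u))) (red v (~trans e (~sym factor)))

      reduced : Reduced u
      reduced = Reduced-prefix u reduced-uz

      Inv⇒w : ∀ t → Inv u t → Inv w t
      Inv⇒w t i = Inv-~ (~sym factor) t (⊑-++ u z' (Reduced⇒PR reduced-uz) t i)

      -- If u⁻¹ kept the root positive, the result would be a nonnegative combination of simple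
      -- roots of `J`, which the minimal `z'` keeps positive.
      Inv⇐ : ∀ t → Inv w t → Supp J (ρ t) → Inv u t
      Inv⇐ (h , q) (p , ng) sp = p , ¬Pos⇒Neg λ ps → iact-α𝟙≢0 (h ++ w) q (Nonneg-antisym
        (Nonneg-resp (≋-sym (≋-trans (iact-~ (~ˡ h factor) (α q 𝟙)) (≡⇒≋ (trans (cong (λ z → iact z (α q 𝟙)) (sym (++-assoc h u z'))) (iact-++ (h ++ u) z' (α q 𝟙))))))
          (Minimal-Nonneg {z'} J minimal (λ r i a l → trans (cong (λ v → v r a) (iact-++ h u (α q 𝟙)))
            (trans (iact-other u (iact h (α q 𝟙)) (λ j → i (letters r j)) a) (sp r i a l))) (pos ps 𝟙 0≤𝟙)))
        (neg ng 𝟙 0≤𝟙))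

      OS-J : ∀ {cs} → OS cs w → OS cs u
      OS-J {cs} os = Sub-AllPairs
        (λ { {t} {t'} {y} {y'} (φ , k) (φ' , k') o f g 0≤f 0≤g → subst (0ℤ ≤_) (sym (ω-≋ cs (proj₂ (k f 0≤f)) (proj₂ (k' g 0≤g))))
          (o (φ f) (φ' g) (proj₁ (k f 0≤f)) (proj₁ (k' g 0≤g))) })
        (subst (Sub Fam (rts u)) (trans (map-cong (λ { (h , q) → cong (_, q) (++-identityʳ h) }) (rts w)) (map-id (rts w))) roots) os

  -- Locates the letter at which αₛ changes sign, where `conjugate` gives the exchange s x' = x' a.
  deletion : ∀ s x u → PosI x s → NegI (x ++ u) s →
    Σ (Word n) λ x' → Σ (Fin n) λ a → Σ (Word n) λ y → x ++ u ≡ x' ++ a ∷ y × PosI x' s × NegI (x' ∷ʳ a) s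
  deletion s x [] ps ng = ⊥-elim (Pos∧Neg x s ps (subst (λ z → NegI z s) (++-identityʳ x) ng))
  deletion s x (a ∷ u) ps ng with sign (x ∷ʳ a) s
  ... | inj₂ ng' = x , a , u , refl , ps , ng'
  ... | inj₁ ps' with deletion s (x ∷ʳ a) u ps' (subst (λ z → NegI z s) (sym (move x a u)) ng)
  ...   | x' , b , y , e , r = x' , b , y , trans (sym (move x a u)) e , r

  -- As s does not occur in `x`, the root x αₛ exceeds αₛ by contributions of inversions of `x`, one
  -- for each letter, on which φ is nonnegative.
  functional : ∀ s x → s ∉ x → (φ : V → ℤ) → (∀ {v w} → v ≋ w → φ v ≡ φ w) → (∀ v w → φ (v +ᵥ w) ≡ φ v + φ w) →
    (∀ t → t ∈ rts x → ∀ f → 0≤ f → 0ℤ ≤ φ (Rv t f)) → ∀ f → 0≤ f → φ (α s f) ≤ φ (iact (reverse x) (α s f))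
  functional s [] s∉ φ φ-cong φ-+ h f k = ℤₚ.≤-refl
  functional s (a ∷ x) s∉ φ φ-cong φ-+ h f k = ℤₚ.≤-trans
    (subst (φ (α s f) ≤_) (sym (trans (φ-cong (rf-α f λ e → s∉ (here (sym e)))) (φ-+ (α s f) (α a (κ (m a s) f)))))
      (subst (_≤ φ (α s f) + φ (α a (κ (m a s) f))) (ℤₚ.+-identityʳ (φ (α s f)))
        (ℤₚ.+-monoʳ-≤ (φ (α s f)) (h (σ a) (here refl) (κ (m a s) f) (κ-0≤ (m a s) (width∣N a s) k)))))
    (ℤₚ.≤-trans (functional s x (λ i → s∉ (there i)) (λ v → φ (rf a v)) (λ e → φ-cong (rf-cong a e))
        (λ v w → trans (φ-cong (rf-+ a v w)) (φ-+ (rf a v) (rf a w)))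
        (λ t i g 0≤g → subst (λ v → 0ℤ ≤ φ v) (Rv-· a t g) (h (a · t) (there (∈-map⁺ (a ·_) i)) g 0≤g)) f k)
      (ℤₚ.≤-reflexive (φ-cong (≡⇒≋ (trans (sym (iact-∷ʳ (reverse x) a (α s f))) (cong (λ z → iact z (α s f)) (sym (unfold-reverse a x))))))))

  root-∈ : ∀ x a (y : Word n) → (reverse x , a) ∈ rts (x ++ a ∷ y)
  root-∈ x a y = subst ((reverse x , a) ∈_) (sym (rts-++ x (a ∷ y))) (∈-++⁺ʳ (rts x) (here refl))

  module SortStep (s : Fin n) (cs : Word n) (d : Distinct (s ∷ cs)) (u : Word n) (sub : u ⊆L (s ∷ cs))
                  (red : Reduced u) (os : OS (s ∷ cs) u) where

    supp : ∀ t → t ∈ rts u → ∀ f → 0≤ f → Supp (s ∷ cs) (Rv t f)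
    supp t i = Inv-Supp sub t (rts-Inv (Reduced⇒PR red) i)

    module Taken (x : Word n) (a : Fin n) (y : Word n) (e : u ≡ x ++ a ∷ y) (ps : PosI x s) (ng : NegI (x ∷ʳ a) s) where

      conj : s ∷ x ~ x ∷ʳ a
      conj = conjugate ps ng

      u~ : s ∷ x ++ y ~ u
      u~ = ~trans (~ʳ y conj) (≡⇒~ (trans (move x a y) (sym e)))

      len : suc (length (x ++ y)) ≡ length u
      len = trans (cong suc (length-++ x)) (trans (sym (ℕₚ.+-suc (length x) (length y))) (trans (sym (length-++ x)) (cong length (sym e))))

      reduced-s : Reduced (s ∷ x ++ y)
      reduced-s v e' = subst (ℕ._≤ length v) (sym len) (red v (~trans e' u~))

      reduced-xy : Reduced (x ++ y)
      reduced-xy = Reduced-suffix (s ∷ []) reduced-s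

      letters : (x ++ y) ⊆L (cs ∷ʳ s)
      letters b i with ∈-++⁻ x i
      ... | inj₁ j = ∈-rotate cs (sub b (subst (b ∈_) (sym e) (∈-++⁺ˡ j)))
      ... | inj₂ j = ∈-rotate cs (sub b (subst (b ∈_) (sym e) (∈-++⁺ʳ x (there j))))

      Twist : Root → Root → Set
      Twist t t' = ∀ f → 0≤ f → Supp (s ∷ cs) (Rv t' f) × Rv t f ≋ rf s (Rv t' f)

      rts-u : rts u ≡ rts x ++ (reverse x , a) ∷ map (x ⋆_) (map (a ·_) (rts y))
      rts-u = trans (cong rts e) (rts-++ x (a ∷ y))

      in-x : ∀ {t} → t ∈ rts x → t ∈ rts u
      in-x {t} i = subst (t ∈_) (sym rts-u) (∈-++⁺ˡ i)

      -- Such a root β precedes αₛ in the list, so ω(β , αₛ) ≥ 0; the opposite sign holds because s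
      -- is initial, so the neighbours of s vanish on β. Then s negates the coordinate of β at s,
      -- and positivity of s β makes it zero.
      fixed : ∀ t → t ∈ rts x → ∀ f → 0≤ f → rf s (Rv t f) ≋ Rv t f
      fixed t@(h , q) i f 0≤f = case-sign (sign (h ∷ʳ s) q)
        where
        β : V
        β = Rv t f
        g : Mo
        g = Simple.coef ps ng 𝟙
        inv-t : Inv u t
        inv-t = rts-Inv (Reduced⇒PR red) (in-x i)
        inv-x : Inv x t
        inv-x = rts-Inv (Reduced⇒PR (Reduced-prefix x (subst Reduced e red))) i
        β≥0 : Nonneg β
        β≥0 = Nonneg-PosR t (proj₁ inv-t) f 0≤f
        ω≥0 : 0ℤ ≤ ω (s ∷ cs) β (α s 𝟙)
        ω≥0 = subst (0ℤ ≤_) (ω-≋ (s ∷ cs) (≋-refl {β}) (Simple.from ps ng 𝟙))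
          (AllPairs-split (rts x) (subst (AllPairs (Om (s ∷ cs))) rts-u os) i f g 0≤f (Simple.0≤coef ps ng 0≤𝟙))
        Nl≡0 : Nl s cs β ≐ 𝟘
        Nl≡0 = ⟨𝟙⟩≡0 (Nl-0≤ s cs β≥0) (0≤-⇒≤0 (subst (0ℤ ≤_)
          (trans (ω-neg (s ∷ cs) β (α s 𝟙)) (cong -_ (ω-α s cs (proj₁ d) 𝟙 β))) ω≥0))
        case-sign : PosI (h ∷ʳ s) q ⊎ NegI (h ∷ʳ s) q → rf s β ≋ β
        case-sign (inj₂ b) = ⊥-elim (Pos∧Neg (h ++ x) q (simple-PosI (proj₁ inv-x) b ps) (proj₂ inv-x))
        case-sign (inj₁ b) = upd-elim s _ (λ p l → trans (negate p l) (trans (cong -_ (zero-s p l)) (sym (zero-s p l))))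
            λ r k p l → rf-other β p k
          where
          negate : ∀ p → p ℕ.< N → rf s β s p ≡ - β s p
          negate p l = trans (rf-Nl s cs d (supp t (in-x i) f 0≤f) p l) (trans (cong (_- β s p) (Nl≡0 p l)) (ℤₚ.+-identityˡ _))
          zero-s : β s ≐ 𝟘
          zero-s = 0≤-antisym (β≥0 s) λ p l → subst (0ℤ ≤_) (trans (cong (λ v → v s p) (Rv-· s t f)) (negate p l))
            (pos b f 0≤f s p l)

      -- By `fixed`, the inversions of `x ++ y` are in order the images under s of those of `u` with
      -- αₛ removed, so `ω-rotate` transports the condition.
      os-xy : OS (cs ∷ʳ s) (x ++ y)
      os-xy = Sub-AllPairs {R = Twist}
        (λ k k' o f g 0≤f 0≤g → subst (0ℤ ≤_) (trans (sym (ω-rotate s cs d (proj₁ (k f 0≤f)) (proj₁ (k' g 0≤g))))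
            (sym (ω-≋ (cs ∷ʳ s) (proj₂ (k f 0≤f)) (proj₂ (k' g 0≤g))))) (o f g 0≤f 0≤g))
        (subst₂ (Sub Twist) (sym (rts-++ x y)) (sym rts-u)
          (Sub-++ {R = Twist} (All.tabulate λ {t} i f 0≤f → supp t (in-x i) f 0≤f , ≋-sym (fixed t i f 0≤f))
            (skip (subst (Sub Twist (map (x ⋆_) (rts y))) (map-∘ (rts y))
              (Sub-mapʳ (x ⋆_) (λ t → x ⋆ (a · t)) (rts y) twisted)))))
        os
        where
        twisted : ∀ t → t ∈ rts y → Twist (x ⋆ t) (x ⋆ (a · t))
        twisted t i f 0≤f = supp (x ⋆ (a · t)) (subst ((x ⋆ (a · t)) ∈_) (sym rts-u)
            (∈-++⁺ʳ (rts x) (there (∈-map⁺ (x ⋆_) (∈-map⁺ (a ·_) i))))) f 0≤f ,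
          ≋-trans (≡⇒≋ (Rv-⋆ x t f)) (≋-trans (≋-sym (rf-invol s _)) (rf-cong s (≋-trans (rf-conj {z = x} conj (Rv t f))
            (≡⇒≋ (sym (trans (Rv-⋆ x (a · t) f) (cong (iact (reverse x)) (Rv-· a t f))))))))

    -- Let `Z` be the inversion at the first occurrence of s. Its coordinate at s is 1, and the sign
    -- conditions force s to make that coordinate negative. So `Z` is αₛ, which is no inversion of
    -- `u`.
    dropped : PosI u s → s ∉ u
    dropped ps s∈ with firstOccurrence s u s∈
    ... | x , y , e , s∉x = case-sign (sign (reverse x ∷ʳ s) s)
      where
      t : Root
      t = reverse x , s
      Z : V
      Z = ρ t
      t∈ : t ∈ rts u
      t∈ = subst (λ w → t ∈ rts w) (sym e) (root-∈ x s y)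
      inv-t : Inv u t
      inv-t = rts-Inv (Reduced⇒PR red) t∈
      Zs : ∀ p → Z s p ≡ 1ℤ
      Zs p = trans (iact-other (reverse x) (α s 𝟙) (∉-reverse s∉x) p) (α-same s 𝟙 p)
      Z≥0 : Nonneg Z
      Z≥0 = pos (proj₁ inv-t) 𝟙 0≤𝟙
      φ : V → ℤ
      φ v = ω (s ∷ cs) v Z
      φ≥0 : ∀ t' → t' ∈ rts x → ∀ f → 0≤ f → 0ℤ ≤ φ (Rv t' f)
      φ≥0 t' i f 0≤f = AllPairs-split (rts x) (subst (AllPairs (Om (s ∷ cs))) (trans (cong rts e) (rts-++ x (s ∷ y))) os) i f 𝟙 0≤f 0≤𝟙
      -- 0 = ω(Z , Z) ≥ ω(αₛ , Z) = ⟨𝟙 , Nl Z⟩ ≥ 0.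
      Nl≡0 : Nl s cs Z ≐ 𝟘
      Nl≡0 = ⟨𝟙⟩≡0 (Nl-0≤ s cs Z≥0) (subst₂ _≤_ (ω-α s cs (proj₁ d) 𝟙 Z) (ℤₚ.+-inverseʳ (E (s ∷ cs) Z Z))
        (functional s x s∉x φ (λ h → ω-≋ (s ∷ cs) h (≋-refl {Z})) (λ v w → ω-+ˡ (s ∷ cs) v w Z) φ≥0 𝟙 0≤𝟙))
      rfZ : rf s Z s 0 ≡ - 1ℤ
      rfZ = trans (rf-Nl s cs d (supp t t∈ 𝟙 0≤𝟙) 0 N-pos) (cong₂ _-_ (Nl≡0 0 N-pos) (Zs 0))
      case-sign : PosI (reverse x ∷ʳ s) s ⊎ NegI (reverse x ∷ʳ s) s → ⊥
      case-sign (inj₁ b) = 0≰-1 {1ℤ} refl (subst (0ℤ ≤_) (trans (cong (λ v → v s 0) (Rv-· s t 𝟙)) rfZ) (pos b 𝟙 0≤𝟙 s 0 N-pos))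
      case-sign (inj₂ b) = Pos∧Neg u s ps (proj₂ (Inv-≃ u t (σ s) (simple-𝟙 (proj₁ inv-t) b) inv-t))

  -- The converse of `Srt⇒OS`, by lexicographic recursion: taking s lowers the length bound `k`,
  -- dropping it lowers the rank `ℓ`.
  sort : ∀ k ℓ cs u → length u ℕ.≤ k → length cs ≡ ℓ → Distinct cs → u ⊆L cs → Reduced u → OS cs u →
         Σ (Word n) λ u' → Srt cs u' × u' ~ u × length u' ≡ length u
  sort k ℓ [] [] hk hℓ d sub red os = [] , done , ~refl , refl
  sort k ℓ [] (a ∷ u) hk hℓ d sub red os with sub a (here refl)
  ... | ()
  sort k (suc ℓ) (s ∷ cs) u hk hℓ d sub red os with sign u s
  ... | inj₁ ps with sort k ℓ cs u hk (ℕₚ.suc-injective hℓ) (proj₂ d) sub' red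
                       (OS-drop (proj₁ d) sub' (Reduced⇒PR red) os)
    where
    sub' : u ⊆L cs
    sub' a i with sub a i
    ... | here refl = ⊥-elim (SortStep.dropped s cs d u sub red os ps i)
    ... | there j = j
  ...   | u' , D , e , l = u' , drop D , e , l
  sort k (suc ℓ) (s ∷ cs) u hk hℓ d sub red os | inj₂ ng with deletion s [] u (σ-pos s) ng
  ... | x , a , y , e , ps , ng' with k
  ...   | zero = ⊥-elim (ℕₚ.<⇒≱ (s≤s z≤n) (subst (ℕ._≤ 0) (sym T.len) hk))
    where module T = SortStep.Taken s cs d u sub red os x a y e ps ng'
  ...   | suc k' with sort k' (suc ℓ) (cs ∷ʳ s) (x ++ y) (ℕₚ.≤-pred (subst (ℕ._≤ suc k') (sym T.len) hk))
                        (trans (length-rotate s cs) hℓ) (Distinct-∷ʳ cs (proj₁ d) (proj₂ d)) T.letters T.reduced-xy T.os-xy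
    where module T = SortStep.Taken s cs d u sub red os x a y e ps ng'
  ...     | u' , D , e' , l = s ∷ u' , take D , ~trans (~∷ s e') T.u~ , trans (cong suc l) T.len
    where module T = SortStep.Taken s cs d u sub red os x a y e ps ng'

-- Meets, separation and orthogonals of sortable elements.

module Sortables {n : ℕ} (M : CoxeterMatrix n) where
  open Sorting M public

  Supp-cons : ∀ s cs {v} → Supp (s ∷ cs) v → v s ≐ 𝟘 → Supp cs v
  Supp-cons s cs {v} sp z r i with r ≟ s
  ... | yes refl = z
  ... | no h = sp r λ { (here e) → h e ; (there j) → i j }

  Srt-Supp : ∀ {cs w} → Srt cs w → ∀ t → Inv w t → Supp cs (ρ t)
  Srt-Supp D t i = Inv-Supp (Srt-letters D) t i 𝟙 0≤𝟙

  Nonneg-Inv : ∀ {w} t → Inv w t → Nonneg (ρ t)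
  Nonneg-Inv t i = Nonneg-PosR t (proj₁ i) 𝟙 0≤𝟙

  record Part (s : Fin n) (cs w : Word n) : Set where
    field
      part     : Word n
      srt      : Srt cs part
      red      : PR part
      part⊑    : part ⊑ w
      part-max : ∀ t → Inv w t → ρ t s ≐ 𝟘 → Inv part t

  -- The parabolic part is again sorted because its inversions form a subsequence of those of w.
  parabolic : ∀ {s cs w} → Distinct (s ∷ cs) → Srt (s ∷ cs) w → PR w → Part s cs w
  parabolic {s} {cs} {w} d D p = result (sort (length P.u) (length cs) cs P.u ℕₚ.≤-refl refl (proj₂ d) P.letters P.reduced
      (OS-drop (proj₁ d) P.letters (Reduced⇒PR P.reduced) (P.OS-J {s ∷ cs} (Srt⇒OS d p D))))
    where
    module P = Restriction.Parabolic cs w (PR⇒Reduced p)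
    result : (Σ (Word n) λ u' → Srt cs u' × u' ~ P.u × length u' ≡ length P.u) → Part s cs w
    result (u' , D' , e , l) = record
      { part = u' ; srt = D'
      ; red = Reduced⇒PR λ v e' → subst (ℕ._≤ length v) (sym l) (P.reduced v (~trans e' e))
      ; part⊑ = λ t i → P.Inv⇒w t (Inv-~ e t i)
      ; part-max = λ t i z → Inv-~ (~sym e) t (P.Inv⇐ t i (Supp-cons s cs (Srt-Supp D t i) z)) }

  E-· : ∀ s cs → Distinct (s ∷ cs) → ∀ i t → Supp (s ∷ cs) (ρ i) → Supp (s ∷ cs) (ρ t) →
        E (cs ∷ʳ s) (ρ (s · i)) (ρ (s · t)) ≡ E (s ∷ cs) (ρ i) (ρ t)
  E-· s cs d i t hi ht = trans (cong₂ (E (cs ∷ʳ s)) (Rv-· s i 𝟙) (Rv-· s t 𝟙)) (E-rotate s cs d hi ht)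

  E-·ˡ : ∀ s cs → Distinct (s ∷ cs) → ∀ i t → Supp (s ∷ cs) (ρ (s · i)) → Supp (s ∷ cs) (ρ t) →
         E (cs ∷ʳ s) (ρ i) (ρ (s · t)) ≡ E (s ∷ cs) (ρ (s · i)) (ρ t)
  E-·ˡ s cs d i t hi ht = trans (E-≋ (cs ∷ʳ s) (≋-sym (·-invol s i)) (≋-refl {ρ (s · t)})) (E-· s cs d (s · i) t hi ht)

  E-σˡ : ∀ s cs → s ∉ cs → ∀ t → E (s ∷ cs) (ρ (σ s)) (ρ t) ≡ ⟨ 𝟙 , ρ t s ⟩
  E-σˡ s cs s∉ t = E-αˡ s cs s∉ 𝟙 (ρ t)

  -- Reflecting back, -E(s i , αₛ) is the sum of the entries of the coordinate of `i` at s.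
  E-σʳ : ∀ s cs → Distinct (s ∷ cs) → ∀ i → Supp (s ∷ cs) (ρ (s · i)) → Nonneg (ρ i) → E (s ∷ cs) (ρ (s · i)) (α s 𝟙) ≤ 0ℤ
  E-σʳ s cs d i sp nn = 0≤-⇒≤0 (subst (0ℤ ≤_) eq (⟨⟩-0≤ (nn s) 0≤𝟙))
    where
    x : V
    x = ρ (s · i)
    lem : ∀ a b → a - b ≡ - (b - a)
    lem = solve-∀
    eq : ⟨ ρ i s , 𝟙 ⟩ ≡ - E (s ∷ cs) x (α s 𝟙)
    eq = trans (⟨⟩-cong {g = 𝟙} (λ p l → trans (sym (·-invol s i s p l)) (trans (cong (λ v → v s p) (Rv-· s (s · i) 𝟙))
          (trans (rf-Nl s cs d sp p l) (lem (Nl s cs x p) (x s p))))) ≐-refl)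
        (trans (⟨⟩-⊝ˡ (x s ⊖ Nl s cs x) 𝟙) (cong -_ (sym (E-αʳ s cs (proj₁ d) x 𝟙))))

  0<? : ∀ z → (0ℤ < z) ⊎ (z ≤ 0ℤ)
  0<? (+ zero)  = inj₂ ℤₚ.≤-refl
  0<? (+ suc k) = inj₁ (+<+ (s≤s z≤n))
  0<? -[1+ k ]  = inj₂ -≤+

  coord-zero : ∀ s cs → s ∉ cs → ∀ {w} t → Inv w t → E (s ∷ cs) (ρ (σ s)) (ρ t) ≤ 0ℤ → ρ t s ≐ 𝟘
  coord-zero s cs s∉ t i h = ⟨𝟙⟩≡0 (Nonneg-Inv t i s) (subst (_≤ 0ℤ) (E-σˡ s cs s∉ t) h)

  σ-zero : ∀ s cs → s ∉ cs → ∀ t → ρ t s ≐ 𝟘 → E (s ∷ cs) (ρ (σ s)) (ρ t) ≡ 0ℤ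
  σ-zero s cs s∉ t h = trans (E-σˡ s cs s∉ t) (⟨⟩-𝟘ʳ 𝟙 h)

  no-σ : ∀ {s w} → PosI w s → ¬ Inv w (σ s)
  no-σ {s} {w} ps i = Pos∧Neg w s ps (proj₂ i)

  Inv-∷-mono : ∀ {s w w'} → PosI w' s → w ⊑ w' → s ∷ w ⊑ s ∷ w'
  Inv-∷-mono {s} {w} {w'} ps h t i with Inv-∷⁻ s w t i
  ... | inj₁ ng = Inv-∷-σ s w' t ps (proj₁ i) ng
  ... | inj₂ j = Inv-∷⁺ s w' t (proj₁ i) (h (s · t) j)

  record Meet (cs x y : Word n) : Set where
    field
      meet : Word n
      srt  : Srt cs meet
      red  : PR meet
      fst⊑ : meet ⊑ x
      snd⊑ : meet ⊑ y
      both : ∀ t → Inv x t → Inv y t → Inv meet t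

  swapMeet : ∀ {cs x y} → Meet cs x y → Meet cs y x
  swapMeet m = record { meet = meet ; srt = srt ; red = red ; fst⊑ = snd⊑ ; snd⊑ = fst⊑ ; both = λ t i j → both t j i }
    where open Meet m

  dropMeet : ∀ {s cs x y} → Meet cs x y → Meet (s ∷ cs) x y
  dropMeet m = record { meet = meet ; srt = drop srt ; red = red ; fst⊑ = fst⊑ ; snd⊑ = snd⊑ ; both = both }
    where open Meet m

  partMeet : ∀ {s cs x y} → s ∉ cs → (P : Part s cs x) → Srt cs y → Meet cs (Part.part P) y → Meet (s ∷ cs) x y
  partMeet {s} s∉ P D m = record { meet = meet ; srt = drop srt ; red = red ; fst⊑ = λ t i → Part.part⊑ P t (fst⊑ t i) ; snd⊑ = snd⊑
    ; both = λ t i j → both t (Part.part-max P t i (Srt-Supp D t j s s∉)) j }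
    where open Meet m

  -- If both take s, the rotated word is used. If only one does, all inversions of the other vanish
  -- at s, so the taker may be replaced by its parabolic part. That part is not a subderivation,
  -- which is why the rank `ℓ` is carried along.
  meet : ∀ ℓ {cs x y} → length cs ≡ ℓ → Distinct cs → Srt cs x → PR x → Srt cs y → PR y → Meet cs x y
  meet ℓ l d done px Dy py = record { meet = [] ; srt = done ; red = tt ; fst⊑ = λ t i → i
    ; snd⊑ = λ t i → ⊥-elim (Inv-[] t i) ; both = λ t i j → i }
  meet ℓ l d Dx@(take _) px done py = record { meet = [] ; srt = done ; red = tt ; fst⊑ = λ t i → ⊥-elim (Inv-[] t i)
    ; snd⊑ = λ t i → i ; both = λ t i j → j }
  meet ℓ l d Dx@(drop _) px done py = record { meet = [] ; srt = done ; red = tt ; fst⊑ = λ t i → ⊥-elim (Inv-[] t i)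
    ; snd⊑ = λ t i → i ; both = λ t i j → j }
  meet ℓ l d (take {s} {cs} {x} Dx) (sx , px) (take {w = y} Dy) (sy , py) = record
    { meet = s ∷ R.meet ; srt = take R.srt ; red = ps , R.red
    ; fst⊑ = Inv-∷-mono sx R.fst⊑ ; snd⊑ = Inv-∷-mono sy R.snd⊑ ; both = both }
    where
    module R = Meet (meet ℓ (trans (length-rotate s cs) l) (Distinct-∷ʳ cs (proj₁ d) (proj₂ d)) Dx px Dy py)
    ps : PosI R.meet s
    ps = ¬Neg⇒Pos λ ng → no-σ sx (R.fst⊑ (σ s) (σ-pos s , ng))
    both : ∀ t → Inv (s ∷ x) t → Inv (s ∷ y) t → Inv (s ∷ R.meet) t
    both t i j with Inv-∷⁻ s x t i | Inv-∷⁻ s y t j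
    ... | inj₁ ng | _ = Inv-∷-σ s R.meet t ps (proj₁ i) ng
    ... | inj₂ _ | inj₁ ng = Inv-∷-σ s R.meet t ps (proj₁ i) ng
    ... | inj₂ i' | inj₂ j' = Inv-∷⁺ s R.meet t (proj₁ i) (R.both (s · t) i' j')
  meet (suc ℓ) l d (drop Dx) px (drop Dy) py = dropMeet (meet ℓ (ℕₚ.suc-injective l) (proj₂ d) Dx px Dy py)
  meet (suc ℓ) l d Dx@(take _) px (drop Dy) py =
    let P = parabolic d Dx px in partMeet (proj₁ d) P Dy (meet ℓ (ℕₚ.suc-injective l) (proj₂ d) (Part.srt P) (Part.red P) Dy py)
  meet (suc ℓ) l d (drop Dx) px Dy@(take _) py =
    let P = parabolic d Dy py in swapMeet (partMeet (proj₁ d) P Dx (meet ℓ (ℕₚ.suc-injective l) (proj₂ d) (Part.srt P) (Part.red P) Dx px))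

  Orthogonal : Word n → Root → Word n → Set
  Orthogonal cs i x = ∀ l → Inv x l → E cs (ρ i) (ρ l) ≤ 0ℤ

  Separation : Word n → Word n → Word n → Root → Set
  Separation cs v x t = Σ Root λ i → Inv v i × (0ℤ < E cs (ρ i) (ρ t)) × Orthogonal cs i x

  -- Inversions of `x` vanish at s. So αₛ separates if E(αₛ , t) > 0; otherwise `t` vanishes at s as
  -- well and everything takes place in the parabolic part of `s ∷ v`.
  separatePart : ∀ {s cs v x} → Distinct (s ∷ cs) → Srt (s ∷ cs) (s ∷ v) → PR (s ∷ v) → Srt cs x → x ⊑ s ∷ v →
    ∀ t → Inv (s ∷ v) t →
    ((P : Part s cs (s ∷ v)) → x ⊑ Part.part P → Inv (Part.part P) t → Separation cs (Part.part P) x t) →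
    Separation (s ∷ cs) (s ∷ v) x t
  separatePart {s} {cs} {v} {x} d Dv pv Dx sub t it rec with 0<? (E (s ∷ cs) (ρ (σ s)) (ρ t))
  ... | inj₁ h = σ s , (σ-pos s , Pos⇒Neg∷ (proj₁ pv)) , h ,
          λ l il → ℤₚ.≤-reflexive (σ-zero s cs (proj₁ d) l (Srt-Supp Dx l il s (proj₁ d)))
  ... | inj₂ h = result (rec P (λ l il → part-max l (sub l il) (Srt-Supp Dx l il s (proj₁ d))) (part-max t it z))
    where
    P : Part s cs (s ∷ v)
    P = parabolic d Dv pv
    open Part P
    z : ρ t s ≐ 𝟘
    z = coord-zero s cs (proj₁ d) t it h
    result : Separation cs part x t → Separation (s ∷ cs) (s ∷ v) x t
    result (i , iv , e , o) = i , part⊑ i iv , subst (0ℤ <_) (sym (E-drop s cs (ρ i) z)) e ,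
      λ l il → subst (_≤ 0ℤ) (sym (E-drop s cs (ρ i) (Srt-Supp Dx l il s (proj₁ d)))) (o l il)

  -- Thus x is determined by the inversions i of v with E(i , l) ≤ 0 for all inversions l of x.
  separate : ∀ ℓ {cs v x} → length cs ≡ ℓ → Distinct cs → Srt cs v → PR v → Srt cs x → PR x → x ⊑ v →
             ∀ t → Inv v t → ¬ Inv x t → Separation cs v x t
  separate ℓ l d done pv Dx px sub t it nt = ⊥-elim (Inv-[] t it)
  separate (suc ℓ) {s ∷ cs} {v} {x} l d (drop Dv) pv Dx px sub t it nt = go Dx px sub nt
    where
    lift : ∀ {x} → Srt cs x → Separation cs v x t → Separation (s ∷ cs) v x t
    lift D (i , iv , e , o) = i , iv , subst (0ℤ <_) (sym (E-drop s cs (ρ i) (Srt-Supp Dv t it s (proj₁ d)))) e ,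
      λ l il → subst (_≤ 0ℤ) (sym (E-drop s cs (ρ i) (Srt-Supp D l il s (proj₁ d)))) (o l il)
    go : ∀ {x} → Srt (s ∷ cs) x → PR x → x ⊑ v → ¬ Inv x t → Separation (s ∷ cs) v x t
    go done px sub nt = lift done (separate ℓ (ℕₚ.suc-injective l) (proj₂ d) Dv pv done px sub t it nt)
    go (drop Dx) px sub nt = lift Dx (separate ℓ (ℕₚ.suc-injective l) (proj₂ d) Dv pv Dx px sub t it nt)
    go (take {w = x} Dx) (ps , px) sub nt = ⊥-elim (absurd (trans (sym (α-same s 𝟙 0))
        (Srt-Supp Dv (σ s) (sub (σ s) (σ-pos s , Pos⇒Neg∷ ps)) s (proj₁ d) 0 N-pos)))
      where
      absurd : ¬ 1ℤ ≡ 0ℤ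
      absurd ()
  separate ℓ {s ∷ cs} {_} {_} l d (take {w = v} Dv) (sv , pv) (take {w = x} Dx) (sx , px) sub t it nt
    with Inv-∷⁻ s v t it
  ... | inj₁ ng = ⊥-elim (nt (Inv-∷-σ s x t sx (proj₁ it) ng))
  ... | inj₂ it' with separate ℓ (trans (length-rotate s cs) l) (Distinct-∷ʳ cs (proj₁ d) (proj₂ d)) Dv pv Dx px
                        (λ t' i' → Inv-··· s v t' (proj₁ i') (sub (s · t') (Inv-· s x t' sx i'))) (s · t) it'
                        (λ i' → nt (Inv-∷⁺ s x t (proj₁ it) i'))
  ...   | i , iv , e , o = s · i , iv' , subst (0ℤ <_) (E-·ˡ s cs d i t si (Srt-Supp (take Dv) t it)) e , o'
    where
    iv' : Inv (s ∷ v) (s · i)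
    iv' = Inv-· s v i sv iv
    si : Supp (s ∷ cs) (ρ (s · i))
    si = Srt-Supp (take Dv) (s · i) iv'
    o' : Orthogonal (s ∷ cs) (s · i) (s ∷ x)
    o' l il with Inv-∷⁻ s x l il
    ... | inj₁ ng = subst (_≤ 0ℤ) (E-≋ (s ∷ cs) (≋-refl {ρ (s · i)}) (≋-sym (simple-𝟙 (proj₁ il) ng)))
                      (E-σʳ s cs d i si (Nonneg-Inv i iv))
    ... | inj₂ il' = subst (_≤ 0ℤ) (E-·ˡ s cs d i l si (Srt-Supp (take Dx) l il)) (o (s · l) il')
  separate (suc ℓ) l d Dv@(take _) pv done px sub t it nt = separatePart d Dv pv done sub t it λ P sub' it' →
    separate ℓ (ℕₚ.suc-injective l) (proj₂ d) (Part.srt P) (Part.red P) done px sub' t it' nt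
  separate (suc ℓ) l d Dv@(take _) pv (drop Dx) px sub t it nt = separatePart d Dv pv Dx sub t it λ P sub' it' →
    separate ℓ (ℕₚ.suc-injective l) (proj₂ d) (Part.srt P) (Part.red P) Dx px sub' t it' nt

  record Perp (cs v : Word n) (i : Root) : Set where
    field
      perp  : Word n
      srt   : Srt cs perp
      red   : PR perp
      perp⊑ : perp ⊑ v
      orth  : Orthogonal cs i perp
      greatest : ∀ t → Inv v t → E cs (ρ i) (ρ t) ≤ 0ℤ → Inv perp t

  -- When the derivation takes s and `i` is αₛ, orthogonality means vanishing at s and cuts out the
  -- parabolic part. For any other `i` there, αₛ is orthogonal by `E-σʳ`, so the answer takes s and
  -- the rest comes from the rotated word.
  perpendicular : ∀ ℓ {cs v} → length cs ≡ ℓ → Distinct cs → Srt cs v → PR v → ∀ i → Inv v i → Perp cs v i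
  perpendicular ℓ l d done pv i iv = ⊥-elim (Inv-[] i iv)
  perpendicular (suc ℓ) {s ∷ cs} l d (drop Dv) pv i iv = record
    { perp = perp ; srt = drop srt ; red = red ; perp⊑ = perp⊑
    ; orth = λ t it → subst (_≤ 0ℤ) (sym (eq t (perp⊑ t it))) (orth t it)
    ; greatest = λ t it h → greatest t it (subst (_≤ 0ℤ) (eq t it) h) }
    where
    open Perp (perpendicular ℓ (ℕₚ.suc-injective l) (proj₂ d) Dv pv i iv)
    eq : ∀ t → Inv _ t → E (s ∷ cs) (ρ i) (ρ t) ≡ E cs (ρ i) (ρ t)
    eq t it = E-drop s cs (ρ i) (Srt-Supp Dv t it s (proj₁ d))
  perpendicular (suc ℓ) {s ∷ cs} l d Dv@(take {w = v} D) pv@(sv , pv') i iv with Inv-∷⁻ s v i iv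
  ... | inj₁ ng = record
    { perp = part ; srt = drop srt ; red = red ; perp⊑ = part⊑
    ; orth = λ t it → ℤₚ.≤-reflexive (trans (eq t) (σ-zero s cs (proj₁ d) t (Srt-Supp srt t it s (proj₁ d))))
    ; greatest = λ t it h → part-max t it (coord-zero s cs (proj₁ d) t it (subst (_≤ 0ℤ) (eq t) h)) }
    where
    open Part (parabolic d Dv pv)
    eq : ∀ t → E (s ∷ cs) (ρ i) (ρ t) ≡ E (s ∷ cs) (ρ (σ s)) (ρ t)
    eq t = E-≋ (s ∷ cs) (simple-𝟙 (proj₁ iv) ng) (≋-refl {ρ t})
  ... | inj₂ iv' = record
    { perp = s ∷ R.perp ; srt = take R.srt ; red = ps , R.red
    ; perp⊑ = below ; orth = orth' ; greatest = greatest' }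
    where
    module R = Perp (perpendicular (suc ℓ) (trans (length-rotate s cs) l) (Distinct-∷ʳ cs (proj₁ d) (proj₂ d)) D pv' (s · i) iv')
    ps : PosI R.perp s
    ps = ¬Neg⇒Pos λ ng → no-σ sv (R.perp⊑ (σ s) (σ-pos s , ng))
    below : s ∷ R.perp ⊑ s ∷ v
    below = Inv-∷-mono sv R.perp⊑
    si : Supp (s ∷ cs) (ρ i)
    si = Srt-Supp Dv i iv
    orth' : Orthogonal (s ∷ cs) i (s ∷ R.perp)
    orth' t it with Inv-∷⁻ s R.perp t it
    ... | inj₁ ng = subst (_≤ 0ℤ) (E-≋ (s ∷ cs) (·-invol s i) (≋-sym (simple-𝟙 (proj₁ it) ng)))
            (E-σʳ s cs d (s · i) (λ r h p q → trans (·-invol s i r p q) (si r h p q)) (Nonneg-Inv (s · i) iv'))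
    ... | inj₂ it' = subst (_≤ 0ℤ) (E-· s cs d i t si (Srt-Supp Dv t (below t it))) (R.orth (s · t) it')
    greatest' : ∀ t → Inv (s ∷ v) t → E (s ∷ cs) (ρ i) (ρ t) ≤ 0ℤ → Inv (s ∷ R.perp) t
    greatest' t it h with Inv-∷⁻ s v t it
    ... | inj₁ ng = Inv-∷-σ s R.perp t ps (proj₁ it) ng
    ... | inj₂ it' = Inv-∷⁺ s R.perp t (proj₁ it) (R.greatest (s · t) it'
            (subst (_≤ 0ℤ) (sym (E-· s cs d i t si (Srt-Supp Dv t it))) h))

  -- Rotation leads to a simple root, where the value is ⟨𝟙 , 𝟙⟩ = N.
  E-diagonal : ∀ {cs v} → Distinct cs → Srt cs v → PR v → ∀ t → Inv v t → 0ℤ < E cs (ρ t) (ρ t)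
  E-diagonal d done pv t it = ⊥-elim (Inv-[] t it)
  E-diagonal {s ∷ cs} d (drop D) pv t it = subst (0ℤ <_) (sym (E-drop s cs (ρ t) (Srt-Supp D t it s (proj₁ d)))) (E-diagonal (proj₂ d) D pv t it)
  E-diagonal {s ∷ cs} d Dv@(take {w = v} D) (sv , pv) t it with Inv-∷⁻ s v t it
  ... | inj₁ ng = subst (0ℤ <_) (sym (trans (E-≋ (s ∷ cs) e e) (trans (E-σˡ s cs (proj₁ d) (σ s))
          (trans (⟨⟩-cong {𝟙} ≐-refl λ p _ → α-same s 𝟙 p) (⟨𝟙,𝟙⟩ N))))) (+<+ N-pos)
    where
    e : ρ t ≋ α s 𝟙
    e = simple-𝟙 (proj₁ it) ng
  ... | inj₂ it' = subst (0ℤ <_) (E-· s cs d t t (Srt-Supp Dv t it) (Srt-Supp Dv t it))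
          (E-diagonal (Distinct-∷ʳ cs (proj₁ d) (proj₂ d)) D pv (s · t) it')

  E-ordered : ∀ {cs v} → Distinct cs → Srt cs v → PR v → AllPairs (λ t t' → E cs (ρ t') (ρ t) ≤ 0ℤ) (rts v)
  E-ordered d done pv = []
  E-ordered {s ∷ cs} {v} d (drop D) pv = AllPairs-mapWith {P = Inv v}
    (λ {t} {t'} it it' h → subst (_≤ 0ℤ) (sym (E-drop s cs (ρ t') (Srt-Supp D t it s (proj₁ d)))) h)
    (All.tabulate (rts-Inv pv)) (E-ordered (proj₂ d) D pv)
  E-ordered {s ∷ cs} d Dv@(take {w = v} D) (sv , pv) =
    Allₚ.map⁺ (All.tabulate λ {t} i → E-σʳ s cs d t (supp t (rts-Inv pv i)) (Nonneg-Inv t (rts-Inv pv i))) ∷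
    AllPairsₚ.map⁺ (AllPairs-mapWith {P = Inv v}
      (λ {t} {t'} it it' h → subst (_≤ 0ℤ) (trans (E-≋ (cs ∷ʳ s) (≋-refl {ρ t'}) (≋-sym (·-invol s t))) (E-·ˡ s cs d t' (s · t) (supp t' it') (supp t it))) h)
      (All.tabulate (rts-Inv pv)) (E-ordered (Distinct-∷ʳ cs (proj₁ d) (proj₂ d)) D pv))
    where
    supp : ∀ t → Inv v t → Supp (s ∷ cs) (ρ (s · t))
    supp t it = Srt-Supp Dv (s · t) (Inv-· s v t sv it)

-- Sorting words as subwords of γ^∞.

Distinct-map : ∀ {n} {A : Set} (f : A → Fin n) xs → AllPairs (λ x y → f x ≢ f y) xs → Distinct (map f xs)
Distinct-map f []       []       = tt
Distinct-map f (x ∷ xs) (r ∷ rs) = (λ i → go (∈-map⁻ f i)) , Distinct-map f xs rs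
  where
  go : ¬ (Σ _ λ y → y ∈ xs × f x ≡ f y)
  go (y , i , e) = All.lookup r i e

AllPairs-lookup : ∀ {A : Set} {R : A → A → Set} {xs : List A} → AllPairs R xs → ∀ i j → i Fin.< j → R (lookup xs i) (lookup xs j)
AllPairs-lookup {xs = x ∷ xs} (r ∷ rs) fzero    (fsuc j) _       = All.lookup r (∈-lookup j)
AllPairs-lookup {xs = x ∷ xs} (r ∷ rs) (fsuc i) (fsuc j) (s≤s l) = AllPairs-lookup rs i j l

module Subwords {n : ℕ} (M : CoxeterMatrix n) (c : Fin n → Fin n) (c-inj : Injective _≡_ _≡_ c) where
  open Sortables M public
  open import Data.List.Membership.DecPropositional (_≟_ {n}) using (_∈?_)

  -- At the first occurrence of a letter a outside `cs`, the corresponding inversion has coordinate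
  -- 1 at a, while all inversions of `w` are supported on `cs`.
  reduced-letters : ∀ {cs w w'} → w ⊆L cs → w' ~ w → Reduced w' → w' ⊆L cs
  reduced-letters {cs} {w} {w'} sub e red a i with a ∈? cs
  ... | yes k = k
  ... | no k with firstOccurrence a w' i
  ...   | x , y , refl , a∉x = ⊥-elim (absurd (trans (sym (trans (iact-other (reverse x) (α a 𝟙) (∉-reverse a∉x) 0) (α-same a 𝟙 0)))
            (Inv-Supp sub t (Inv-~ e t (rts-Inv (Reduced⇒PR red) (root-∈ x a y))) 𝟙 0≤𝟙 a k 0 N-pos)))
    where
    t : Root
    t = reverse x , a
    absurd : ¬ 1ℤ ≡ 0ℤ
    absurd ()

  next : Pos → Pos
  next (k , i) = suc k , i

  <P-trans : ∀ {p q r} → p <P q → q <P r → p <P r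
  <P-trans (inj₁ a) (inj₁ b) = inj₁ (ℕₚ.<-trans a b)
  <P-trans (inj₁ a) (inj₂ (refl , _)) = inj₁ a
  <P-trans (inj₂ (refl , _)) (inj₁ b) = inj₁ b
  <P-trans (inj₂ (refl , a)) (inj₂ (refl , b)) = inj₂ (refl , ℕₚ.<-trans a b)

  <P-irrefl : ∀ {p} → ¬ p <P p
  <P-irrefl (inj₁ a) = ℕₚ.<-irrefl refl a
  <P-irrefl (inj₂ (_ , a)) = ℕₚ.<-irrefl refl a

  _⊴_ : Pos → Pos → Set
  p ⊴ q = proj₂ p ≡ proj₂ q × proj₁ p ℕ.≤ proj₁ q

  <P-⊴ : ∀ {p q r} → p <P q → q ⊴ r → p <P r
  <P-⊴ (inj₁ a) (_ , l) = inj₁ (ℕₚ.<-≤-trans a l)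
  <P-⊴ {p} {q} {r} (inj₂ (refl , a)) (refl , l) with ℕₚ.m≤n⇒m<n∨m≡n l
  ... | inj₁ l' = inj₁ l'
  ... | inj₂ refl = inj₂ (refl , a)

  ⊴⇒ : ∀ {p q} → p ⊴ q → p ≡ q ⊎ p <P q
  ⊴⇒ (refl , l) with ℕₚ.m≤n⇒m<n∨m≡n l
  ... | inj₁ l' = inj₂ (inj₁ l')
  ... | inj₂ refl = inj₁ refl

  _≟P_ : (p q : Pos) → Dec (p ≡ q)
  _≟P_ = ≡-dec ℕ._≟_ _≟_

  -- As Srt, but with positions in γ^∞ in place of letters: pend lists the next available position
  -- of each letter not yet dropped.
  data SrtP : List Pos → List Pos → Set where
    done : ∀ {pend} → SrtP pend []
    take : ∀ {p pend ps} → SrtP (pend ∷ʳ next p) ps → SrtP (p ∷ pend) (p ∷ ps)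
    drop : ∀ {p pend ps} → SrtP pend ps → SrtP (p ∷ pend) ps

  letters-∷ʳ : ∀ p pend → map (letter c) (pend ∷ʳ next p) ≡ map (letter c) pend ∷ʳ letter c p
  letters-∷ʳ p pend = map-++ (letter c) pend (next p ∷ [])

  SrtP⇒Srt : ∀ {pend ps} → SrtP pend ps → Srt (map (letter c) pend) (map (letter c) ps)
  SrtP⇒Srt done = done
  SrtP⇒Srt (take {p} {pend} {ps} D) = take (subst (λ z → Srt z (map (letter c) ps)) (letters-∷ʳ p pend) (SrtP⇒Srt D))
  SrtP⇒Srt (drop D) = drop (SrtP⇒Srt D)

  Srt⇒SrtP : ∀ {cs w} → Srt cs w → ∀ pend → cs ≡ map (letter c) pend → Σ (List Pos) λ ps → SrtP pend ps × map (letter c) ps ≡ w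
  Srt⇒SrtP done pend e = [] , done , refl
  Srt⇒SrtP (take D) (p ∷ pend) refl with Srt⇒SrtP D (pend ∷ʳ next p) (sym (letters-∷ʳ p pend))
  ... | ps , D' , refl = p ∷ ps , take D' , refl
  Srt⇒SrtP (drop D) (p ∷ pend) refl with Srt⇒SrtP D pend refl
  ... | ps , D' , e = ps , drop D' , e

  Reach : List Pos → Pos → Set
  Reach pend q = Σ Pos λ p → p ∈ pend × p ⊴ q

  -- The pending positions fit into one period of γ^∞, so moving the first one to its next copy at
  -- the end keeps the list increasing.
  record Window (pend : List Pos) : Set where
    field
      increasing : Increasing pend
      period     : ∀ {p q} → p ∈ pend → q ∈ pend → p <P next q
  open Window

  next-mono : ∀ {p q} → p <P q → next p <P next q
  next-mono (inj₁ a) = inj₁ (s≤s a)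
  next-mono (inj₂ (refl , a)) = inj₂ (refl , a)

  Window-tail : ∀ {p pend} → Window (p ∷ pend) → Window pend
  Window-tail W with increasing W
  ... | _ ∷ inc = record { increasing = inc ; period = λ i j → period W (there i) (there j) }

  Window-head : ∀ {p pend q} → Window (p ∷ pend) → q ∈ pend → p <P q
  Window-head W i with increasing W
  ... | h ∷ _ = All.lookup h i

  Window-∷ʳ : ∀ {p pend} → Window (p ∷ pend) → Window (pend ∷ʳ next p)
  Window-∷ʳ {p} {pend} W = record
    { increasing = AllPairsₚ.++⁺ (increasing (Window-tail W)) ([] ∷ []) (All.tabulate λ i → period W (there i) (here refl) ∷ [])
    ; period = λ i j → per (∈-++⁻ pend i) (∈-++⁻ pend j) }
    where
    per : ∀ {q r} → q ∈ pend ⊎ q ∈ next p ∷ [] → r ∈ pend ⊎ r ∈ next p ∷ [] → q <P next r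
    per (inj₁ i) (inj₁ j) = period W (there i) (there j)
    per (inj₁ i) (inj₂ (here refl)) = <P-trans {q = next p} (period W (there i) (here refl)) (inj₁ (ℕₚ.n<1+n _))
    per {r = r} (inj₂ (here refl)) (inj₁ j) = next-mono {p} {r} (Window-head W j)
    per (inj₂ (here refl)) (inj₂ (here refl)) = inj₁ (ℕₚ.n<1+n _)

  new-above : ∀ {p pend q} → Window (p ∷ pend) → q ∈ pend ∷ʳ next p → p <P q
  new-above {p} {pend} W i with ∈-++⁻ pend i
  ... | inj₁ j = Window-head W j
  ... | inj₂ (here refl) = inj₁ (ℕₚ.n<1+n _)

  head-least : ∀ {p pend q} → Window (p ∷ pend) → Reach (p ∷ pend) q → p ≡ q ⊎ p <P q
  head-least W (_ , here refl , l) = ⊴⇒ l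
  head-least {p} {pend} {q} W (r , there i , l) = inj₂ (<P-⊴ {p} {r} {q} (Window-head W i) l)

  SrtP-reach : ∀ {pend ps} → SrtP pend ps → ∀ {q} → q ∈ ps → Reach pend q
  SrtP-reach (take D) (here refl) = _ , here refl , refl , ℕₚ.≤-refl
  SrtP-reach (take {pend = pend} D) (there i) with SrtP-reach D i
  ... | r , j , l with ∈-++⁻ pend j
  ...   | inj₁ k = r , there k , l
  ...   | inj₂ (here refl) = _ , here refl , proj₁ l , ℕₚ.≤-trans (ℕₚ.n≤1+n _) (proj₂ l)
  SrtP-reach (drop D) i with SrtP-reach D i
  ... | r , j , l = r , there j , l

  SrtP-increasing : ∀ {pend ps} → Window pend → SrtP pend ps → Increasing ps
  SrtP-increasing W done = []
  SrtP-increasing W (take {p} {pend} D) = All.tabulate (λ {q} i → lem q (SrtP-reach D i)) ∷ SrtP-increasing (Window-∷ʳ W) D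
    where
    lem : ∀ q → Reach (pend ∷ʳ next p) q → p <P q
    lem q (r , j , l) = <P-⊴ {p} {r} {q} (new-above W j) l
  SrtP-increasing W (drop D) = SrtP-increasing (Window-tail W) D

  SrtP-blocks : ∀ {pend ps} → SrtP pend ps → ∀ {k i} → (suc k , i) ∈ ps → (suc k , i) ∈ pend ⊎ (k , i) ∈ ps
  SrtP-blocks (take D) (here e) = inj₁ (here e)
  SrtP-blocks (take {pend = pend} D) (there i) with SrtP-blocks D i
  ... | inj₂ k = inj₂ (there k)
  ... | inj₁ k with ∈-++⁻ pend k
  ...   | inj₁ j = inj₁ (there j)
  ...   | inj₂ (here refl) = inj₂ (here refl)
  SrtP-blocks (drop D) i with SrtP-blocks D i
  ... | inj₁ k = inj₁ (there k)
  ... | inj₂ k = inj₂ k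

  -- A taken position is the least one reachable, so a competitor starts there or later. The letter
  -- of a dropped position does not occur in the element, hence by `reduced-letters` in no
  -- competitor.
  SrtP-least : ∀ {pend ps} → Window pend → Distinct (map (letter c) pend) → SrtP pend ps → PR (map (letter c) ps) →
    ∀ qs → Increasing qs → (∀ {q} → q ∈ qs → Reach pend q) → map (letter c) qs ~ map (letter c) ps →
    Reduced (map (letter c) qs) → LexLe ps qs
  SrtP-least W d done p [] inc rch e red = lex-[]
  SrtP-least W d done p (q ∷ qs) inc rch e red with red [] (~sym e)
  ... | ()
  SrtP-least W d (take D) p [] inc rch e red with PR⇒Reduced p [] e
  ... | ()
  SrtP-least W d (take {p₁} {pend} D) (ps , p) (q ∷ qs) (h ∷ inc) rch e red with p₁ ≟P q
  ... | yes refl = lex-≡ (SrtP-least (Window-∷ʳ W) (subst Distinct (sym (letters-∷ʳ p₁ pend)) (Distinct-∷ʳ _ (proj₁ d) (proj₂ d)))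
          D p qs inc (λ {q'} i → rch' q' i (rch (there i))) (~cancelˡ (letter c p₁ ∷ []) e) (Reduced-suffix (letter c p₁ ∷ []) red))
    where
    rch' : ∀ q' → q' ∈ qs → Reach (p₁ ∷ pend) q' → Reach (pend ∷ʳ next p₁) q'
    rch' q' i (r , there j , l) = r , ∈-++⁺ˡ j , l
    rch' q' i (r , here refl , (refl , l)) with All.lookup h i
    ... | inj₁ l' = next p₁ , ∈-++⁺ʳ pend (here refl) , refl , l'
    ... | inj₂ (_ , l') = ⊥-elim (ℕₚ.<-irrefl refl l')
  ... | no ne with head-least W (rch (here refl))
  ...   | inj₁ e' = ⊥-elim (ne e')
  ...   | inj₂ l = lex-< l
  SrtP-least W d (drop {p₁} {pend} {ps} D) p qs inc rch e red =
    SrtP-least (Window-tail W) (proj₂ d) D p qs inc (λ {q} i → rch' q i (rch i)) e red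
    where
    rch' : ∀ q → q ∈ qs → Reach (p₁ ∷ pend) q → Reach pend q
    rch' q i (r , there j , l) = r , j , l
    rch' q i (r , here refl , (refl , _)) = ⊥-elim (proj₁ d
      (reduced-letters (Srt-letters (SrtP⇒Srt D)) e red (letter c q) (∈-map⁺ (letter c) i)))

  -- The bounds `a` and `b` serve termination. If `ps` does not start at the first pending position,
  -- it starts later; that position is then missed for good, and with it all its later copies, as
  -- each position must be pending or have its previous copy in `ps`.
  build : ∀ a b ps pend → length ps ℕ.≤ a → length pend ℕ.≤ b → Window pend → Increasing ps →
    (∀ {q} → q ∈ ps → q ∈ pend ⊎ (Σ ℕ λ k → proj₁ q ≡ suc k × (k , proj₂ q) ∈ ps)) → SrtP pend ps
  reachable : ∀ {ps pend} →
    (∀ {q} → q ∈ ps → q ∈ pend ⊎ (Σ ℕ λ k → proj₁ q ≡ suc k × (k , proj₂ q) ∈ ps)) → ∀ k i → (k , i) ∈ ps → Reach pend (k , i)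
  reachable h k i m with h m
  ... | inj₁ j = (k , i) , j , refl , ℕₚ.≤-refl
  reachable h (suc k) i m | inj₂ (k , refl , m') with reachable h k i m'
  ... | p , j , e , l = p , j , e , ℕₚ.≤-trans l (ℕₚ.n≤1+n k)
  build a b [] pend la lb W inc h = done
  build a b (q ∷ qs) [] la lb W inc h with reachable h _ _ (here refl)
  ... | _ , () , _
  build a (suc b) (q ∷ qs) (p ∷ pend) la (s≤s lb) W (hq ∷ inc) h with p ≟P q
  build a (suc b) (q ∷ qs) (p ∷ pend) la (s≤s lb) W (hq ∷ inc) h | yes refl with a | la
  ... | suc a' | s≤s la' = take (build a' (suc b) qs (pend ∷ʳ next p) la' (subst (ℕ._≤ suc b) (sym (trans (length-++ pend) (ℕₚ.+-comm (length pend) 1))) (s≤s lb)) (Window-∷ʳ W) inc h')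
    where
    h' : ∀ {q'} → q' ∈ qs → q' ∈ pend ∷ʳ next p ⊎ (Σ ℕ λ k → proj₁ q' ≡ suc k × (k , proj₂ q') ∈ qs)
    h' i with h (there i)
    ... | inj₁ (here refl) = ⊥-elim (<P-irrefl {p} (All.lookup hq i))
    ... | inj₁ (there j) = inj₁ (∈-++⁺ˡ j)
    ... | inj₂ (k , refl , here refl) = inj₁ (∈-++⁺ʳ pend (here refl))
    ... | inj₂ (k , e , there m) = inj₂ (k , e , m)
  build a (suc b) (q ∷ qs) (p ∷ pend) la (s≤s lb) W (hq ∷ inc) h | no ne = drop (build a b (q ∷ qs) pend la lb (Window-tail W) (hq ∷ inc) h')
    where
    p<q : p <P q
    p<q with head-least W (reachable h _ _ (here refl))
    ... | inj₁ e = ⊥-elim (ne e)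
    ... | inj₂ l = l
    h' : ∀ {q'} → q' ∈ q ∷ qs → q' ∈ pend ⊎ (Σ ℕ λ k → proj₁ q' ≡ suc k × (k , proj₂ q') ∈ q ∷ qs)
    h' i with h i
    h' (here e)  | inj₁ (here refl) = ⊥-elim (ne e)
    h' (there i) | inj₁ (here refl) = ⊥-elim (<P-irrefl {q} (<P-trans {q} {p} {q} (All.lookup hq i) p<q))
    ... | inj₁ (there j) = inj₁ j
    ... | inj₂ r = inj₂ r

  first : List Pos
  first = map (0 ,_) (allFin n)

  first-letters : map (letter c) first ≡ cword c
  first-letters = sym (map-∘ (allFin n))

  first-block : ∀ {p} → p ∈ first → proj₁ p ≡ 0
  first-block i with ∈-map⁻ (0 ,_) i
  ... | _ , _ , refl = refl

  first-window : Window first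
  first-window = record
    { increasing = AllPairsₚ.map⁺ (AllPairsₚ.tabulate⁺-< λ l → inj₂ (refl , l))
    ; period = λ {p} i j → inj₁ (subst (ℕ._< suc _) (sym (first-block i)) (s≤s z≤n)) }

  cword-distinct : Distinct (cword c)
  cword-distinct = Distinct-map c (allFin n) (AllPairsₚ.tabulate⁺-< λ {i} {j} l e → ℕₚ.<-irrefl (cong toℕ (c-inj e)) l)

  first-reach : ∀ q → Reach first q
  first-reach (k , i) = (0 , i) , ∈-map⁺ (0 ,_) (∈-allFin i) , refl , z≤n

  Srt⇒Sortable : ∀ {w x} → Srt (cword c) w → PR w → w ~ x → Sortable c x
  Srt⇒Sortable D p e with Srt⇒SrtP D first (sym first-letters)
  ... | ps , D' , refl = ps , (SrtP-increasing first-window D' , e , PR⇒Reduced p ,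
          λ qs inc e' red → SrtP-least first-window (subst Distinct (sym first-letters) cword-distinct) D' p qs inc
            (λ {q} _ → first-reach q) (~trans e' (~sym e)) red) ,
        λ k s (i , m , e') → i , blocks k i (SrtP-blocks D' m) , e'
    where
    blocks : ∀ {ps} k i → (suc k , i) ∈ first ⊎ (k , i) ∈ ps → (k , i) ∈ ps
    blocks k i (inj₂ m) = m
    blocks k i (inj₁ m) with first-block m
    ... | ()

  Sortable⇒Srt : ∀ {x} → Sortable c x → Σ (Word n) λ w → Srt (cword c) w × PR w × w ~ x
  Sortable⇒Srt (ps , (inc , e , red , _) , blocks) = map (letter c) ps ,
      subst (λ z → Srt z (map (letter c) ps)) first-letters (SrtP⇒Srt (build (length ps) (length first) ps first ℕₚ.≤-refl ℕₚ.≤-refl first-window inc cond)) , Reduced⇒PR red , e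
    where
    cond : ∀ {q} → q ∈ ps → q ∈ first ⊎ (Σ ℕ λ k → proj₁ q ≡ suc k × (k , proj₂ q) ∈ ps)
    cond {zero , i} m = inj₁ (∈-map⁺ (0 ,_) (∈-allFin i))
    cond {suc k , i} m with blocks k (c i) (i , m , refl)
    ... | j , m' , e' = inj₂ (k , refl , subst (λ z → (k , z) ∈ ps) (c-inj e') m')

-- Intervals of the Cambrian semilattice as lattices of closed sets.

module CambrianInterval {n : ℕ} (M : CoxeterMatrix n) (c : Fin n → Fin n) (c-inj : Injective _≡_ _≡_ c)
  (u v : Word n) (su : Coxeter.Sortable M c u) (sv : Coxeter.Sortable M c v) (u≤v : Coxeter.WeakLe M u v) where
  open Subwords M c c-inj

  I : Set
  I = Interval c u v

  C : Word n
  C = cword c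

  record Sorted (x : Word n) : Set where
    field
      word : Word n
      srt  : Srt C word
      red  : PR word
      rep  : word ~ x

  sorted : ∀ {x} → Sortable c x → Sorted x
  sorted s with Sortable⇒Srt s
  ... | w , D , p , e = record { word = w ; srt = D ; red = p ; rep = e }

  sortedI : (x : I) → Sorted (proj₁ x)
  sortedI (x , s , _) = sorted s

  module V̂ = Sorted (sorted sv)

  roots : List Root
  roots = rts V̂.word

  K : ℕ
  K = length roots

  root : Fin K → Root
  root = lookup roots

  root-Inv : ∀ i → Inv V̂.word (root i)
  root-Inv i = rts-Inv V̂.red (∈-lookup i)

  position : ∀ t → Inv V̂.word t → Σ (Fin K) λ i → t ≃ root i
  position t i with Inv-rts V̂.word t i
  ... | t' , m , e = Any.index m , subst (t ≃_) (lookup-index m) e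

  X : I → Fin K → Set
  X x i = Inv (proj₁ x) (root i)

  ar : Fin K → Fin K → Set
  ar j i = 0ℤ < E C (ρ (root i)) (ρ (root j))

  ar? : ∀ j i → Dec (ar j i)
  ar? j i = 0ℤ ℤₚ.<? E C (ρ (root i)) (ρ (root j))

  below-v : (x : I) → proj₁ x ⊑ V̂.word
  below-v (x , _ , _ , x≤v) t i = Inv-~ (~sym V̂.rep) t (WeakLe⇒⊑ x≤v t i)

  above-u : (x : I) → u ⊑ proj₁ x
  above-u (x , _ , u≤x , _) = WeakLe⇒⊑ u≤x

  X⇒⊑ : ∀ {x y} → (∀ i → X x i → X y i) → proj₁ x ⊑ proj₁ y
  X⇒⊑ {x} {y} h t it with position t (below-v x t it)
  ... | i , e = Inv-≃ (proj₁ y) (root i) t (≋-sym e) (h i (Inv-≃ (proj₁ x) t (root i) e it))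

  element : ∀ w → Srt C w → PR w → u ⊑ w → w ⊑ V̂.word → I
  element w D p h k = w , Srt⇒Sortable D p ~refl , ⊑⇒WeakLe h , ⊑⇒WeakLe λ t i → Inv-~ V̂.rep t (k t i)

  orthogonal : (x : I) (i : Fin K) (t : Root) → t ≃ root i → Orthogonal C t (Sorted.word (sortedI x)) → ∀ l → X x l → ¬ ar l i
  orthogonal x i t e o l p a = ℤₚ.≤⇒≯ (subst (_≤ 0ℤ) (E-≋ C e (≋-refl {ρ (root l)})) (o (root l) (Inv-~ (~sym (Sorted.rep (sortedI x))) (root l) p))) a

  sep : ∀ x j → ¬ X x j → Σ (Fin K) λ i → ar j i × (∀ l → X x l → ¬ ar l i)
  sep x j np with separate (length C) refl cword-distinct V̂.srt V̂.red (Sorted.srt (sortedI x)) (Sorted.red (sortedI x))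
      (λ t i → below-v x t (Inv-~ (Sorted.rep (sortedI x)) t i)) (root j) (root-Inv j) (λ i → np (Inv-~ (Sorted.rep (sortedI x)) (root j) i))
  ... | t , it , h , o with position t it
  ...   | i , e = i , subst (0ℤ <_) (E-≋ C e (≋-refl {ρ (root j)})) h , orthogonal x i t e o

  witness : ∀ x y → x ≤I y → ¬ y ≤I x → Σ (Fin K) λ i → X y i × (∀ l → X x l → ¬ ar l i)
  witness x y x≤y ny with Finₚ.any? (λ l → Inv? (proj₁ y) (root l) ×-dec ¬? (Inv? (proj₁ x) (root l)))
  ... | no h = ⊥-elim (ny (⊑⇒WeakLe (X⇒⊑ {y} {x} sub)))
    where
    sub : ∀ l → X y l → X x l
    sub l p with Inv? (proj₁ x) (root l)
    ... | yes q = q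
    ... | no nq = ⊥-elim (h (l , p , nq))
  ... | yes (l , p , np) with separate (length C) refl cword-distinct Ŷ.srt Ŷ.red X̂.srt X̂.red
      (λ t i → Inv-~ (~sym Ŷ.rep) t (WeakLe⇒⊑ x≤y t (Inv-~ X̂.rep t i))) (root l) (Inv-~ (~sym Ŷ.rep) (root l) p) (λ i → np (Inv-~ X̂.rep (root l) i))
    where
    module X̂ = Sorted (sortedI x)
    module Ŷ = Sorted (sortedI y)
  ...   | t , it , h , o with position t (below-v y t (Inv-~ (Sorted.rep (sortedI y)) t it))
  ...     | i , e = i , Inv-≃ (proj₁ y) t (root i) e (Inv-~ (Sorted.rep (sortedI y)) t it) , orthogonal x i t e o

  meetI : ∀ x y → Σ I λ z → (∀ i → X z i → X x i × X y i) × (∀ i → X x i → X y i → X z i)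
  meetI x y = element R.meet R.srt R.red
      (λ t i → R.both t (Inv-~ (~sym X̂.rep) t (above-u x t i)) (Inv-~ (~sym Ŷ.rep) t (above-u y t i)))
      (λ t i → below-v x t (Inv-~ X̂.rep t (R.fst⊑ t i))) ,
    (λ i p → Inv-~ X̂.rep (root i) (R.fst⊑ (root i) p) , Inv-~ Ŷ.rep (root i) (R.snd⊑ (root i) p)) ,
    λ i p q → R.both (root i) (Inv-~ (~sym X̂.rep) (root i) p) (Inv-~ (~sym Ŷ.rep) (root i) q)
    where
    module X̂ = Sorted (sortedI x)
    module Ŷ = Sorted (sortedI y)
    module R = Meet (meet (length C) refl cword-distinct X̂.srt X̂.red Ŷ.srt Ŷ.red)

  uI vI : I
  uI = u , su , ⊑⇒WeakLe (λ t i → i) , u≤v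
  vI = v , sv , u≤v , ⊑⇒WeakLe λ t i → i

  perpI : ∀ i → (∀ l → X uI l → ¬ ar l i) → Σ I λ z → (∀ j → X z j → ¬ ar j i) × (∀ j → ¬ ar j i → X z j)
  perpI i h = element R.perp R.srt R.red above R.perp⊑ ,
    (λ j p a → ℤₚ.≤⇒≯ (R.orth (root j) p) a) , λ j na → R.greatest (root j) (root-Inv j) (ℤₚ.≮⇒≥ na)
    where
    module R = Perp (perpendicular (length C) refl cword-distinct V̂.srt V̂.red (root i) (root-Inv i))
    above : u ⊑ R.perp
    above t it with position t (below-v uI t it)
    ... | l , e = R.greatest t (below-v uI t it) (subst (_≤ 0ℤ) (E-≋ C (≋-refl {ρ (root i)}) (≋-sym e))
            (ℤₚ.≮⇒≥ (h l (Inv-≃ u t (root l) e it))))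

  ar-ord : ∀ j i → ar j i → i Fin.≤ j
  ar-ord j i a with i Finₚ.≤? j
  ... | yes h = h
  ... | no h = ⊥-elim (ℤₚ.≤⇒≯ (AllPairs-lookup (E-ordered cword-distinct V̂.srt V̂.red) j i (ℕₚ.≰⇒> h)) a)

  ⊑-of : ∀ {x y : I} → proj₁ x ~ proj₁ y → x ≤I y
  ⊑-of e = ⊑⇒WeakLe (λ t i → Inv-~ e t i)

  open GaloisLattice (_≈I_ {c} {u} {v}) (_≤I_ {c} {u} {v}) K X (λ x i → Inv? (proj₁ x) (root i)) ar ar?
    (λ {x} {y} h i p → WeakLe⇒⊑ h (root i) p) (λ {x} {y} h → ⊑⇒WeakLe (X⇒⊑ {x} {y} h))
    (λ {x} {y} e → ⊑-of {x} {y} e) (λ {x} {y} e → ⊑-of {y} {x} (~sym e))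
    (λ h k → ⊑-antisym (WeakLe⇒⊑ h) (WeakLe⇒⊑ k))
    (λ i → E-diagonal cword-distinct V̂.srt V̂.red (root i) (root-Inv i)) ar-ord uI vI
    (λ x → proj₁ (proj₂ (proj₂ x))) (λ i → Inv-~ V̂.rep (root i) (root-Inv i))
    sep witness meetI perpI public using (trim; distributive)

theorem1p1 : ∀ {n : ℕ} (M : CoxeterMatrix n) (c : Fin n → Fin n)
    → Injective _≡_ _≡_ c → Coxeter.Reduced M (Coxeter.cword M c)
    → ∀ u v → Coxeter.Sortable M c u → Coxeter.Sortable M c v → Coxeter.WeakLe M u v
    → PosetNotions.Trim (Coxeter._≈I_ M {c} {u} {v}) (Coxeter._≤I_ M {c} {u} {v})
    × (PosetNotions.Graded (Coxeter._≈I_ M {c} {u} {v}) (Coxeter._≤I_ M {c} {u} {v})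
    → PosetNotions.Distributive (Coxeter._≈I_ M {c} {u} {v}) (Coxeter._≤I_ M {c} {u} {v}))
theorem1p1 M c c-inj _ u v su sv u≤v = trim , distributive
  where open CambrianInterval M c c-inj u v su sv u≤v
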